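{- Let $\lambda=(\lambda_1,\lambda_2,\dots)$ be a partition of $n$, let $T$ be the Young tableau of shape $2\lambda=(2\lambda_1,2\lambda_2,\dots)$ whose boxes are filled with $1,\dots,2n$ consecutively along the rows, and let $S=\{\{1,2\},\{3,4\},\dots,\{2n-1,2n\}\}$. Call a couple $(S_1,S_2)$ of pair-partitions of $[2n]$ $T$-admissible if the permutation $S\circ S_1$ preserves each column of $T$ and $S_2$ preserves each row of $T$ (permutations of $[2n]$ being viewed as permutations of the boxes of $T$). Then the zonal polynomial satisfies $$Z_\lambda=\sum_{(S_1,S_2)\ T\text{ -admissible}} (-1)^{\mathcal{L}(S,S_1)}\, p_{\mathcal{L}(S_1,S_2)}.$$
   Context: A pair-partition of $[2n]=\{1,\dots,2n\}$ is a set of pairwise disjoint two-element subsets whose union is $[2n]$; it is identified with the fixed-point-free involution of $[2n]$ sending each element to its partner. For two pair-partitions $S_1,S_2$ of $[2n]$, $\mathcal{L}(S_1,S_2)$ is the bipartite graph with one black vertex for each pair of $S_1$, one white vertex for each pair of $S_2$, and, for each $i\in[2n]$, an edge labeled $i$ joining the pair of $S_1$ containing $i$ to the pair of $S_2$ containing $i$. Every vertex has degree 2, so $\mathcal{L}(S_1,S_2)$ is a disjoint union of loops of even lengths $2\ell_1\ge 2\ell_2\ge\cdots$; the partition $(\ell_1,\ell_2,\dots)$ is the type of $(S_1,S_2)$, and $|\mathcal{L}(S_1,S_2)|$ denotes the number of loops. The sign is $(-1)^{\mathcal{L}(S_1,S_2)}=(-1)^{n-|\mathcal{L}(S_1,S_2)|}$,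 and $p_{\mathcal{L}(S_1,S_2)}=p_{\ell_1}p_{\ell_2}\cdots$ is the power-sum symmetric function, $p_m=\sum_j z_j^m$. $Z_\lambda$ is the zonal polynomial in Macdonald's normalization (Macdonald, Symmetric functions and Hall polynomials, VII (2.13)); equivalently the Jack polynomial $J^{(2)}_\lambda$ in Macdonald's $J$-normalization. -}

module Defs where

open import Data.Bool using (Bool; if_then_else_; _∨_)
open import Data.Fin using (Fin; toℕ; combine; remQuot; opposite)
import Data.Fin as Fin
open import Data.Fin.Properties
  using (all?; combine-remQuot; remQuot-combine; combine-injective; opposite-involutive)
open import Data.Integer using (+_)
open import Data.List
  using (List; []; _∷_; map; mapMaybe; concatMap; filter; filterᵇ; foldr; length; replicate;
         take; upTo; allFin; cartesianProduct; cartesianProductWith)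
open import Data.List.Properties using (≡-dec)
open import Data.List.Relation.Unary.All using (All)
import Data.List.Relation.Unary.All as All
open import Data.List.Relation.Unary.Linked using (Linked; linked?)
open import Data.List.Sort.InsertionSort.Base using (sort)
open import Data.Maybe using (Maybe; just; nothing)
open import Data.Nat
  using (ℕ; zero; suc; _+_; _*_; _∸_; _^_; _!; _≤_; _≥_; _<_; _≤?_; _≥?_; _<?_; ⌊_/2⌋)
import Data.Nat as ℕ
open import Data.Nat.ListAction using (sum; product)
import Data.Nat.Properties as ℕₚ
open import Data.Product using (_×_; _,_; proj₁; proj₂; uncurry)
open import Data.Rational using (ℚ; 0ℚ; 1ℚ)
import Data.Rational as ℚ
open import Data.Vec using (Vec; []; _∷_; lookup; tabulate)
open import Data.Vec.Properties using (lookup∘tabulate)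
open import Function using (_∘_)
open import Relation.Binary.PropositionalEquality
  using (_≡_; _≢_; sym; trans; cong; module ≡-Reasoning)
open import Relation.Nullary using (¬_; Dec; yes; no; does; ¬?)
open import Relation.Nullary.Decidable using (_×-dec_)

------------------------------------------------------------------------
-- Integer partitions

record Partition (n : ℕ) : Set where
  constructor mkPartition
  field
    parts       : List ℕ
    .positive   : All (0 <_) parts
    .decreasing : Linked _≥_ parts
    .total      : sum parts ≡ n

open Partition public

-- All lists of positive integers with sum n, each once.
compositions : ℕ → List (List ℕ)
compositions zero    = [] ∷ []
compositions (suc n) = concatMap extend (compositions n)
  where
  extend : List ℕ → List (List ℕ)
  extend []       = (1 ∷ []) ∷ []
  extend (k ∷ ks) = (1 ∷ k ∷ ks) ∷ (suc k ∷ ks) ∷ []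

toPartition : ∀ {n} → List ℕ → Maybe (Partition n)
toPartition {n} ks
  with All.all? (0 <?_) ks | linked? _≥?_ ks | sum ks ℕ.≟ n
... | yes pos | yes dec | yes tot = just (mkPartition ks pos dec tot)
... | _       | _       | _       = nothing

partitions : ∀ n → List (Partition n)
partitions n = mapMaybe toPartition (compositions n)

infix 4 _⊴_

_⊴_ : ∀ {n} → Partition n → Partition n → Set
μ ⊴ ν = ∀ k → sum (take k (parts μ)) ≤ sum (take k (parts ν))

multiplicity : ℕ → List ℕ → ℕ
multiplicity m ks = length (filter (m ℕ.≟_) ks)

-- z_ρ = ∏_{i ≥ 1} i^{mᵢ} mᵢ!, where mᵢ is the number of parts of ρ equal to i.
z : ∀ {n} → Partition n → ℕ
z {n} ρ = product (map (factor ∘ suc) (upTo n))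
  where
  factor : ℕ → ℕ
  factor i = i ^ multiplicity i (parts ρ) * multiplicity i (parts ρ) !

------------------------------------------------------------------------
-- Symmetric functions over ℚ

fromℕ : ℕ → ℚ
fromℕ k = + k ℚ./ 1

∑ : ∀ {A : Set} → List A → (A → ℚ) → ℚ
∑ xs f = foldr (λ x s → f x ℚ.+ s) 0ℚ xs

-- A homogeneous symmetric function of degree n over ℚ.  The products
-- p_ρ, for ρ a partition of n, form a ℚ-basis; F stands for ∑_ρ F(ρ) p_ρ.
SymFun : ℕ → Set
SymFun n = Partition n → ℚ

infix 4 _≈_

_≈_ : ∀ {n} → SymFun n → SymFun n → Set
F ≈ G = ∀ ρ → F ρ ≡ G ρ

infixr 7 _•_

_•_ : ∀ {n} → ℚ → SymFun n → SymFun n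
(c • F) ρ = c ℚ.* F ρ

Sum : ∀ {A : Set} {n} → List A → (A → SymFun n) → SymFun n
Sum xs F ρ = ∑ xs (λ x → F x ρ)

-- The product p_{k₁} p_{k₂} ⋯ for positive k₁, k₂, … with sum n, in any order.
p : ∀ {n} → List ℕ → SymFun n
p ks ρ = if does (≡-dec ℕ._≟_ (sort′ ks) (sort′ (parts ρ))) then 1ℚ else 0ℚ
  where
  sort′ : List ℕ → List ℕ
  sort′ = sort ℕₚ.≤-decTotalOrder

-- A list of exponents e₁, …, e_k stands for the monomial z₁^{e₁} ⋯ z_k^{e_k}.
-- quotients m e lists its quotients by those powers z_j^m, j ≤ k, that divide it.
quotients : ℕ → List ℕ → List (List ℕ)
quotients m []      = []
quotients m (a ∷ e) =
  (if does (m ≤? a) then (λ es → ((a ∸ m) ∷ e) ∷ es) else (λ es → es))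
    (map (a ∷_) (quotients m e))

-- The coefficient of a monomial in p_{k₁} p_{k₂} ⋯, where p_m = ∑_j z_j^m.
-- Variables beyond those in the exponent list do not contribute, as kᵢ > 0.
powerSumCoeff : List ℕ → List ℕ → ℕ
powerSumCoeff []       e = if does (sum e ℕ.≟ 0) then 1 else 0
powerSumCoeff (m ∷ ks) e = sum (map (powerSumCoeff ks) (quotients m e))

-- Since the coefficients are symmetric, coeff (parts μ) F is also the
-- coefficient of the monomial symmetric function m_μ in F.
coeff : ∀ {n} → List ℕ → SymFun n → ℚ
coeff {n} e F = ∑ (partitions n) (λ ρ → F ρ ℚ.* fromℕ (powerSumCoeff (parts ρ) e))

-- The Jack scalar product ⟨p_ρ , p_σ⟩ = δ_{ρσ} z_ρ α^{ℓ(ρ)} at α = 2.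
⟨_,_⟩ : ∀ {n} → SymFun n → SymFun n → ℚ
⟨_,_⟩ {n} F G =
  ∑ (partitions n) (λ ρ → F ρ ℚ.* G ρ ℚ.* fromℕ (z ρ * 2 ^ length (parts ρ)))

-- The zonal polynomials Z_λ = J_λ^{(2)}: the unique family that is
-- triangular in the monomial basis for dominance, orthogonal for the Jack
-- scalar product at α = 2, and whose coefficient of z₁ z₂ ⋯ z_n is n!.  Only
-- p₁ⁿ contains that monomial, so p₁ⁿ has coefficient 1 in Z_λ, as it does in
-- Z_λ = |H_n| ∑_ρ z_{2ρ}⁻¹ ω^λ_ρ p_ρ (ω^λ is 1 at the identity).
record IsZonal (Z : ∀ {n} → Partition n → SymFun n) : Set where
  field
    triangular : ∀ {n} (la μ : Partition n) → ¬ (μ ⊴ la) → coeff (parts μ) (Z la) ≡ 0ℚ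
    orthogonal : ∀ {n} (la μ : Partition n) → la ≢ μ → ⟨ Z la , Z μ ⟩ ≡ 0ℚ
    normalised : ∀ {n} (la : Partition n) → coeff (replicate n 1) (Z la) ≡ fromℕ (n !)

------------------------------------------------------------------------
-- Pair-partitions; i ∈ {1,…,2n} is the element of Fin (n * 2) of value i - 1

record PairPartition (n : ℕ) : Set where
  constructor mkPairPartition
  field
    partner         : Vec (Fin (n * 2)) (n * 2)
    .involutive     : ∀ i → lookup partner (lookup partner i) ≡ i
    .fixedPointFree : ∀ i → lookup partner i ≢ i

open PairPartition public

⟦_⟧ : ∀ {n} → PairPartition n → Fin (n * 2) → Fin (n * 2)
⟦ S ⟧ = lookup (partner S)

tuples : ∀ {A : Set} → List A → ∀ k → List (Vec A k)
tuples xs zero    = [] ∷ []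
tuples xs (suc k) = cartesianProductWith _∷_ xs (tuples xs k)

toPairPartition : ∀ {n} → Vec (Fin (n * 2)) (n * 2) → Maybe (PairPartition n)
toPairPartition v
  with all? (λ i → lookup v (lookup v i) Fin.≟ i) | all? (λ i → ¬? (lookup v i Fin.≟ i))
... | yes inv | yes fpf = just (mkPairPartition v inv fpf)
... | _       | _       = nothing

pairPartitions : ∀ n → List (PairPartition n)
pairPartitions n = mapMaybe toPairPartition (tuples (allFin (n * 2)) (n * 2))

-- Exchanges 2q and 2q + 1 (elements of Fin (n * 2)) for every q < n.
swap : ∀ {n} → Fin (n * 2) → Fin (n * 2)
swap {n} i = combine (proj₁ (remQuot {n} 2 i)) (opposite (proj₂ (remQuot {n} 2 i)))

private
  swap-involutive : ∀ {n} (i : Fin (n * 2)) → swap {n} (swap {n} i) ≡ i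
  swap-involutive {n} i = begin
    combine (proj₁ (remQuot {n} 2 (swap {n} i))) (opposite (proj₂ (remQuot {n} 2 (swap {n} i))))
      ≡⟨ cong (λ qr → combine (proj₁ qr) (opposite (proj₂ qr))) (remQuot-combine {n} {2} _ _) ⟩
    combine (proj₁ (remQuot {n} 2 i)) (opposite (opposite (proj₂ (remQuot {n} 2 i))))
      ≡⟨ cong (combine (proj₁ (remQuot {n} 2 i))) (opposite-involutive _) ⟩
    uncurry combine (remQuot {n} 2 i)
      ≡⟨ combine-remQuot {n} 2 i ⟩
    i ∎
    where open ≡-Reasoning

  opposite₂-fpf : (r : Fin 2) → opposite r ≢ r
  opposite₂-fpf Fin.zero           ()
  opposite₂-fpf (Fin.suc Fin.zero) ()

  swap-fpf : ∀ {n} (i : Fin (n * 2)) → swap {n} i ≢ i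
  swap-fpf {n} i eq = opposite₂-fpf _ (proj₂ (combine-injective {n} {2} _ _ _ _
    (trans eq (sym (combine-remQuot {n} 2 i)))))

-- S = {{1,2},{3,4},…,{2n-1,2n}}
standard : ∀ n → PairPartition n
standard n = mkPairPartition (tabulate swap′) inv fpf
  where
  swap′ : Fin (n * 2) → Fin (n * 2)
  swap′ = swap {n}
  at : ∀ i → lookup (tabulate swap′) i ≡ swap′ i
  at = lookup∘tabulate swap′
  inv : ∀ i → lookup (tabulate swap′) (lookup (tabulate swap′) i) ≡ i
  inv i = trans (at _) (trans (cong swap′ (at i)) (swap-involutive {n} i))
  fpf : ∀ i → lookup (tabulate swap′) i ≢ i
  fpf i eq = swap-fpf {n} i (trans (sym (at i)) eq)

------------------------------------------------------------------------
-- The graph 𝓛(S₁,S₂), handled through its edges, which are the elements of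
-- Fin (n * 2).  The edges sharing the black (white) vertex of edge i are i
-- itself and its partner in S₁ (in S₂).

-- Whether edges i and j are linked by at most k steps between edges
-- sharing a vertex.
linked : ∀ {n} → PairPartition n → PairPartition n → ℕ → Fin (n * 2) → Fin (n * 2) → Bool
linked S₁ S₂ zero    i j = does (i Fin.≟ j)
linked S₁ S₂ (suc k) i j =
  linked S₁ S₂ k i j ∨ linked S₁ S₂ k (⟦ S₁ ⟧ i) j ∨ linked S₁ S₂ k (⟦ S₂ ⟧ i) j

-- The edges of the loop through i; the graph has n * 2 edges, so that many
-- steps reach all of it.
loopEdges : ∀ {n} → PairPartition n → PairPartition n → Fin (n * 2) → List (Fin (n * 2))
loopEdges {n} S₁ S₂ i = filterᵇ (linked S₁ S₂ (n * 2) i) (allFin (n * 2))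

-- One edge from each loop: the smallest.
loopRepresentatives : ∀ {n} → PairPartition n → PairPartition n → List (Fin (n * 2))
loopRepresentatives {n} S₁ S₂ =
  filter (λ i → All.all? (λ j → i Fin.≤? j) (loopEdges S₁ S₂ i)) (allFin (n * 2))

-- The half-lengths ℓ₁, ℓ₂, … of the loops, in no particular order.
loops : ∀ {n} → PairPartition n → PairPartition n → List ℕ
loops S₁ S₂ = map (λ i → ⌊ length (loopEdges S₁ S₂ i) /2⌋) (loopRepresentatives S₁ S₂)

-1^_ : ℕ → ℚ
-1^ zero  = 1ℚ
-1^ suc k = ℚ.- (-1^ k)

sign : ∀ {n} → PairPartition n → PairPartition n → ℚ
sign {n} S₁ S₂ = -1^ (n ∸ length (loops S₁ S₂))

------------------------------------------------------------------------
-- Tableaux and admissible couples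

-- The (row , column) of the box numbered m, numbering from 0 along the rows,
-- in the diagram with given row lengths (for m less than their sum).
box : List ℕ → ℕ → ℕ × ℕ
box []       m = 0 , m
box (r ∷ rs) m with m <? r | box rs (m ∸ r)
... | yes _ | _     = 0 , m
... | no  _ | i , j = suc i , j

row column : ∀ {n} → Partition n → Fin (n * 2) → ℕ
row    la i = proj₁ (box (map (2 *_) (parts la)) (toℕ i))
column la i = proj₂ (box (map (2 *_) (parts la)) (toℕ i))

-- Here T is the tableau of shape 2λ filled consecutively along the rows.
Admissible : ∀ {n} → Partition n → PairPartition n × PairPartition n → Set
Admissible {n} la (S₁ , S₂) =
  (∀ i → column la (⟦ standard n ⟧ (⟦ S₁ ⟧ i)) ≡ column la i) ×
  (∀ i → row la (⟦ S₂ ⟧ i) ≡ row la i)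

admissible? : ∀ {n} (la : Partition n) SS → Dec (Admissible la SS)
admissible? {n} la (S₁ , S₂) =
  all? (λ i → column la (⟦ standard n ⟧ (⟦ S₁ ⟧ i)) ℕ.≟ column la i) ×-dec
  all? (λ i → row la (⟦ S₂ ⟧ i) ℕ.≟ row la i)

admissibleCouples : ∀ {n} → Partition n → List (PairPartition n × PairPartition n)
admissibleCouples {n} la =
  filter (admissible? la) (cartesianProduct (pairPartitions n) (pairPartitions n))

-- Let Y_λ be the right-hand side.  It satisfies the three conditions that
-- characterise the zonal polynomials, and these conditions have one solution.
--
-- Triangularity.  The coefficient of z^e in p_{𝓛(S₁,S₂)} is the number of
-- colourings of [2n] with content 2e that are invariant under S₁ and S₂.  If e
-- is not dominated by λ, then every such colouring repeats a colour at two
-- boxes a, b of some column of T; conjugating S₁ by the transposition (a b)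
-- changes the number of loops of 𝓛(S,S₁) by one, so the signs cancel.
--
-- Orthogonality.  ⟨ p_{𝓛(S₁,S₂)} , p_{𝓛(T₁,T₂)} ⟩ is the number of permutations
-- w with w S₁ = T₁ w and w S₂ = T₂ w.  If μ is not dominated by λ, then w sends
-- two boxes a, b of some column of the tableau of 2λ to the same row of that of
-- 2μ.  With t = (a b) and u = (w(a) w(b)), the map
-- (S₁, S₂, T₁, T₂, w) ↦ (t S₁ t, S₂, T₁, u T₂ u, w t) cancels the summands of
-- ⟨ Y_λ , Y_μ ⟩.
--
-- Normalisation.  Only S₁ = S₂ contributes to p₁ⁿ, and admissibility then
-- leaves S₁ = S₂ = S.
--
-- Uniqueness.  For a down-closed set of partitions κ, a symmetric function whose
-- monomials are of types in the set and which is orthogonal to all Z_κ is zero: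
-- add the partitions one by one along a linear extension of dominance.

module Submission where

import Defs
open import Defs hiding (∑; fromℕ)
import Algebra.Solver.Ring.AlmostCommutativeRing as ACR
open import Algebra.Structures using (IsCommutativeRing)
open import Data.Bool using (Bool; true; false; if_then_else_; not; _∨_; _xor_)
open import Data.Bool.Properties using (not-involutive; ¬-not)
open import Data.Fin using (Fin; toℕ; fromℕ<)
import Data.Fin as Fin
import Data.Fin.Properties as Finₚ
import Data.Integer as ℤ
import Data.Integer.Properties as ℤₚ
open import Data.List
  using (List; []; _∷_; _++_; map; mapMaybe; concatMap; filter; length; replicate;
         take; upTo; allFin; cartesianProduct; cartesianProductWith)
import Data.List as List
import Data.List.Properties as Listₚ
open import Data.List.Membership.Propositional using (_∈_; _∉_)
import Data.List.Membership.Propositional.Properties as Memₚ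
open import Data.List.Relation.Binary.Permutation.Propositional using (_↭_; ↭-sym; ↭-trans; ↭-refl)
import Data.List.Relation.Binary.Permutation.Propositional as Perm
import Data.List.Relation.Binary.Permutation.Propositional.Properties as Permₚ
open import Data.List.Relation.Unary.All using (All; []; _∷_)
import Data.List.Relation.Unary.All as All
import Data.List.Relation.Unary.All.Properties as Allₚ
open import Data.List.Relation.Unary.Any using (Any; here; there)
import Data.List.Relation.Unary.Any as Any
import Data.List.Relation.Unary.Any.Properties as Anyₚ
open import Data.List.Relation.Unary.Unique.Propositional using (Unique)
import Data.List.Relation.Unary.Unique.Propositional.Properties as Uniqueₚ
open import Data.List.Relation.Unary.Linked using (Linked; linked?)
open import Data.List.Relation.Unary.AllPairs using (AllPairs; []; _∷_)
import Data.List.Relation.Unary.AllPairs as AllPairs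
import Data.List.Relation.Unary.AllPairs.Properties as AllPairsₚ
import Data.List.Relation.Unary.Linked.Properties as Linkedₚ
open import Data.List.Sort.InsertionSort.Base using (sort)
open import Data.List.Relation.Binary.Pointwise using (Pointwise-≡⇒≡)
import Data.List.Relation.Unary.Sorted.TotalOrder.Properties as Sortedₚ
import Data.List.Sort.InsertionSort.Properties as InsertionSortₚ
open import Data.Maybe using (Maybe; just; nothing)
open import Data.Nat using (ℕ; zero; suc; _≤_; _<_; _≥_; z≤n; s≤s; _∸_; ⌊_/2⌋; _!; _^_)
import Data.Nat as ℕ
open import Data.Nat.DivMod using (m≡m%n+[m/n]*n; m%n<n)
import Data.Nat.Properties as ℕₚ
open import Data.Nat.ListAction using (sum; product)
open import Data.Nat.ListAction.Properties using (sum-↭)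
import Data.Nat.Tactic.RingSolver as ℕ-solver
open import Data.Product using (∃; ∃₂; _×_; _,_; proj₁; proj₂)
open import Data.Rational using (ℚ; 0ℚ; 1ℚ)
import Data.Rational as ℚ
import Data.Rational.Properties as ℚₚ
open import Data.Rational.Unnormalised using (mkℚᵘ; *≡*; *≤*; *<*) renaming (_≃_ to _≃ᵘ_)
import Data.Rational.Unnormalised.Properties as ℚᵘₚ
open import Data.Sum using (_⊎_; inj₁; inj₂; [_,_]′)
open import Data.Vec using (Vec; []; _∷_; lookup; tabulate)
import Data.Vec as Vec
import Data.Vec.Properties as Vecₚ
open import Function using (_∘_; id; case_of_; Equivalence)
open import Level using (0ℓ)
import Relation.Binary.Bundles
import Relation.Binary.Construct.Flip.EqAndOrd
import Relation.Binary.Construct.On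
open import Relation.Binary.Definitions using (DecidableEquality; tri<; tri≈; tri>)
open import Relation.Binary.PropositionalEquality
  using (_≡_; _≢_; refl; sym; trans; cong; cong₂; subst; subst₂; module ≡-Reasoning)
open import Relation.Nullary using (¬_; Dec; yes; no; does; contradiction; ¬?)
open import Relation.Nullary.Decidable using (_×-dec_; _→-dec_; map′; dec-true; dec-false; dec⇒maybe; recompute)

-- The operations of ℚ reduce even on variables, which defeats the inference of
-- implicit arguments; hence the opaque copies.

infixl 6 _+_
infixl 7 _*_
infix  8 -_

opaque

  _+_ _*_ : ℚ → ℚ → ℚ
  _+_ = ℚ._+_
  _*_ = ℚ._*_

  -_ : ℚ → ℚ
  -_ = ℚ.-_

  fromℕ : ℕ → ℚ
  fromℕ = Defs.fromℕ

  𝟙 : ∀ {P : Set} → Dec P → ℚ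
  𝟙 P? = if does P? then 1ℚ else 0ℚ

∑ : ∀ {A : Set} → List A → (A → ℚ) → ℚ
∑ []       f = 0ℚ
∑ (x ∷ xs) f = f x + ∑ xs f

opaque
  unfolding _+_ _*_ -_ fromℕ 𝟙

  +≡ : ∀ a b → a ℚ.+ b ≡ a + b
  +≡ a b = refl

  *≡ : ∀ a b → a ℚ.* b ≡ a * b
  *≡ a b = refl

  -≡ : ∀ a → ℚ.- a ≡ - a
  -≡ a = refl

  ∑≡ : ∀ {A : Set} (xs : List A) f → Defs.∑ xs f ≡ ∑ xs f
  ∑≡ []       f = refl
  ∑≡ (x ∷ xs) f = cong (f x +_) (∑≡ xs f)

  fromℕ≡ : ∀ k → Defs.fromℕ k ≡ fromℕ k
  fromℕ≡ k = refl

  𝟙≡ : ∀ {P : Set} (P? : Dec P) → (if does P? then 1ℚ else 0ℚ) ≡ 𝟙 P?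
  𝟙≡ P? = refl

  +-*-isCommutativeRing : IsCommutativeRing _≡_ _+_ _*_ -_ 0ℚ 1ℚ
  +-*-isCommutativeRing = ℚₚ.+-*-isCommutativeRing

  +-mono-≤ : ∀ {a b c d} → a ℚ.≤ b → c ℚ.≤ d → a + c ℚ.≤ b + d
  +-mono-≤ = ℚₚ.+-mono-≤

  +-mono-<-≤ : ∀ {a b c d} → a ℚ.< b → c ℚ.≤ d → a + c ℚ.< b + d
  +-mono-<-≤ = ℚₚ.+-mono-<-≤

  neg⇒pos : ∀ {a} → a ℚ.< 0ℚ → 0ℚ ℚ.< - a
  neg⇒pos = ℚₚ.neg-antimono-<

  pos⇒neg : ∀ {a} → 0ℚ ℚ.< a → - a ℚ.< 0ℚ
  pos⇒neg = ℚₚ.neg-antimono-<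

  *-pos : ∀ {a b} → 0ℚ ℚ.< a → 0ℚ ℚ.< b → 0ℚ ℚ.< a * b
  *-pos {a} {b} 0<a 0<b = subst (ℚ._< a ℚ.* b) (ℚₚ.*-zeroʳ a)
    (ℚₚ.*-monoʳ-<-pos a {{ℚ.positive 0<a}} 0<b)

  𝟙-yes : {P : Set} (P? : Dec P) → P → 𝟙 P? ≡ 1ℚ
  𝟙-yes P? p rewrite dec-true P? p = refl

  𝟙-no : {P : Set} (P? : Dec P) → ¬ P → 𝟙 P? ≡ 0ℚ
  𝟙-no P? ¬p rewrite dec-false P? ¬p = refl

  fromℕ-0 : fromℕ 0 ≡ 0ℚ
  fromℕ-0 = refl

  fromℕ-1 : fromℕ 1 ≡ 1ℚ
  fromℕ-1 = refl

  private
    toℚᵘ-fromℕ : ∀ k → ℚ.toℚᵘ (fromℕ k) ≃ᵘ mkℚᵘ (ℤ.+ k) 0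
    toℚᵘ-fromℕ k = ℚₚ.toℚᵘ-fromℚᵘ (mkℚᵘ (ℤ.+ k) 0)

  fromℕ-+ : ∀ a b → fromℕ (a ℕ.+ b) ≡ fromℕ a + fromℕ b
  fromℕ-+ a b = ℚₚ.toℚᵘ-injective (ℚᵘₚ.≃-trans (toℚᵘ-fromℕ (a ℕ.+ b))
    (ℚᵘₚ.≃-trans (*≡* (cong (ℤ._* (ℤ.+ 1)) (sym (cong₂ ℤ._+_ (ℤₚ.*-identityʳ (ℤ.+ a)) (ℤₚ.*-identityʳ (ℤ.+ b))))))
    (ℚᵘₚ.≃-sym (ℚᵘₚ.≃-trans (ℚₚ.toℚᵘ-homo-+ (fromℕ a) (fromℕ b))
      (ℚᵘₚ.+-cong (toℚᵘ-fromℕ a) (toℚᵘ-fromℕ b))))))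

  fromℕ-* : ∀ a b → fromℕ (a ℕ.* b) ≡ fromℕ a * fromℕ b
  fromℕ-* a b = ℚₚ.toℚᵘ-injective (ℚᵘₚ.≃-trans (toℚᵘ-fromℕ (a ℕ.* b))
    (ℚᵘₚ.≃-trans (*≡* (cong (ℤ._* (ℤ.+ 1)) (ℤₚ.pos-* a b)))
    (ℚᵘₚ.≃-sym (ℚᵘₚ.≃-trans (ℚₚ.toℚᵘ-homo-* (fromℕ a) (fromℕ b))
      (ℚᵘₚ.*-cong (toℚᵘ-fromℕ a) (toℚᵘ-fromℕ b))))))

  fromℕ-cancel-≤ : ∀ {a b} → fromℕ a ℚ.≤ fromℕ b → a ≤ b
  fromℕ-cancel-≤ {a} {b} le
    with ℚᵘₚ.≤-respˡ-≃ (toℚᵘ-fromℕ a) (ℚᵘₚ.≤-respʳ-≃ (toℚᵘ-fromℕ b) (ℚₚ.toℚᵘ-mono-≤ le))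
  ... | *≤* a≤b = ℤₚ.drop‿+≤+ (subst₂ ℤ._≤_ (ℤₚ.*-identityʳ _) (ℤₚ.*-identityʳ _) a≤b)

  fromℕ-pos : ∀ k → 0ℚ ℚ.< fromℕ (suc k)
  fromℕ-pos k = ℚₚ.toℚᵘ-cancel-< (ℚᵘₚ.<-respʳ-≃ (ℚᵘₚ.≃-sym (toℚᵘ-fromℕ (suc k))) (*<* (ℤ.+<+ (s≤s z≤n))))

fromℕ-injective : ∀ {a b} → fromℕ a ≡ fromℕ b → a ≡ b
fromℕ-injective eq = ℕₚ.≤-antisym (fromℕ-cancel-≤ (ℚₚ.≤-reflexive eq)) (fromℕ-cancel-≤ (ℚₚ.≤-reflexive (sym eq)))

open IsCommutativeRing +-*-isCommutativeRing using
  ( +-assoc; +-comm; +-identityˡ; +-identityʳ; *-assoc; *-comm; *-identityˡ; *-identityʳ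
  ; zeroˡ; zeroʳ; distribˡ; distribʳ; -‿inverseˡ; -‿inverseʳ )

private
  module Ring where
    ring : ACR.AlmostCommutativeRing 0ℓ 0ℓ
    ring = ACR.fromCommutativeRing (record { isCommutativeRing = +-*-isCommutativeRing })

    identity : ACR._-Raw-AlmostCommutative⟶_
      (ACR.AlmostCommutativeRing.rawRing (ACR.fromCommutativeRing ℚₚ.+-*-commutativeRing)) ring
    identity = record
      { ⟦_⟧    = id
      ; +-homo = +≡
      ; *-homo = *≡
      ; -‿homo = -≡
      ; 0-homo = refl
      ; 1-homo = refl
      }

    open import Algebra.Solver.Ring _ ring identity (λ x y → dec⇒maybe (x ℚ.≟ y)) public

open Ring using (solve; _:=_; _:+_; _:*_; :-_)

zero-+ : ∀ {a} b → a ≡ 0ℚ → a + b ≡ b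
zero-+ b refl = +-identityˡ b

neg-+ : ∀ a b → - (a + b) ≡ - a + - b
neg-+ = solve 2 (λ a b → :- (a :+ b) := :- a :+ :- b) refl

-- Finite sums and indicators

module _ {A : Set} where

  ∑-cong-∈ : ∀ (xs : List A) {f g : A → ℚ} → (∀ {x} → x ∈ xs → f x ≡ g x) → ∑ xs f ≡ ∑ xs g
  ∑-cong-∈ []       eq = refl
  ∑-cong-∈ (x ∷ xs) eq = cong₂ _+_ (eq (here refl)) (∑-cong-∈ xs (eq ∘ there))

  ∑-cong : ∀ (xs : List A) {f g : A → ℚ} → (∀ x → f x ≡ g x) → ∑ xs f ≡ ∑ xs g
  ∑-cong xs eq = ∑-cong-∈ xs (λ {x} _ → eq x)

  ∑-zero : ∀ (xs : List A) {f : A → ℚ} → (∀ x → f x ≡ 0ℚ) → ∑ xs f ≡ 0ℚ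
  ∑-zero []       eq = refl
  ∑-zero (x ∷ xs) eq = trans (cong₂ _+_ (eq x) (∑-zero xs eq)) (+-identityˡ 0ℚ)

  ∑-+ : ∀ (xs : List A) (f g : A → ℚ) → ∑ xs (λ x → f x + g x) ≡ ∑ xs f + ∑ xs g
  ∑-+ []       f g = sym (+-identityˡ 0ℚ)
  ∑-+ (x ∷ xs) f g = trans (cong (f x + g x +_) (∑-+ xs f g)) (interchange (f x) (g x) _ _)
    where
    interchange : ∀ a b c d → (a + b) + (c + d) ≡ (a + c) + (b + d)
    interchange = solve 4 (λ a b c d → (a :+ b) :+ (c :+ d) := (a :+ c) :+ (b :+ d)) refl

  ∑-*ˡ : ∀ c (xs : List A) (f : A → ℚ) → c * ∑ xs f ≡ ∑ xs (λ x → c * f x)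
  ∑-*ˡ c []       f = zeroʳ c
  ∑-*ˡ c (x ∷ xs) f = trans (distribˡ c (f x) _) (cong (c * f x +_) (∑-*ˡ c xs f))

  ∑-*ʳ : ∀ c (xs : List A) (f : A → ℚ) → ∑ xs f * c ≡ ∑ xs (λ x → f x * c)
  ∑-*ʳ c xs f =
    trans (*-comm _ c) (trans (∑-*ˡ c xs f) (∑-cong xs (λ x → *-comm c (f x))))

  ∑-neg : ∀ (xs : List A) (f : A → ℚ) → ∑ xs (λ x → - f x) ≡ - ∑ xs f
  ∑-neg []       f = -≡ 0ℚ
  ∑-neg (x ∷ xs) f = trans (cong (- f x +_) (∑-neg xs f)) (sym (neg-+ (f x) _))

  ∑-mono : ∀ (xs : List A) {f g : A → ℚ} → (∀ x → f x ℚ.≤ g x) → ∑ xs f ℚ.≤ ∑ xs g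
  ∑-mono []       le = ℚₚ.≤-refl
  ∑-mono (x ∷ xs) le = +-mono-≤ (le x) (∑-mono xs le)

  ∑-nonneg : ∀ (xs : List A) {f : A → ℚ} → (∀ x → 0ℚ ℚ.≤ f x) → 0ℚ ℚ.≤ ∑ xs f
  ∑-nonneg []       le = ℚₚ.≤-refl
  ∑-nonneg (x ∷ xs) {f} le =
    subst (ℚ._≤ f x + ∑ xs f) (+-identityˡ 0ℚ) (+-mono-≤ (le x) (∑-nonneg xs le))

  ∑-++ : ∀ (xs ys : List A) (f : A → ℚ) → ∑ (xs ++ ys) f ≡ ∑ xs f + ∑ ys f
  ∑-++ []       ys f = sym (+-identityˡ _)
  ∑-++ (x ∷ xs) ys f = trans (cong (f x +_) (∑-++ xs ys f)) (sym (+-assoc (f x) _ _))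

  ∑-↭ : ∀ {xs ys : List A} (f : A → ℚ) → xs ↭ ys → ∑ xs f ≡ ∑ ys f
  ∑-↭ f Perm.refl           = refl
  ∑-↭ f (Perm.prep x xs↭ys) = cong (f x +_) (∑-↭ f xs↭ys)
  ∑-↭ f (Perm.swap x y xs↭ys) =
    trans (cong (λ s → f x + (f y + s)) (∑-↭ f xs↭ys)) (exchange (f x) (f y) _)
    where
    exchange : ∀ a b c → a + (b + c) ≡ b + (a + c)
    exchange = solve 3 (λ a b c → a :+ (b :+ c) := b :+ (a :+ c)) refl
  ∑-↭ f (Perm.trans xs↭ys ys↭zs) = trans (∑-↭ f xs↭ys) (∑-↭ f ys↭zs)

module _ {A B : Set} where

  ∑-map : ∀ (h : A → B) (xs : List A) (f : B → ℚ) → ∑ (map h xs) f ≡ ∑ xs (f ∘ h)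
  ∑-map h []       f = refl
  ∑-map h (x ∷ xs) f = cong (f (h x) +_) (∑-map h xs f)

  ∑-concatMap : ∀ (h : A → List B) (xs : List A) (f : B → ℚ) →
                ∑ (concatMap h xs) f ≡ ∑ xs (λ x → ∑ (h x) f)
  ∑-concatMap h []       f = refl
  ∑-concatMap h (x ∷ xs) f =
    trans (∑-++ (h x) _ f) (cong (∑ (h x) f +_) (∑-concatMap h xs f))

  ∑-mapMaybe : ∀ (h : A → Maybe B) (xs : List A) (f : B → ℚ) →
               ∑ (mapMaybe h xs) f ≡ ∑ xs (λ x → Data.Maybe.maybe′ f 0ℚ (h x))
  ∑-mapMaybe h []       f = refl
  ∑-mapMaybe h (x ∷ xs) f with h x
  ... | just y  = cong (f y +_) (∑-mapMaybe h xs f)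
  ... | nothing = trans (∑-mapMaybe h xs f) (sym (+-identityˡ _))

  ∑-swap : ∀ (xs : List A) (ys : List B) (f : A → B → ℚ) →
           ∑ xs (λ x → ∑ ys (f x)) ≡ ∑ ys (λ y → ∑ xs (λ x → f x y))
  ∑-swap []       ys f = sym (∑-zero ys (λ _ → refl))
  ∑-swap (x ∷ xs) ys f =
    trans (cong (∑ ys (f x) +_) (∑-swap xs ys f)) (sym (∑-+ ys (f x) _))

  ∑-*-∑ : ∀ (xs : List A) (ys : List B) (f : A → ℚ) (g : B → ℚ) →
          ∑ xs f * ∑ ys g ≡ ∑ xs (λ x → ∑ ys (λ y → f x * g y))
  ∑-*-∑ xs ys f g = trans (∑-*ʳ _ xs f) (∑-cong xs (λ x → ∑-*ˡ (f x) ys g))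

∑-cartesianProductWith : ∀ {A B C : Set} (h : A → B → C) xs ys (f : C → ℚ) →
                         ∑ (cartesianProductWith h xs ys) f ≡ ∑ xs (λ x → ∑ ys (λ y → f (h x y)))
∑-cartesianProductWith h []       ys f = refl
∑-cartesianProductWith h (x ∷ xs) ys f =
  trans (∑-++ (map (h x) ys) _ f)
        (cong₂ _+_ (∑-map (h x) ys f) (∑-cartesianProductWith h xs ys f))

module _ {P : Set} where

  𝟙-*-yes : (P? : Dec P) (x : ℚ) → P → 𝟙 P? * x ≡ x
  𝟙-*-yes P? x p = trans (cong (_* x) (𝟙-yes P? p)) (*-identityˡ x)

  𝟙-*-no : (P? : Dec P) (x : ℚ) → ¬ P → 𝟙 P? * x ≡ 0ℚ
  𝟙-*-no P? x ¬p = trans (cong (_* x) (𝟙-no P? ¬p)) (zeroˡ x)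

  𝟙-guard : (P? : Dec P) {x y : ℚ} → (P → x ≡ y) → 𝟙 P? * x ≡ 𝟙 P? * y
  𝟙-guard (yes p)         eq = cong (𝟙 (yes p) *_) (eq p)
  𝟙-guard (no ¬p) {x} {y} eq = trans (𝟙-*-no (no ¬p) x ¬p) (sym (𝟙-*-no (no ¬p) y ¬p))

  𝟙-nonneg : (P? : Dec P) → 0ℚ ℚ.≤ 𝟙 P?
  𝟙-nonneg (yes p) = subst (0ℚ ℚ.≤_) (sym (𝟙-yes (yes p) p)) (ℚₚ.nonNegative⁻¹ 1ℚ)
  𝟙-nonneg (no ¬p) = ℚₚ.≤-reflexive (sym (𝟙-no (no ¬p) ¬p))

module _ {P Q : Set} where

  𝟙-cong : (P? : Dec P) (Q? : Dec Q) → (P → Q) → (Q → P) → 𝟙 P? ≡ 𝟙 Q?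
  𝟙-cong (yes p) Q? to from = trans (𝟙-yes (yes p) p) (sym (𝟙-yes Q? (to p)))
  𝟙-cong (no ¬p) Q? to from = trans (𝟙-no (no ¬p) ¬p) (sym (𝟙-no Q? (¬p ∘ from)))

  𝟙-mono : (P? : Dec P) (Q? : Dec Q) → (P → Q) → 𝟙 P? ℚ.≤ 𝟙 Q?
  𝟙-mono (yes p) Q? to = ℚₚ.≤-reflexive (trans (𝟙-yes (yes p) p) (sym (𝟙-yes Q? (to p))))
  𝟙-mono (no ¬p) Q? to = subst (ℚ._≤ 𝟙 Q?) (sym (𝟙-no (no ¬p) ¬p)) (𝟙-nonneg Q?)

𝟙-× : ∀ {P Q : Set} (P? : Dec P) (Q? : Dec Q) → 𝟙 (P? ×-dec Q?) ≡ 𝟙 P? * 𝟙 Q?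
𝟙-× P?@(yes p) Q? =
  trans (𝟙-cong (P? ×-dec Q?) Q? proj₂ (p ,_)) (sym (𝟙-*-yes P? (𝟙 Q?) p))
𝟙-× P?@(no ¬p) Q? =
  trans (𝟙-no (P? ×-dec Q?) (¬p ∘ proj₁)) (sym (𝟙-*-no P? (𝟙 Q?) ¬p))

∑-filter : ∀ {A : Set} {P : A → Set} (P? : ∀ x → Dec (P x)) (xs : List A) (f : A → ℚ) →
           ∑ (filter P? xs) f ≡ ∑ xs (λ x → 𝟙 (P? x) * f x)
∑-filter P? []       f = refl
∑-filter P? (x ∷ xs) f with P? x
... | yes p = cong₂ _+_ (sym (𝟙-*-yes (yes p) (f x) p)) (∑-filter P? xs f)
... | no ¬p = trans (∑-filter P? xs f)
                    (sym (zero-+ _ (𝟙-*-no (no ¬p) (f x) ¬p)))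

record Enumeration (A : Set) : Set where
  field
    elements : List A
    _≟_      : DecidableEquality A
    once     : ∀ y → ∑ elements (λ x → 𝟙 (x ≟ y)) ≡ 1ℚ

  ∑-δ : ∀ y (f : A → ℚ) → ∑ elements (λ x → 𝟙 (x ≟ y) * f x) ≡ f y
  ∑-δ y f = begin
    ∑ elements (λ x → 𝟙 (x ≟ y) * f x) ≡⟨ ∑-cong elements (λ x → 𝟙-guard (x ≟ y) (cong f)) ⟩
    ∑ elements (λ x → 𝟙 (x ≟ y) * f y) ≡⟨ sym (∑-*ʳ (f y) elements _) ⟩
    ∑ elements (λ x → 𝟙 (x ≟ y)) * f y ≡⟨ cong (_* f y) (once y) ⟩
    1ℚ * f y                           ≡⟨ *-identityˡ (f y) ⟩
    f y                                ∎
    where open ≡-Reasoning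

  ∑-single : ∀ y (f : A → ℚ) → (∀ x → x ≢ y → f x ≡ 0ℚ) → ∑ elements f ≡ f y
  ∑-single y f vanish = trans (∑-cong elements pick) (∑-δ y f)
    where
    pick : ∀ x → f x ≡ 𝟙 (x ≟ y) * f x
    pick x with x ≟ y
    ... | yes x≡y = sym (𝟙-*-yes (yes x≡y) (f x) x≡y)
    ... | no  x≢y = trans (vanish x x≢y) (sym (𝟙-*-no (no x≢y) (f x) x≢y))

  ∈-elements : ∀ y → y ∈ elements
  ∈-elements y with Any.any? (_≟_ y) elements
  ... | yes y∈ = y∈
  ... | no  y∉ = contradiction (trans (sym (once y)) zero-sum) λ ()
    where
    zero-sum : ∑ elements (λ x → 𝟙 (x ≟ y)) ≡ 0ℚ
    zero-sum = trans
      (∑-cong-∈ elements (λ {x} x∈ → 𝟙-no (x ≟ y) (λ { refl → y∉ x∈ })))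
      (∑-zero elements (λ _ → refl))

open Enumeration using (elements; once; ∑-δ; ∑-single; ∈-elements)

module _ {A B : Set} (EA : Enumeration A) (EB : Enumeration B) {P : A → Set} {Q : B → Set}
         (P? : ∀ a → Dec (P a)) (Q? : ∀ b → Dec (Q b)) where

  private
    _≟A_ = Enumeration._≟_ EA
    _≟B_ = Enumeration._≟_ EB

  ∑-bijection : ∀ (φ : A → B) (ψ : B → A) →
                (∀ a → P a → Q (φ a)) → (∀ b → Q b → P (ψ b)) →
                (∀ a → P a → ψ (φ a) ≡ a) → (∀ b → Q b → φ (ψ b) ≡ b) →
                ∀ (f : A → ℚ) (g : B → ℚ) → (∀ a → P a → f a ≡ g (φ a)) →
                ∑ (elements EA) (λ a → 𝟙 (P? a) * f a) ≡ ∑ (elements EB) (λ b → 𝟙 (Q? b) * g b)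
  ∑-bijection φ ψ Pφ Qψ ψφ φψ f g fg = begin
    ∑ (elements EA) (λ a → 𝟙 (P? a) * f a)
      ≡⟨ ∑-cong (elements EA) (λ a → trans (𝟙-guard (P? a) (λ pa →
           trans (fg a pa) (sym (∑-δ EB (φ a) g)))) (∑-*ˡ _ (elements EB) _)) ⟩
    ∑ (elements EA) (λ a → ∑ (elements EB) (λ b → 𝟙 (P? a) * (𝟙 (b ≟B φ a) * g b)))
      ≡⟨ ∑-swap (elements EA) (elements EB) _ ⟩
    ∑ (elements EB) (λ b → ∑ (elements EA) (λ a → 𝟙 (P? a) * (𝟙 (b ≟B φ a) * g b)))
      ≡⟨ ∑-cong (elements EB) (λ b → trans (∑-cong (elements EA) (λ a → graph a b))
           (∑-δ EA (ψ b) (λ _ → 𝟙 (Q? b) * g b))) ⟩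
    ∑ (elements EB) (λ b → 𝟙 (Q? b) * g b) ∎
    where
    open ≡-Reasoning
    graph : ∀ a b → 𝟙 (P? a) * (𝟙 (b ≟B φ a) * g b) ≡ 𝟙 (a ≟A ψ b) * (𝟙 (Q? b) * g b)
    graph a b = begin
      𝟙 (P? a) * (𝟙 (b ≟B φ a) * g b)
        ≡⟨ sym (*-assoc (𝟙 (P? a)) _ _) ⟩
      𝟙 (P? a) * 𝟙 (b ≟B φ a) * g b
        ≡⟨ cong (_* g b) (trans (sym (𝟙-× (P? a) (b ≟B φ a)))
             (trans (𝟙-cong (P? a ×-dec (b ≟B φ a)) ((a ≟A ψ b) ×-dec Q? b)
               (λ { (pa , refl) → sym (ψφ a pa) , Pφ a pa })
               (λ { (refl , qb) → Qψ b qb , sym (φψ b qb) }))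
             (𝟙-× (a ≟A ψ b) (Q? b)))) ⟩
      𝟙 (a ≟A ψ b) * 𝟙 (Q? b) * g b
        ≡⟨ *-assoc (𝟙 (a ≟A ψ b)) _ _ ⟩
      𝟙 (a ≟A ψ b) * (𝟙 (Q? b) * g b) ∎

∑-involution : ∀ {A : Set} (E : Enumeration A) (φ : A → A) → (∀ a → φ (φ a) ≡ a) →
               ∀ (f : A → ℚ) → ∑ (elements E) f ≡ ∑ (elements E) (f ∘ φ)
∑-involution E φ φφ f = begin
  ∑ (elements E) f
    ≡⟨ ∑-cong (elements E) (λ a → sym (𝟙-*-yes true? (f a) tt)) ⟩
  ∑ (elements E) (λ a → 𝟙 true? * f a)
    ≡⟨ ∑-bijection E E (λ _ → true?) (λ _ → true?) φ φ _ _ (λ a _ → φφ a) (λ a _ → φφ a)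
         f (f ∘ φ) (λ a _ → cong f (sym (φφ a))) ⟩
  ∑ (elements E) (λ a → 𝟙 true? * f (φ a))
    ≡⟨ ∑-cong (elements E) (λ a → 𝟙-*-yes true? (f (φ a)) tt) ⟩
  ∑ (elements E) (f ∘ φ) ∎
  where
  open ≡-Reasoning
  open import Data.Unit using (⊤; tt)
  true? : Dec ⊤
  true? = yes tt

≡-neg⇒≡0 : ∀ x → x ≡ - x → x ≡ 0ℚ
≡-neg⇒≡0 x x≡-x with ℚₚ.<-cmp x 0ℚ
... | tri≈ _ x≡0 _ = x≡0
... | tri< x<0 _ _ = contradiction (ℚₚ.<-trans x<0 (subst (0ℚ ℚ.<_) (sym x≡-x) (neg⇒pos x<0)))
                                   (ℚₚ.<-irrefl refl)
... | tri> _ _ 0<x = contradiction (ℚₚ.<-trans 0<x (subst (ℚ._< 0ℚ) (sym x≡-x) (pos⇒neg 0<x)))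
                                   (ℚₚ.<-irrefl refl)

sign-reversing : ∀ {A : Set} (E : Enumeration A) (φ : A → A) → (∀ a → φ (φ a) ≡ a) →
                 ∀ (f : A → ℚ) → (∀ a → f (φ a) ≡ - f a) → ∑ (elements E) f ≡ 0ℚ
sign-reversing E φ φφ f anti = ≡-neg⇒≡0 _
  (trans (∑-involution E φ φφ f) (trans (∑-cong (elements E) anti) (∑-neg (elements E) f)))

∑-allFin-suc : ∀ n (f : Fin (suc n) → ℚ) →
               ∑ (allFin (suc n)) f ≡ f Fin.zero + ∑ (allFin n) (f ∘ Fin.suc)
∑-allFin-suc n f = cong (f Fin.zero +_)
  (trans (cong (λ xs → ∑ xs f) (sym (Listₚ.map-tabulate id Fin.suc))) (∑-map Fin.suc (allFin n) f))

allFin-once : ∀ n (y : Fin n) → ∑ (allFin n) (λ x → 𝟙 (x Fin.≟ y)) ≡ 1ℚ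
allFin-once (suc n) Fin.zero = trans (∑-allFin-suc n _)
  (trans (cong₂ _+_ (𝟙-yes (Fin.zero {n} Fin.≟ Fin.zero) refl)
    (∑-zero (allFin n) (λ x → 𝟙-no (Fin.suc x Fin.≟ Fin.zero) λ ()))) (+-identityʳ 1ℚ))
allFin-once (suc n) (Fin.suc y) = trans (∑-allFin-suc n _) (trans (zero-+ _
  (𝟙-no (Fin.zero Fin.≟ Fin.suc y) λ ())) (trans (∑-cong (allFin n) (λ x → 𝟙-cong (Fin.suc x Fin.≟ Fin.suc y) (x Fin.≟ y)
    Finₚ.suc-injective (cong Fin.suc))) (allFin-once n y)))

finE : ∀ n → Enumeration (Fin n)
finE n = record { elements = allFin n ; _≟_ = Fin._≟_ ; once = allFin-once n }

tuplesE : ∀ {A : Set} → Enumeration A → ∀ k → Enumeration (Vec A k)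
tuplesE {A} E k = record { elements = tuples (elements E) k ; _≟_ = _≟V_ ; once = once′ k }
  where
  open ≡-Reasoning
  _≟A_ = Enumeration._≟_ E
  _≟V_ : ∀ {k} → DecidableEquality (Vec A k)
  _≟V_ = Vecₚ.≡-dec _≟A_
  once′ : ∀ k (y : Vec A k) → ∑ (tuples (elements E) k) (λ x → 𝟙 (x ≟V y)) ≡ 1ℚ
  once′ zero    []       = trans (+-identityʳ _) (𝟙-yes (_≟V_ {0} [] []) refl)
  once′ (suc k) (y ∷ ys) = begin
    ∑ (tuples (elements E) (suc k)) (λ x → 𝟙 (x ≟V (y ∷ ys)))
      ≡⟨ ∑-cartesianProductWith _∷_ (elements E) _ _ ⟩
    ∑ (elements E) (λ x → ∑ (tuples (elements E) k) (λ xs → 𝟙 ((x ∷ xs) ≟V (y ∷ ys))))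
      ≡⟨ ∑-cong (elements E) (λ x → ∑-cong (tuples (elements E) k) (λ xs → trans
           (𝟙-cong ((x ∷ xs) ≟V (y ∷ ys)) ((x ≟A y) ×-dec (xs ≟V ys)) Vecₚ.∷-injective
             (λ { (refl , refl) → refl }))
           (𝟙-× (x ≟A y) (xs ≟V ys)))) ⟩
    ∑ (elements E) (λ x → ∑ (tuples (elements E) k) (λ xs → 𝟙 (x ≟A y) * 𝟙 (xs ≟V ys)))
      ≡⟨ sym (∑-*-∑ (elements E) (tuples (elements E) k) _ _) ⟩
    ∑ (elements E) (λ x → 𝟙 (x ≟A y)) * ∑ (tuples (elements E) k) (λ xs → 𝟙 (xs ≟V ys))
      ≡⟨ cong₂ _*_ (once E y) (once′ k ys) ⟩
    1ℚ * 1ℚ ≡⟨ *-identityˡ 1ℚ ⟩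
    1ℚ ∎

pos-cancel : ∀ a {b} → 0ℚ ℚ.< b → a * b ≡ 0ℚ → a ≡ 0ℚ
pos-cancel a {b} 0<b ab≡0 with ℚₚ.<-cmp a 0ℚ
... | tri≈ _ a≡0 _ = a≡0
... | tri> _ _ 0<a = contradiction (*-pos 0<a 0<b) (λ 0<ab → ℚₚ.<-irrefl (sym ab≡0) 0<ab)
... | tri< a<0 _ _ = contradiction (*-pos (neg⇒pos a<0) 0<b)
  (λ 0<-ab → ℚₚ.<-irrefl (sym (trans (neg-*ˡ a b) (trans (cong -_ ab≡0) (sym (-≡ 0ℚ))))) 0<-ab)
  where
  neg-*ˡ : ∀ a b → (- a) * b ≡ - (a * b)
  neg-*ˡ = solve 2 (λ a b → (:- a) :* b := :- (a :* b)) refl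

∑-one : ∀ n → ∑ (allFin n) (λ _ → 1ℚ) ≡ fromℕ n
∑-one zero    = sym fromℕ-0
∑-one (suc n) = trans (∑-allFin-suc n _) (trans (cong (1ℚ +_) (∑-one n))
  (trans (cong (_+ fromℕ n) (sym fromℕ-1)) (sym (fromℕ-+ 1 n))))

-- Partitions and the basis of products of power sums

module _ where

  private
    ≥-decTotalOrder = Relation.Binary.Construct.Flip.EqAndOrd.decTotalOrder ℕₚ.≤-decTotalOrder
    ≥-totalOrder = Relation.Binary.Bundles.DecTotalOrder.totalOrder ≥-decTotalOrder

  sortedDecreasing : List ℕ → List ℕ
  sortedDecreasing = sort ≥-decTotalOrder

  sortedDecreasing-↭ : ∀ ks → sortedDecreasing ks ↭ ks
  sortedDecreasing-↭ = InsertionSortₚ.sort-↭ ≥-decTotalOrder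

  sortedDecreasing-≥ : ∀ ks → Linked _≥_ (sortedDecreasing ks)
  sortedDecreasing-≥ = InsertionSortₚ.sort-↗ ≥-decTotalOrder

  ↭⇒≡-decreasing : ∀ {ks ls} → Linked _≥_ ks → Linked _≥_ ls → ks ↭ ls → ks ≡ ls
  ↭⇒≡-decreasing ks↘ ls↘ ks↭ls =
    Pointwise-≡⇒≡ (Sortedₚ.↗↭↗⇒≋ ≥-totalOrder ks↘ ls↘ (Perm.↭⇒↭ₛ ks↭ls))

_≟ˡ_ : DecidableEquality (List ℕ)
_≟ˡ_ = Listₚ.≡-dec ℕ._≟_

sort≤ : List ℕ → List ℕ
sort≤ = sort ℕₚ.≤-decTotalOrder

↭⇒sort≡ : ∀ {ks ls} → ks ↭ ls → sort≤ ks ≡ sort≤ ls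
↭⇒sort≡ {ks} {ls} ks↭ls = Pointwise-≡⇒≡ (Sortedₚ.↗↭↗⇒≋ ℕₚ.≤-totalOrder
  (InsertionSortₚ.sort-↗ ℕₚ.≤-decTotalOrder ks) (InsertionSortₚ.sort-↗ ℕₚ.≤-decTotalOrder ls)
  (Perm.↭⇒↭ₛ (↭-trans (InsertionSortₚ.sort-↭ ℕₚ.≤-decTotalOrder ks)
    (↭-trans ks↭ls (↭-sym (InsertionSortₚ.sort-↭ ℕₚ.≤-decTotalOrder ls))))))

sort≡⇒↭ : ∀ {ks ls} → sort≤ ks ≡ sort≤ ls → ks ↭ ls
sort≡⇒↭ {ks} {ls} eq = ↭-trans (↭-sym (InsertionSortₚ.sort-↭ ℕₚ.≤-decTotalOrder ks))
  (subst (_↭ ls) (sym eq) (InsertionSortₚ.sort-↭ ℕₚ.≤-decTotalOrder ls))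

Positive : List ℕ → Set
Positive = All (0 <_)

module _ {n : ℕ} where

  parts-positive : (ρ : Partition n) → Positive (parts ρ)
  parts-positive (mkPartition ks ks>0 _ _) = recompute (All.all? (0 ℕ.<?_) ks) ks>0

  parts-decreasing : (ρ : Partition n) → Linked _≥_ (parts ρ)
  parts-decreasing (mkPartition ks _ ks↘ _) = recompute (linked? ℕ._≥?_ ks) ks↘

  sum-parts : (ρ : Partition n) → sum (parts ρ) ≡ n
  sum-parts (mkPartition ks _ _ ∑ks) = recompute (sum ks ℕ.≟ n) ∑ks

  parts-injective : ∀ {ρ σ : Partition n} → parts ρ ≡ parts σ → ρ ≡ σ
  parts-injective refl = refl

  _≟ᵖ_ : DecidableEquality (Partition n)
  ρ ≟ᵖ σ = map′ parts-injective (cong parts) (parts ρ ≟ˡ parts σ)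

  partition : ∀ ks → Positive ks → sum ks ≡ n → Partition n
  partition ks ks>0 ∑ks = mkPartition (sortedDecreasing ks)
    (Permₚ.All-resp-↭ (↭-sym (sortedDecreasing-↭ ks)) ks>0)
    (sortedDecreasing-≥ ks)
    (trans (sum-↭ (sortedDecreasing-↭ ks)) ∑ks)

  p-𝟙 : ∀ ks (ks>0 : Positive ks) (∑ks : sum ks ≡ n) ρ → p ks ρ ≡ 𝟙 (ρ ≟ᵖ partition ks ks>0 ∑ks)
  p-𝟙 ks ks>0 ∑ks ρ = trans (𝟙≡ (Listₚ.≡-dec ℕ._≟_ (sort≤ ks) (sort≤ (parts ρ))))
    (𝟙-cong _ (ρ ≟ᵖ partition ks ks>0 ∑ks)
      (λ eq → parts-injective (↭⇒≡-decreasing (parts-decreasing ρ) (sortedDecreasing-≥ ks)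
        (↭-trans (↭-sym (sort≡⇒↭ eq)) (↭-sym (sortedDecreasing-↭ ks)))))
      (λ { refl → ↭⇒sort≡ (↭-sym (sortedDecreasing-↭ ks)) }))

compositions-suc : ∀ n → ∃ λ e → compositions (suc n) ≡ concatMap e (compositions n) ×
  (e [] ≡ (1 ∷ []) ∷ []) × (∀ k ks → e (k ∷ ks) ≡ (1 ∷ k ∷ ks) ∷ (suc k ∷ ks) ∷ [])
compositions-suc n = _ , refl , refl , λ _ _ → refl

module _ (n : ℕ) where

  private
    e = proj₁ (compositions-suc n)

  ∑-compositions-suc : ∀ (f : List ℕ → ℚ) (g : List ℕ → ℚ) → f (1 ∷ []) ≡ g [] →
                       (∀ k ks → f (1 ∷ k ∷ ks) + f (suc k ∷ ks) ≡ g (k ∷ ks)) →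
                       ∑ (compositions (suc n)) f ≡ ∑ (compositions n) g
  ∑-compositions-suc f g g[] g∷ = trans (∑-concatMap e (compositions n) f)
    (∑-cong (compositions n) λ
      { []       → trans (+-identityʳ _) g[]
      ; (k ∷ ks) → trans (cong (f (1 ∷ k ∷ ks) +_) (+-identityʳ _)) (g∷ k ks) })

compositions-positive-head : ∀ n ks → ∑ (compositions n) (λ c → 𝟙 (c ≟ˡ (0 ∷ ks))) ≡ 0ℚ
compositions-positive-head zero    ks = zero-+ 0ℚ (𝟙-no ([] ≟ˡ (0 ∷ ks)) λ ())
compositions-positive-head (suc n) ks = trans
  (∑-compositions-suc n _ (λ _ → 0ℚ) (𝟙-no ((1 ∷ []) ≟ˡ (0 ∷ ks)) λ ())
    (λ k′ ks′ → trans (zero-+ _ (𝟙-no ((1 ∷ k′ ∷ ks′) ≟ˡ (0 ∷ ks)) λ ()))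
      (𝟙-no ((suc k′ ∷ ks′) ≟ˡ (0 ∷ ks)) λ ())))
  (∑-zero (compositions n) (λ _ → refl))

compositions-once : ∀ n ks → Positive ks → sum ks ≡ n → ∑ (compositions n) (λ c → 𝟙 (c ≟ˡ ks)) ≡ 1ℚ
compositions-once zero    []       _         _   = trans (+-identityʳ _) (𝟙-yes ([] ≟ˡ []) refl)
compositions-once zero    (zero ∷ _)  (() ∷ _) _
compositions-once zero    (suc _ ∷ _) _         ()
compositions-once (suc n) (1 ∷ ks) (_ ∷ ks>0) ∑ks = begin
  ∑ (compositions (suc n)) (λ c → 𝟙 (c ≟ˡ (1 ∷ ks)))
    ≡⟨ ∑-compositions-suc n _ (λ c → 𝟙 (c ≟ˡ ks) + 𝟙 (c ≟ˡ (0 ∷ ks)))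
         (sym (trans (+-comm _ _) (trans (zero-+ _ (𝟙-no ([] ≟ˡ (0 ∷ ks)) λ ()))
           (𝟙-cong ([] ≟ˡ ks) ((1 ∷ []) ≟ˡ (1 ∷ ks)) (cong (1 ∷_)) Listₚ.∷-injectiveʳ))))
         (λ k′ ks′ → cong₂ _+_
           (𝟙-cong ((1 ∷ k′ ∷ ks′) ≟ˡ (1 ∷ ks)) ((k′ ∷ ks′) ≟ˡ ks) Listₚ.∷-injectiveʳ (cong (1 ∷_)))
           (𝟙-cong ((suc k′ ∷ ks′) ≟ˡ (1 ∷ ks)) ((k′ ∷ ks′) ≟ˡ (0 ∷ ks))
             (λ { refl → refl }) (λ { refl → refl }))) ⟩
  ∑ (compositions n) (λ c → 𝟙 (c ≟ˡ ks) + 𝟙 (c ≟ˡ (0 ∷ ks)))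
    ≡⟨ ∑-+ (compositions n) _ _ ⟩
  ∑ (compositions n) (λ c → 𝟙 (c ≟ˡ ks)) + ∑ (compositions n) (λ c → 𝟙 (c ≟ˡ (0 ∷ ks)))
    ≡⟨ cong₂ _+_ (compositions-once n ks ks>0 (ℕₚ.suc-injective ∑ks)) (compositions-positive-head n ks) ⟩
  1ℚ + 0ℚ
    ≡⟨ +-identityʳ 1ℚ ⟩
  1ℚ ∎
  where open ≡-Reasoning
compositions-once (suc n) (suc (suc k) ∷ ks) (_ ∷ ks>0) ∑ks = trans
  (∑-compositions-suc n _ (λ c → 𝟙 (c ≟ˡ (suc k ∷ ks)))
    (𝟙-cong ((1 ∷ []) ≟ˡ (suc (suc k) ∷ ks)) ([] ≟ˡ (suc k ∷ ks)) (λ ()) (λ ()))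
    (λ k′ ks′ → trans (zero-+ _ (𝟙-no ((1 ∷ k′ ∷ ks′) ≟ˡ (suc (suc k) ∷ ks)) λ ()))
      (𝟙-cong ((suc k′ ∷ ks′) ≟ˡ (suc (suc k) ∷ ks)) ((k′ ∷ ks′) ≟ˡ (suc k ∷ ks))
        (λ { refl → refl }) (λ { refl → refl }))))
  (compositions-once n (suc k ∷ ks) (s≤s z≤n ∷ ks>0) (ℕₚ.suc-injective ∑ks))

partitionsE : ∀ n → Enumeration (Partition n)
partitionsE n = record { elements = partitions n ; _≟_ = _≟ᵖ_ ; once = once′ }
  where
  once′ : ∀ ρ → ∑ (partitions n) (λ σ → 𝟙 (σ ≟ᵖ ρ)) ≡ 1ℚ
  once′ ρ = trans (∑-mapMaybe toPartition (compositions n) _)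
    (trans (∑-cong (compositions n) pick)
           (compositions-once n (parts ρ) (parts-positive ρ) (sum-parts ρ)))
    where
    pick : ∀ ks → Data.Maybe.maybe′ (λ σ → 𝟙 (σ ≟ᵖ ρ)) 0ℚ (toPartition ks) ≡ 𝟙 (ks ≟ˡ parts ρ)
    pick ks with All.all? (0 ℕ.<?_) ks | linked? ℕ._≥?_ ks | sum ks ℕ.≟ n
    ... | yes pos | yes dec | yes tot =
      𝟙-cong (mkPartition ks pos dec tot ≟ᵖ ρ) (ks ≟ˡ parts ρ) (cong parts) parts-injective
    ... | no ¬pos | _       | _       =
      sym (𝟙-no (ks ≟ˡ parts ρ) (λ { refl → ¬pos (parts-positive ρ) }))
    ... | yes _   | no ¬dec | _       =
      sym (𝟙-no (ks ≟ˡ parts ρ) (λ { refl → ¬dec (parts-decreasing ρ) }))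
    ... | yes _   | yes _   | no ¬tot =
      sym (𝟙-no (ks ≟ˡ parts ρ) (λ { refl → ¬tot (sum-parts ρ) }))

coeff≡ : ∀ {n} e (F : SymFun n) →
         coeff e F ≡ ∑ (partitions n) (λ ρ → F ρ * fromℕ (powerSumCoeff (parts ρ) e))
coeff≡ {n} e F = trans (∑≡ (partitions n) _) (∑-cong (partitions n) (λ ρ →
  trans (*≡ (F ρ) _) (cong (F ρ *_) (fromℕ≡ _))))

jackWeight : ∀ {n} → Partition n → ℚ
jackWeight ρ = fromℕ (z ρ ℕ.* 2 ^ length (parts ρ))

⟨⟩≡ : ∀ {n} (F G : SymFun n) → ⟨ F , G ⟩ ≡ ∑ (partitions n) (λ ρ → F ρ * G ρ * jackWeight ρ)
⟨⟩≡ {n} F G = trans (∑≡ (partitions n) _) (∑-cong (partitions n) (λ ρ →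
  trans (*≡ (F ρ ℚ.* G ρ) _) (cong₂ _*_ (*≡ (F ρ) (G ρ)) (fromℕ≡ _))))

module _ {n : ℕ} (ks : List ℕ) (ks>0 : Positive ks) (∑ks : sum ks ≡ n) where

  ∑-p : ∀ (f : Partition n → ℚ) → ∑ (partitions n) (λ ρ → p ks ρ * f ρ) ≡ f (partition ks ks>0 ∑ks)
  ∑-p f = trans (∑-cong (partitions n) (λ ρ → cong (_* f ρ) (p-𝟙 ks ks>0 ∑ks ρ)))
                (∑-δ (partitionsE n) _ f)

-- Monomial coefficients of products of power sums

fromℕ-sum : ∀ {A : Set} (g : A → ℕ) xs → fromℕ (sum (map g xs)) ≡ ∑ xs (fromℕ ∘ g)
fromℕ-sum g []       = fromℕ-0
fromℕ-sum g (x ∷ xs) = trans (fromℕ-+ (g x) _) (cong (fromℕ (g x) +_) (fromℕ-sum g xs))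

module _ (m a : ℕ) (e : List ℕ) where

  private
    include : Bool → List (List ℕ)
    include b = (if b then (λ es → ((a ∸ m) ∷ e) ∷ es) else (λ es → es)) (map (a ∷_) (quotients m e))

  quotients-yes : m ≤ a → quotients m (a ∷ e) ≡ ((a ∸ m) ∷ e) ∷ map (a ∷_) (quotients m e)
  quotients-yes m≤a = cong include (dec-true (m ℕ.≤? a) m≤a)

  quotients-no : ¬ m ≤ a → quotients m (a ∷ e) ≡ map (a ∷_) (quotients m e)
  quotients-no m≰a = cong include (dec-false (m ℕ.≤? a) m≰a)

∑-quotients : ∀ {k} m (e : Vec ℕ k) (h : List ℕ → ℚ) →
              ∑ (quotients m (Vec.toList e)) h ≡
              ∑ (allFin k) (λ j → 𝟙 (m ℕ.≤? lookup e j) * h (Vec.toList (Vec.updateAt e j (_∸ m))))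
∑-quotients m []      h = refl
∑-quotients {suc k} m (a ∷ e) h = trans split (sym (∑-allFin-suc k _))
  where
  rest : ∑ (map (a ∷_) (quotients m (Vec.toList e))) h ≡
         ∑ (allFin k) (λ j → 𝟙 (m ℕ.≤? lookup e j) * h (a ∷ Vec.toList (Vec.updateAt e j (_∸ m))))
  rest = trans (∑-map (a ∷_) (quotients m (Vec.toList e)) h) (∑-quotients m e (h ∘ (a ∷_)))
  split : ∑ (quotients m (a ∷ Vec.toList e)) h ≡
          𝟙 (m ℕ.≤? a) * h ((a ∸ m) ∷ Vec.toList e) +
          ∑ (allFin k) (λ j → 𝟙 (m ℕ.≤? lookup e j) * h (a ∷ Vec.toList (Vec.updateAt e j (_∸ m))))
  split = case m ℕ.≤? a of λ
    { (yes m≤a) → trans (cong (λ es → ∑ es h) (quotients-yes m a (Vec.toList e) m≤a))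
                        (cong₂ _+_ (sym (𝟙-*-yes (m ℕ.≤? a) _ m≤a)) rest)
    ; (no m≰a)  → trans (cong (λ es → ∑ es h) (quotients-no m a (Vec.toList e) m≰a))
                        (trans rest (sym (zero-+ _ (𝟙-*-no (m ℕ.≤? a) _ m≰a)))) }

module _ {A : Set} (f : A → ℕ) where

  -- The exponent of z_j in the monomial obtained by choosing the variable
  -- z_{c i} in the i-th factor of ∏_{r ∈ rs} p_{f r}.
  weight : ∀ {k} (rs : List A) → Vec (Fin k) (length rs) → Fin k → ℕ
  weight []       []       j = 0
  weight (r ∷ rs) (c ∷ cs) j = (if does (c Fin.≟ j) then f r else 0) ℕ.+ weight rs cs j

  hasWeight? : ∀ {k} (e : Vec ℕ k) (rs : List A) (c : Vec (Fin k) (length rs)) →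
               Dec (∀ j → weight rs c j ≡ lookup e j)
  hasWeight? e rs c = Finₚ.all? (λ j → weight rs c j ℕ.≟ lookup e j)

sum-toList≡0 : ∀ {k} (e : Vec ℕ k) → sum (Vec.toList e) ≡ 0 → ∀ j → 0 ≡ lookup e j
sum-toList≡0 (a ∷ e) eq Fin.zero    = sym (ℕₚ.m+n≡0⇒m≡0 a eq)
sum-toList≡0 (a ∷ e) eq (Fin.suc j) = sum-toList≡0 e (ℕₚ.m+n≡0⇒n≡0 a eq) j

≡0⇒sum-toList : ∀ {k} (e : Vec ℕ k) → (∀ j → 0 ≡ lookup e j) → sum (Vec.toList e) ≡ 0
≡0⇒sum-toList []      eq = refl
≡0⇒sum-toList (a ∷ e) eq = cong₂ ℕ._+_ (sym (eq Fin.zero)) (≡0⇒sum-toList e (eq ∘ Fin.suc))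

powerSumCoeff≡ : ∀ {A : Set} (f : A → ℕ) {k} (rs : List A) (e : Vec ℕ k) →
                 fromℕ (powerSumCoeff (map f rs) (Vec.toList e)) ≡
                 ∑ (tuples (allFin k) (length rs)) (λ c → 𝟙 (hasWeight? f e rs c))
powerSumCoeff≡ f [] e = case sum (Vec.toList e) ℕ.≟ 0 of λ
  { (yes eq) → trans (cong (fromℕ ∘ indicator) (dec-true (sum (Vec.toList e) ℕ.≟ 0) eq))
      (trans fromℕ-1 (sym (trans (+-identityʳ _) (𝟙-yes (hasWeight? f e [] []) (sum-toList≡0 e eq)))))
  ; (no neq) → trans (cong (fromℕ ∘ indicator) (dec-false (sum (Vec.toList e) ℕ.≟ 0) neq))
      (trans fromℕ-0 (sym (trans (+-identityʳ _) (𝟙-no (hasWeight? f e [] []) (neq ∘ ≡0⇒sum-toList e))))) }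
  where
  indicator : Bool → ℕ
  indicator b = if b then 1 else 0
powerSumCoeff≡ f {k} (r ∷ rs) e = begin
  fromℕ (sum (map (powerSumCoeff (map f rs)) (quotients m (Vec.toList e))))
    ≡⟨ fromℕ-sum (powerSumCoeff (map f rs)) (quotients m (Vec.toList e)) ⟩
  ∑ (quotients m (Vec.toList e)) (fromℕ ∘ powerSumCoeff (map f rs))
    ≡⟨ ∑-quotients m e _ ⟩
  ∑ (allFin k) (λ j → 𝟙 (m ℕ.≤? lookup e j) * fromℕ (powerSumCoeff (map f rs) (Vec.toList (e′ j))))
    ≡⟨ ∑-cong (allFin k) (λ j → trans (cong (𝟙 (m ℕ.≤? lookup e j) *_) (powerSumCoeff≡ f rs (e′ j)))
         (trans (∑-*ˡ _ (tuples (allFin k) (length rs)) _)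
                (∑-cong (tuples (allFin k) (length rs)) (step j)))) ⟩
  ∑ (allFin k) (λ j → ∑ (tuples (allFin k) (length rs)) (λ c → 𝟙 (hasWeight? f e (r ∷ rs) (j ∷ c))))
    ≡⟨ sym (∑-cartesianProductWith _∷_ (allFin k) _ _) ⟩
  ∑ (tuples (allFin k) (suc (length rs))) (λ c → 𝟙 (hasWeight? f e (r ∷ rs) c)) ∎
  where
  open ≡-Reasoning
  m = f r
  e′ : Fin k → Vec ℕ k
  e′ j = Vec.updateAt e j (_∸ m)
  step : ∀ j c → 𝟙 (m ℕ.≤? lookup e j) * 𝟙 (hasWeight? f (e′ j) rs c) ≡
                 𝟙 (hasWeight? f e (r ∷ rs) (j ∷ c))
  step j c = trans (sym (𝟙-× (m ℕ.≤? lookup e j) (hasWeight? f (e′ j) rs c)))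
    (𝟙-cong ((m ℕ.≤? lookup e j) ×-dec hasWeight? f (e′ j) rs c) (hasWeight? f e (r ∷ rs) (j ∷ c)) to from)
    where
    to : (m ≤ lookup e j × (∀ i → weight f rs c i ≡ lookup (e′ j) i)) →
         ∀ i → weight f (r ∷ rs) (j ∷ c) i ≡ lookup e i
    to (m≤ , eqs) i with j Fin.≟ i
    ... | yes refl = trans (cong (m ℕ.+_) (trans (eqs j) (Vecₚ.lookup∘updateAt j e)))
                           (ℕₚ.m+[n∸m]≡n m≤)
    ... | no j≢i   = trans (eqs i) (Vecₚ.lookup∘updateAt′ i j (j≢i ∘ sym) e)
    from : (∀ i → weight f (r ∷ rs) (j ∷ c) i ≡ lookup e i) →
           m ≤ lookup e j × (∀ i → weight f rs c i ≡ lookup (e′ j) i)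
    from eqs = subst (m ≤_) at-j (ℕₚ.m≤m+n m _) , at
      where
      at-j : m ℕ.+ weight f rs c j ≡ lookup e j
      at-j = subst (λ b → (if b then m else 0) ℕ.+ weight f rs c j ≡ lookup e j)
                   (dec-true (j Fin.≟ j) refl) (eqs j)
      at : ∀ i → weight f rs c i ≡ lookup (e′ j) i
      at i with j Fin.≟ i | eqs i
      ... | yes refl | eq = trans (sym (trans (cong (_∸ m) (sym eq)) (ℕₚ.m+n∸m≡n m _)))
                                  (sym (Vecₚ.lookup∘updateAt j e))
      ... | no j≢i   | eq = trans eq (sym (Vecₚ.lookup∘updateAt′ i j (j≢i ∘ sym) e))

powerSumCoeff-swap : ∀ x y ks e → powerSumCoeff (x ∷ y ∷ ks) e ≡ powerSumCoeff (y ∷ x ∷ ks) e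
powerSumCoeff-swap x y ks e = subst (λ ls → powerSumCoeff (x ∷ y ∷ ls) e ≡ powerSumCoeff (y ∷ x ∷ ls) e)
  (Listₚ.map-id ks)
  (subst (λ e → powerSumCoeff (x ∷ y ∷ ks′) e ≡ powerSumCoeff (y ∷ x ∷ ks′) e)
        (Vecₚ.toList∘fromList e) (fromℕ-injective (begin
    fromℕ (powerSumCoeff (x ∷ y ∷ ks′) (Vec.toList e′))
      ≡⟨ expand x y ⟩
    ∑ F (λ i → ∑ F (λ j → ∑ C (λ c → 𝟙 (hasWeight? id e′ (x ∷ y ∷ ks) (i ∷ j ∷ c)))))
      ≡⟨ ∑-swap F F _ ⟩
    ∑ F (λ j → ∑ F (λ i → ∑ C (λ c → 𝟙 (hasWeight? id e′ (x ∷ y ∷ ks) (i ∷ j ∷ c)))))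
      ≡⟨ ∑-cong F (λ j → ∑-cong F (λ i → ∑-cong C (λ c →
           𝟙-cong (hasWeight? id e′ (x ∷ y ∷ ks) (i ∷ j ∷ c)) (hasWeight? id e′ (y ∷ x ∷ ks) (j ∷ i ∷ c))
             (λ eqs a → trans (exchange (at j y a) (at i x a) (weight id ks c a)) (eqs a))
             (λ eqs a → trans (exchange (at i x a) (at j y a) (weight id ks c a)) (eqs a))))) ⟩
    ∑ F (λ j → ∑ F (λ i → ∑ C (λ c → 𝟙 (hasWeight? id e′ (y ∷ x ∷ ks) (j ∷ i ∷ c)))))
      ≡⟨ sym (expand y x) ⟩
    fromℕ (powerSumCoeff (y ∷ x ∷ ks′) (Vec.toList e′)) ∎)))
  where
  open ≡-Reasoning
  e′ = Vec.fromList e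
  ks′ = map id ks
  F = allFin (length e)
  C = tuples F (length ks)
  at : Fin (length e) → ℕ → Fin (length e) → ℕ
  at i m a = if does (i Fin.≟ a) then m else 0
  exchange : ∀ a b c → a ℕ.+ (b ℕ.+ c) ≡ b ℕ.+ (a ℕ.+ c)
  exchange a b c = trans (sym (ℕₚ.+-assoc a b c)) (trans (cong (ℕ._+ c) (ℕₚ.+-comm a b)) (ℕₚ.+-assoc b a c))
  expand : ∀ x y → fromℕ (powerSumCoeff (x ∷ y ∷ ks′) (Vec.toList e′)) ≡
           ∑ F (λ i → ∑ F (λ j → ∑ C (λ c → 𝟙 (hasWeight? id e′ (x ∷ y ∷ ks) (i ∷ j ∷ c)))))
  expand x y = trans (powerSumCoeff≡ id (x ∷ y ∷ ks) e′)
    (trans (∑-cartesianProductWith _∷_ F _ _)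
           (∑-cong F (λ i → ∑-cartesianProductWith _∷_ F C _)))

powerSumCoeff-↭ : ∀ {ks ls} → ks ↭ ls → ∀ e → powerSumCoeff ks e ≡ powerSumCoeff ls e
powerSumCoeff-↭ Perm.refl         e = refl
powerSumCoeff-↭ (Perm.prep m eq)  e = cong sum (Listₚ.map-cong (powerSumCoeff-↭ eq) (quotients m e))
powerSumCoeff-↭ {ls = y ∷ x ∷ ls} (Perm.swap x y eq) e =
  trans (cong sum (Listₚ.map-cong (λ q → cong sum (Listₚ.map-cong (powerSumCoeff-↭ eq) (quotients y q)))
                                   (quotients x e))) (powerSumCoeff-swap x y ls e)
powerSumCoeff-↭ (Perm.trans eq₁ eq₂) e = trans (powerSumCoeff-↭ eq₁ e) (powerSumCoeff-↭ eq₂ e)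

sum-map≢0 : ∀ {A : Set} (g : A → ℕ) xs → sum (map g xs) ≢ 0 → ∃ λ x → x ∈ xs × g x ≢ 0
sum-map≢0 g []       ≢0 = contradiction refl ≢0
sum-map≢0 g (x ∷ xs) ≢0 with g x ℕ.≟ 0
... | no  gx≢0 = x , here refl , gx≢0
... | yes gx≡0 with sum-map≢0 g xs (λ eq → ≢0 (cong₂ ℕ._+_ gx≡0 eq))
...   | y , y∈ , gy≢0 = y , there y∈ , gy≢0

length≤sum : ∀ {ks} → Positive ks → length ks ≤ sum ks
length≤sum []           = z≤n
length≤sum (0<k ∷ ks>0) = ℕₚ.+-mono-≤ 0<k (length≤sum ks>0)

nonzeros : List ℕ → List ℕ
nonzeros = filter (0 ℕ.<?_)

∈-quotients : ∀ m a e {q} → q ∈ quotients m (a ∷ e) →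
              (m ≤ a × q ≡ (a ∸ m) ∷ e) ⊎ (∃ λ q′ → q′ ∈ quotients m e × q ≡ a ∷ q′)
∈-quotients m a e {q} q∈ = case m ℕ.≤? a of λ
  { (yes m≤a) → case subst (q ∈_) (quotients-yes m a e m≤a) q∈ of λ
      { (here eq)   → inj₁ (m≤a , eq)
      ; (there q∈′) → inj₂ (Memₚ.∈-map⁻ (a ∷_) q∈′) }
  ; (no m≰a) → inj₂ (Memₚ.∈-map⁻ (a ∷_) (subst (q ∈_) (quotients-no m a e m≰a) q∈)) }

nonzeros-∷ : ∀ {a} e → 0 < a → nonzeros (a ∷ e) ≡ a ∷ nonzeros e
nonzeros-∷ e 0<a = Listₚ.filter-accept (0 ℕ.<?_) 0<a

nonzeros-0∷ : ∀ e → nonzeros (0 ∷ e) ≡ nonzeros e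
nonzeros-0∷ e = refl

nonzeros-quotient : ∀ {m} → 0 < m → ∀ e {q} → q ∈ quotients m e →
                    (nonzeros e ↭ m ∷ nonzeros q) ⊎ (length (nonzeros e) ≡ length (nonzeros q))
nonzeros-quotient {m} 0<m (a ∷ e) q∈ with ∈-quotients m a e q∈
... | inj₁ (m≤a , refl) with m ℕ.≟ a
...   | yes refl rewrite ℕₚ.n∸n≡0 m = inj₁ (Perm.↭-reflexive
          (trans (nonzeros-∷ e 0<m) (cong (m ∷_) (sym (nonzeros-0∷ e)))))
...   | no  m≢a  = inj₂ (trans (cong length (nonzeros-∷ e (ℕₚ.≤-trans 0<m m≤a)))
          (sym (cong length (nonzeros-∷ e (ℕₚ.m<n⇒0<n∸m (ℕₚ.≤∧≢⇒< m≤a m≢a))))))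
nonzeros-quotient {m} 0<m (zero ∷ e) q∈ | inj₂ (q′ , q′∈ , refl) =
  subst₂ (λ es qs → (es ↭ m ∷ qs) ⊎ (length es ≡ length qs))
         (sym (nonzeros-0∷ e)) (sym (nonzeros-0∷ q′)) (nonzeros-quotient 0<m e q′∈)
nonzeros-quotient {m} 0<m (suc a ∷ e) q∈ | inj₂ (q′ , q′∈ , refl) =
  subst₂ (λ es qs → (es ↭ m ∷ qs) ⊎ (length es ≡ length qs))
         (sym (nonzeros-∷ e (s≤s z≤n))) (sym (nonzeros-∷ q′ (s≤s z≤n)))
         ([ (λ perm → inj₁ (↭-trans (Perm.prep (suc a) perm) (Perm.swap (suc a) m ↭-refl)))
          , (λ eq → inj₂ (cong suc eq)) ]′ (nonzeros-quotient 0<m e q′∈))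

powerSumCoeff≢0 : ∀ ks → Positive ks → ∀ e → powerSumCoeff ks e ≢ 0 →
                  (length (nonzeros e) < length ks) ⊎ (nonzeros e ↭ ks)
powerSumCoeff≢0 [] _ e ≢0 = case sum e ℕ.≟ 0 of λ
  { (yes eq) → inj₂ (Perm.↭-reflexive (empty e eq))
  ; (no neq) → contradiction (cong (λ b → if b then 1 else 0) (dec-false (sum e ℕ.≟ 0) neq)) ≢0 }
  where
  empty : ∀ e → sum e ≡ 0 → nonzeros e ≡ []
  empty []         _  = refl
  empty (zero ∷ e) eq = empty e eq
powerSumCoeff≢0 (m ∷ ks) (0<m ∷ ks>0) e ≢0 with sum-map≢0 (powerSumCoeff ks) (quotients m e) ≢0
... | q , q∈ , q≢0 with nonzeros-quotient 0<m e q∈ | powerSumCoeff≢0 ks ks>0 q q≢0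
...   | inj₁ perm | inj₁ lt    = inj₁ (subst (_< suc (length ks)) (sym (Permₚ.↭-length perm)) (s≤s lt))
...   | inj₁ perm | inj₂ perm′ = inj₂ (↭-trans perm (Perm.prep m perm′))
...   | inj₂ eq   | inj₁ lt    = inj₁ (subst (_< suc (length ks)) (sym eq) (ℕₚ.m<n⇒m<1+n lt))
...   | inj₂ eq   | inj₂ perm′ = inj₁ (subst (_< suc (length ks)) (sym (trans eq (Permₚ.↭-length perm′))) ℕₚ.≤-refl)

powerSumCoeff-0∷ : ∀ ks → Positive ks → ∀ e → powerSumCoeff ks (0 ∷ e) ≡ powerSumCoeff ks e
powerSumCoeff-0∷ []           _           e = refl
powerSumCoeff-0∷ (suc m ∷ ks) (_ ∷ ks>0) e = cong sum
  (trans (sym (Listₚ.map-∘ (quotients (suc m) e)))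
         (Listₚ.map-cong (powerSumCoeff-0∷ ks ks>0) (quotients (suc m) e)))

powerSumCoeff-diagonal : ∀ ks → Positive ks → 0 < powerSumCoeff ks ks
powerSumCoeff-diagonal []       _          = s≤s z≤n
powerSumCoeff-diagonal (m ∷ ks) (_ ∷ ks>0)
  rewrite quotients-yes m m ks ℕₚ.≤-refl | ℕₚ.n∸n≡0 m =
  ℕₚ.≤-trans (subst (0 <_) (sym (powerSumCoeff-0∷ ks ks>0 ks)) (powerSumCoeff-diagonal ks ks>0))
             (ℕₚ.m≤m+n _ _)

module _ {n : ℕ} where

  powerSumCoeff-parts≢0 : ∀ (ρ μ : Partition n) → powerSumCoeff (parts ρ) (parts μ) ≢ 0 →
                          (length (parts μ) < length (parts ρ)) ⊎ (μ ≡ ρ)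
  powerSumCoeff-parts≢0 ρ μ ≢0
    with subst (λ e → (length e < length (parts ρ)) ⊎ (e ↭ parts ρ))
               (Listₚ.filter-all (0 ℕ.<?_) (parts-positive μ))
               (powerSumCoeff≢0 (parts ρ) (parts-positive ρ) (parts μ) ≢0)
  ... | inj₁ lt   = inj₁ lt
  ... | inj₂ perm = inj₂ (parts-injective (↭⇒≡-decreasing (parts-decreasing μ) (parts-decreasing ρ) perm))

  -- By induction on n ∸ length (parts μ): p_ρ has a monomial of type μ only
  -- if μ is ρ or has fewer parts than ρ.
  coeff-injective : ∀ (F : SymFun n) → (∀ μ → coeff (parts μ) F ≡ 0ℚ) → F ≈ (λ _ → 0ℚ)
  coeff-injective F vanish μ = go (n ∸ length (parts μ)) μ ℕₚ.≤-refl
    where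
    length≤n : ∀ (μ : Partition n) → length (parts μ) ≤ n
    length≤n μ = subst (length (parts μ) ≤_) (sum-parts μ) (length≤sum (parts-positive μ))
    go : ∀ b μ → n ∸ length (parts μ) ≤ b → F μ ≡ 0ℚ
    go b μ ≤b = pos-cancel (F μ) diagonal (trans (sym (trans (coeff≡ (parts μ) F)
        (∑-single (partitionsE n) μ _ others))) (vanish μ))
      where
      diagonal : 0ℚ ℚ.< fromℕ (powerSumCoeff (parts μ) (parts μ))
      diagonal with powerSumCoeff (parts μ) (parts μ) | powerSumCoeff-diagonal (parts μ) (parts-positive μ)
      ... | suc k | _ = fromℕ-pos k
      others : ∀ ρ → ρ ≢ μ → F ρ * fromℕ (powerSumCoeff (parts ρ) (parts μ)) ≡ 0ℚ
      others ρ ρ≢μ with powerSumCoeff (parts ρ) (parts μ) ℕ.≟ 0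
      ... | yes eq = trans (cong (λ k → F ρ * fromℕ k) eq) (trans (cong (F ρ *_) fromℕ-0) (zeroʳ (F ρ)))
      ... | no neq with powerSumCoeff-parts≢0 ρ μ neq
      ...   | inj₂ μ≡ρ = contradiction (sym μ≡ρ) ρ≢μ
      ...   | inj₁ lt  = trans (cong (_* _) (smaller b ≤b)) (zeroˡ (fromℕ (powerSumCoeff (parts ρ) (parts μ))))
        where
        smaller : ∀ b → n ∸ length (parts μ) ≤ b → F ρ ≡ 0ℚ
        smaller zero    ≤0 = contradiction (ℕₚ.≤-trans lt (length≤n ρ))
          (ℕₚ.≤⇒≯ (ℕₚ.m∸n≡0⇒m≤n (ℕₚ.n≤0⇒n≡0 ≤0)))
        smaller (suc b) ≤b = go b ρ (ℕₚ.≤-pred (ℕₚ.≤-trans (ℕₚ.∸-monoʳ-< lt (length≤n ρ)) ≤b))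

-- The coefficient of z₁ ⋯ z_n

Squarefree : List ℕ → Set
Squarefree = All (_≤ 1)

quotient-squarefree : ∀ {m} → 0 < m → ∀ e → Squarefree e → ∀ {q} → q ∈ quotients m e →
                      m ≡ 1 × Squarefree q × suc (sum q) ≡ sum e
quotient-squarefree {m} 0<m (a ∷ e) (a≤1 ∷ e≤1) q∈ with ∈-quotients m a e q∈
... | inj₂ (q′ , q′∈ , refl) with quotient-squarefree 0<m e e≤1 q′∈
...   | m≡1 , q≤1 , ∑q = m≡1 , a≤1 ∷ q≤1 , trans (sym (ℕₚ.+-suc a (sum q′))) (cong (a ℕ.+_) ∑q)
quotient-squarefree {1} 0<m (1 ∷ e) (a≤1 ∷ e≤1) q∈ | inj₁ (m≤a , refl) = refl , z≤n ∷ e≤1 , refl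
quotient-squarefree {suc (suc m)} 0<m (1 ∷ e) (a≤1 ∷ e≤1) q∈ | inj₁ (s≤s () , refl)
quotient-squarefree {m} 0<m (suc (suc a) ∷ e) (s≤s () ∷ e≤1) q∈ | inj₁ (m≤a , refl)
quotient-squarefree {suc m} 0<m (0 ∷ e) (a≤1 ∷ e≤1) q∈ | inj₁ (() , refl)

powerSumCoeff-squarefree≢0 : ∀ ks → Positive ks → ∀ e → Squarefree e → powerSumCoeff ks e ≢ 0 → All (_≡ 1) ks
powerSumCoeff-squarefree≢0 []       _            e e≤1 ≢0 = []
powerSumCoeff-squarefree≢0 (m ∷ ks) (0<m ∷ ks>0) e e≤1 ≢0
  with sum-map≢0 (powerSumCoeff ks) (quotients m e) ≢0
... | q , q∈ , q≢0 with quotient-squarefree 0<m e e≤1 q∈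
...   | m≡1 , q≤1 , _ = m≡1 ∷ powerSumCoeff-squarefree≢0 ks ks>0 q q≤1 q≢0

length-quotients-1 : ∀ e → Squarefree e → length (quotients 1 e) ≡ sum e
length-quotients-1 []      _           = refl
length-quotients-1 (0 ∷ e) (_ ∷ e≤1) = trans (Listₚ.length-map (0 ∷_) (quotients 1 e)) (length-quotients-1 e e≤1)
length-quotients-1 (1 ∷ e) (_ ∷ e≤1) = cong suc (trans (Listₚ.length-map (1 ∷_) (quotients 1 e)) (length-quotients-1 e e≤1))
length-quotients-1 (suc (suc _) ∷ e) (s≤s () ∷ _)

powerSumCoeff-ones : ∀ k ks → All (_≡ 1) ks → length ks ≡ k → ∀ e → Squarefree e → sum e ≡ k → powerSumCoeff ks e ≡ k !
powerSumCoeff-ones zero    []       _            _   e e≤1 ∑e rewrite dec-true (sum e ℕ.≟ 0) ∑e = refl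
powerSumCoeff-ones (suc k) (.1 ∷ ks) (refl ∷ ones) len e e≤1 ∑e =
  trans (constant (quotients 1 e) (λ q∈ → case quotient-squarefree (s≤s z≤n) e e≤1 q∈ of λ
          { (_ , q≤1 , ∑q) → powerSumCoeff-ones k ks ones (ℕₚ.suc-injective len) _ q≤1
                               (ℕₚ.suc-injective (trans ∑q ∑e)) }))
        (cong (ℕ._* k !) (trans (length-quotients-1 e e≤1) ∑e))
  where
  constant : ∀ qs → (∀ {q} → q ∈ qs → powerSumCoeff ks q ≡ k !) →
             sum (map (powerSumCoeff ks) qs) ≡ length qs ℕ.* k !
  constant []       eq = refl
  constant (q ∷ qs) eq = cong₂ ℕ._+_ (eq (here refl)) (constant qs (eq ∘ there))

-- Alternating walks of two involutions

least : ∀ {P : ℕ → Set} → (∀ k → Dec (P k)) → ∀ n → P n → ∃ λ k → P k × (∀ j → j < k → ¬ P j)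
least P? zero    p = zero , p , λ _ ()
least P? (suc n) p with P? zero
... | yes p₀ = zero , p₀ , λ _ ()
... | no ¬p₀ with least (P? ∘ suc) n p
...   | k , pk , min = suc k , pk , λ { zero _ → ¬p₀ ; (suc j) (s≤s j<k) → min j j<k }

odd : ℕ → Bool
odd zero    = false
odd (suc k) = not (odd k)

odd-+ : ∀ k {j} → odd j ≡ false → odd (k ℕ.+ j) ≡ odd k
odd-+ zero    eq = eq
odd-+ (suc k) eq = cong not (odd-+ k eq)

odd-*2 : ∀ k → odd (k ℕ.* 2) ≡ false
odd-*2 zero    = refl
odd-*2 (suc k) = trans (not-involutive _) (odd-*2 k)

halve : ∀ k → ∃ λ h → (k ≡ h ℕ.* 2) ⊎ (k ≡ suc (h ℕ.* 2))
halve zero    = 0 , inj₁ refl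
halve (suc k) with halve k
... | h , inj₁ eq = h , inj₂ (cong suc eq)
... | h , inj₂ eq = suc h , inj₁ (cong suc eq)

module Walk {X : Set} (τ : Bool → X → X) (τ-inv : ∀ b x → τ b (τ b x) ≡ x) where

  walk : ℕ → X → X
  walk zero    x = x
  walk (suc k) x = τ (odd k) (walk k x)

  walk-back : ∀ k x → τ (odd k) (walk (suc k) x) ≡ walk k x
  walk-back k x = τ-inv (odd k) (walk k x)

  τ-injective : ∀ b {x y} → τ b x ≡ τ b y → x ≡ y
  τ-injective b eq = trans (sym (τ-inv b _)) (trans (cong (τ b) eq) (τ-inv b _))

  walk-+ : ∀ {j} → odd j ≡ false → ∀ k x → walk (k ℕ.+ j) x ≡ walk k (walk j x)
  walk-+ even zero    x = refl
  walk-+ even (suc k) x = cong₂ τ (odd-+ k even) (walk-+ even k x)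

  walk-cancel : ∀ i {d} → odd d ≡ false → ∀ {x} → walk i x ≡ walk (i ℕ.+ d) x → x ≡ walk d x
  walk-cancel zero    even eq = eq
  walk-cancel (suc i) {d} even {x} eq = walk-cancel i even
    (τ-injective (odd i) (trans eq (cong (λ b → τ b (walk (i ℕ.+ d) x)) (odd-+ i even))))

  Closes : X → ℕ → Set
  Closes x ℓ = walk (ℓ ℕ.* 2) x ≡ x

  walk-period : ∀ {x ℓ} → Closes x ℓ → ∀ q k → walk (k ℕ.+ q ℕ.* (ℓ ℕ.* 2)) x ≡ walk k x
  walk-period {x} {ℓ} closes zero    k = cong (λ j → walk j x) (ℕₚ.+-identityʳ k)
  walk-period {x} {ℓ} closes (suc q) k = begin
    walk (k ℕ.+ (ℓ ℕ.* 2 ℕ.+ q ℕ.* (ℓ ℕ.* 2))) x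
      ≡⟨ cong (λ j → walk j x) (trans (cong (k ℕ.+_) (ℕₚ.+-comm (ℓ ℕ.* 2) _)) (sym (ℕₚ.+-assoc k _ _))) ⟩
    walk (k ℕ.+ q ℕ.* (ℓ ℕ.* 2) ℕ.+ ℓ ℕ.* 2) x
      ≡⟨ walk-+ (odd-*2 ℓ) (k ℕ.+ q ℕ.* (ℓ ℕ.* 2)) x ⟩
    walk (k ℕ.+ q ℕ.* (ℓ ℕ.* 2)) (walk (ℓ ℕ.* 2) x)
      ≡⟨ cong (walk (k ℕ.+ q ℕ.* (ℓ ℕ.* 2))) closes ⟩
    walk (k ℕ.+ q ℕ.* (ℓ ℕ.* 2)) x
      ≡⟨ walk-period {ℓ = ℓ} closes q k ⟩
    walk k x ∎
    where open ≡-Reasoning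

  walk-% : ∀ {x ℓ} → Closes x (suc ℓ) → ∀ k → walk k x ≡ walk (k ℕ.% (suc ℓ ℕ.* 2)) x
  walk-% {x} {ℓ} closes k = trans (cong (λ j → walk j x) (m≡m%n+[m/n]*n k (suc ℓ ℕ.* 2)))
    (walk-period {ℓ = suc ℓ} closes (k ℕ./ (suc ℓ ℕ.* 2)) (k ℕ.% (suc ℓ ℕ.* 2)))

module Loops {m : ℕ} (τ : Bool → Fin m → Fin m) (τ-inv : ∀ b x → τ b (τ b x) ≡ x)
             (τ-fpf : ∀ b x → τ b x ≢ x) where

  open Walk τ τ-inv public

  private
    closes : ∀ x → ∃ λ k → Closes x (suc k)
    closes x with Finₚ.pigeonhole {m = m} (ℕₚ.n<1+n m) (λ i → walk (toℕ i ℕ.* 2) x)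
    ... | i , j , i<j , eq with ℕₚ.m≤n⇒∃[o]m+o≡n i<j
    ...   | k , refl′ = k , sym (walk-cancel (toℕ i ℕ.* 2) (odd-*2 (suc k)) (trans eq (cong (λ l → walk l x)
              (trans (cong (ℕ._* 2) (sym (trans (ℕₚ.+-suc (toℕ i) k) refl′))) (ℕₚ.*-distribʳ-+ 2 (toℕ i) (suc k))))))

    opaque
      leastReturn : ∀ x → ∃ λ k → Closes x (suc k) × (∀ j → j < k → ¬ Closes x (suc j))
      leastReturn x = least (λ k → walk (suc k ℕ.* 2) x Fin.≟ x) (proj₁ (closes x)) (proj₂ (closes x))

  -- One less than the half-length of the loop through x.
  predPeriod : Fin m → ℕ
  predPeriod x = proj₁ (leastReturn x)

  period : Fin m → ℕ
  period x = suc (predPeriod x)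

  period-closes : ∀ x → Closes x (period x)
  period-closes x = proj₁ (proj₂ (leastReturn x))

  period-minimal : ∀ x j → 0 < j → j < period x → ¬ Closes x j
  period-minimal x (suc j) _ (s≤s j<) = proj₂ (proj₂ (leastReturn x)) j j<

  odd-step-≢ : ∀ e i x → walk i x ≢ walk (i ℕ.+ suc (e ℕ.* 2)) x
  odd-step-≢ zero    i x eq = τ-fpf (odd i) (walk i x)
    (sym (trans eq (cong (λ j → walk j x) (ℕₚ.+-comm i 1))))
  odd-step-≢ (suc e) i x eq = odd-step-≢ e (suc i) x (begin
    τ (odd i) (walk i x)
      ≡⟨ cong (τ (odd i)) (trans eq (cong (λ j → walk j x) (ℕₚ.+-suc i _))) ⟩
    τ (odd i) (walk (suc (i ℕ.+ suc (suc (e ℕ.* 2)))) x)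
      ≡⟨ cong (λ b → τ b (walk (suc (i ℕ.+ suc (suc (e ℕ.* 2)))) x)) (sym (odd-+ i (odd-*2 (suc e)))) ⟩
    τ (odd (i ℕ.+ suc (suc (e ℕ.* 2)))) (walk (suc (i ℕ.+ suc (suc (e ℕ.* 2)))) x)
      ≡⟨ walk-back (i ℕ.+ suc (suc (e ℕ.* 2))) x ⟩
    walk (i ℕ.+ suc (suc (e ℕ.* 2))) x
      ≡⟨ cong (λ j → walk j x) (ℕₚ.+-suc i _) ⟩
    walk (suc i ℕ.+ suc (e ℕ.* 2)) x ∎)
    where open ≡-Reasoning

  walk-<-≢ : ∀ x {i j} → i < j → j < period x ℕ.* 2 → walk i x ≢ walk j x
  walk-<-≢ x {i} {j} i<j j<P eq with halve (j ∸ i)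
  ... | h , inj₂ d≡ = odd-step-≢ h i x (trans eq (cong (λ k → walk k x)
          (trans (sym (ℕₚ.m+[n∸m]≡n (ℕₚ.<⇒≤ i<j))) (cong (i ℕ.+_) d≡))))
  ... | h , inj₁ d≡ = period-minimal x h 0<h h<period
          (sym (walk-cancel i (odd-*2 h) (trans eq (cong (λ k → walk k x)
            (trans (sym (ℕₚ.m+[n∸m]≡n (ℕₚ.<⇒≤ i<j))) (cong (i ℕ.+_) d≡))))))
    where
    0<h : 0 < h
    0<h = ℕₚ.n≢0⇒n>0 (λ h≡0 → ℕₚ.<⇒≱ i<j (ℕₚ.m∸n≡0⇒m≤n (trans d≡ (cong (ℕ._* 2) h≡0))))
    h<period : h < period x
    h<period = ℕₚ.*-cancelʳ-< 2 h (period x)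
      (subst (_< period x ℕ.* 2) d≡ (ℕₚ.≤-<-trans (ℕₚ.m∸n≤m j i) j<P))

  walk-injective : ∀ x {i j} → i < period x ℕ.* 2 → j < period x ℕ.* 2 → walk i x ≡ walk j x → i ≡ j
  walk-injective x {i} {j} i<P j<P eq with ℕₚ.<-cmp i j
  ... | tri< i<j _ _ = contradiction eq (walk-<-≢ x i<j j<P)
  ... | tri≈ _ i≡j _ = i≡j
  ... | tri> _ _ j<i = contradiction (sym eq) (walk-<-≢ x j<i i<P)

  period-bound : ∀ x → period x ℕ.* 2 ≤ m
  period-bound x = Finₚ.injective⇒≤ {f = λ (k : Fin (period x ℕ.* 2)) → walk (toℕ k) x}
    (λ eq → Finₚ.toℕ-injective (walk-injective x (Finₚ.toℕ<n _) (Finₚ.toℕ<n _) eq))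

  infix 4 _~_

  _~_ : Fin m → Fin m → Set
  x ~ y = ∃ λ k → walk k x ≡ y

  ~-refl : ∀ {x} → x ~ x
  ~-refl = 0 , refl

  ~-positive : ∀ {x y} → x ~ y → ∃ λ k → walk (suc k) x ≡ y
  ~-positive {x} (zero  , eq) = predPeriod x ℕ.* 2 ℕ.+ 1 ,
    trans (cong (λ j → walk (suc j) x) (ℕₚ.+-comm (predPeriod x ℕ.* 2) 1)) (trans (period-closes x) eq)
  ~-positive     (suc k , eq) = k , eq

  ~-τ : ∀ {x y} b → x ~ y → x ~ τ b y
  ~-τ {x} b x~y with ~-positive x~y
  ... | k , refl with odd k Data.Bool.≟ b
  ...   | yes refl = k , sym (walk-back k x)
  ...   | no  neq  = suc (suc k) , cong (λ b′ → τ b′ (walk (suc k) x)) (sym (¬-not (neq ∘ sym)))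

  ~-trans : ∀ {x y z} → x ~ y → y ~ z → x ~ z
  ~-trans x~y (zero  , refl) = x~y
  ~-trans x~y (suc k , refl) = ~-τ (odd k) (~-trans x~y (k , refl))

  ~-sym : ∀ {x y} → x ~ y → y ~ x
  ~-sym (zero  , refl) = ~-refl
  ~-sym {x} (suc k , refl) = ~-trans (subst (walk (suc k) x ~_) (walk-back k x) (~-τ (odd k) ~-refl))
                                     (~-sym (k , refl))

  ~-normal : ∀ {x y} → x ~ y → ∃ λ (k : Fin (period x ℕ.* 2)) → walk (toℕ k) x ≡ y
  ~-normal {x} (k , refl) = fromℕ< (m%n<n k (period x ℕ.* 2)) ,
    trans (cong (λ j → walk j x) (Finₚ.toℕ-fromℕ< (m%n<n k (period x ℕ.* 2))))
          (sym (walk-% {ℓ = predPeriod x} (period-closes x) k))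

  _~?_ : ∀ x y → Dec (x ~ y)
  x ~? y = map′ (λ (k , eq) → toℕ k , eq) ~-normal
                (Finₚ.any? (λ (k : Fin (period x ℕ.* 2)) → walk (toℕ k) x Fin.≟ y))

  ∑-loop : ∀ x → ∑ (allFin m) (λ y → 𝟙 (x ~? y)) ≡ fromℕ (period x ℕ.* 2)
  ∑-loop x = begin
    ∑ (allFin m) (λ y → 𝟙 (x ~? y))
      ≡⟨ ∑-cong (allFin m) count ⟩
    ∑ (allFin m) (λ y → ∑ (allFin P) (λ k → 𝟙 (y Fin.≟ walk (toℕ k) x)))
      ≡⟨ ∑-swap (allFin m) (allFin P) _ ⟩
    ∑ (allFin P) (λ k → ∑ (allFin m) (λ y → 𝟙 (y Fin.≟ walk (toℕ k) x)))
      ≡⟨ ∑-cong (allFin P) (λ k → allFin-once m (walk (toℕ k) x)) ⟩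
    ∑ (allFin P) (λ _ → 1ℚ)
      ≡⟨ ∑-one P ⟩
    fromℕ P ∎
    where
    open ≡-Reasoning
    P = period x ℕ.* 2
    count : ∀ y → 𝟙 (x ~? y) ≡ ∑ (allFin P) (λ k → 𝟙 (y Fin.≟ walk (toℕ k) x))
    count y with x ~? y
    ... | no ¬x~y = trans (𝟙-no (no ¬x~y) ¬x~y) (sym (∑-zero (allFin P) (λ k →
          𝟙-no (y Fin.≟ walk (toℕ k) x) (λ eq → ¬x~y (toℕ k , sym eq)))))
    ... | yes x~y with ~-normal x~y
    ...   | k , refl = trans (𝟙-yes (yes x~y) x~y) (sym (trans
            (∑-single (finE P) k _ (λ j j≢k → 𝟙-no (walk (toℕ k) x Fin.≟ walk (toℕ j) x)
              (λ eq → j≢k (Finₚ.toℕ-injective (walk-injective x (Finₚ.toℕ<n j) (Finₚ.toℕ<n k) (sym eq))))))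
            (𝟙-yes (walk (toℕ k) x Fin.≟ walk (toℕ k) x) refl)))

  period-resp-~ : ∀ {x y} → x ~ y → period x ≡ period y
  period-resp-~ {x} {y} x~y = ℕₚ.*-cancelʳ-≡ (period x) (period y) 2 (fromℕ-injective
    (trans (sym (∑-loop x)) (trans (∑-cong (allFin m) (λ z →
      𝟙-cong (x ~? z) (y ~? z) (~-trans (~-sym x~y)) (~-trans x~y))) (∑-loop y))))

  IsRep : Fin m → Set
  IsRep x = ∀ y → x ~ y → x Fin.≤ y

  private
    opaque
      leastInLoop : ∀ x → ∃ λ k → (∃ λ y → x ~ y × toℕ y ≡ k) × (∀ j → j < k → ¬ ∃ λ y → x ~ y × toℕ y ≡ j)
      leastInLoop x = least (λ k → Finₚ.any? (λ y → (x ~? y) ×-dec (toℕ y ℕ.≟ k))) (toℕ x) (x , ~-refl , refl)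

  rep : Fin m → Fin m
  rep x = proj₁ (proj₁ (proj₂ (leastInLoop x)))

  ~-rep : ∀ x → x ~ rep x
  ~-rep x = proj₁ (proj₂ (proj₁ (proj₂ (leastInLoop x))))

  rep-isRep : ∀ x → IsRep (rep x)
  rep-isRep x y rep~y = ℕₚ.≮⇒≥ (λ y<rep → proj₂ (proj₂ (leastInLoop x)) (toℕ y)
    (subst (toℕ y <_) (proj₂ (proj₂ (proj₁ (proj₂ (leastInLoop x))))) y<rep)
    (y , ~-trans (~-rep x) rep~y , refl))

  rep-unique : ∀ {x y} → IsRep x → IsRep y → x ~ y → x ≡ y
  rep-unique x-rep y-rep x~y = Finₚ.≤-antisym (x-rep _ x~y) (y-rep _ (~-sym x~y))

  isRep? : ∀ x → Dec (IsRep x)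
  isRep? x = map′ (λ eq → subst IsRep (sym eq) (rep-isRep x))
                  (λ x-rep → rep-unique x-rep (rep-isRep x) (~-rep x)) (x Fin.≟ rep x)

  ∑-reps : ∀ (f : Fin m → ℚ) (g : Fin m → ℚ) → (∀ x → IsRep x → ∑ (allFin m) (λ y → 𝟙 (x ~? y) * f y) ≡ g x) →
           ∑ (allFin m) f ≡ ∑ (allFin m) (λ x → 𝟙 (isRep? x) * g x)
  ∑-reps f g loop = begin
    ∑ (allFin m) f
      ≡⟨ ∑-cong (allFin m) (λ y → sym (trans (∑-single (finE m) (rep y) _ (λ x x≢ → off y x x≢)) (on y))) ⟩
    ∑ (allFin m) (λ y → ∑ (allFin m) (λ x → 𝟙 (isRep? x) * (𝟙 (x ~? y) * f y)))
      ≡⟨ ∑-swap (allFin m) (allFin m) _ ⟩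
    ∑ (allFin m) (λ x → ∑ (allFin m) (λ y → 𝟙 (isRep? x) * (𝟙 (x ~? y) * f y)))
      ≡⟨ ∑-cong (allFin m) (λ x → trans (sym (∑-*ˡ (𝟙 (isRep? x)) (allFin m) _)) (𝟙-guard (isRep? x) (loop x))) ⟩
    ∑ (allFin m) (λ x → 𝟙 (isRep? x) * g x) ∎
    where
    open ≡-Reasoning
    on : ∀ y → 𝟙 (isRep? (rep y)) * (𝟙 (rep y ~? y) * f y) ≡ f y
    on y = trans (𝟙-*-yes (isRep? (rep y)) _ (rep-isRep y)) (𝟙-*-yes (rep y ~? y) (f y) (~-sym (~-rep y)))
    off : ∀ y x → x ≢ rep y → 𝟙 (isRep? x) * (𝟙 (x ~? y) * f y) ≡ 0ℚ
    off y x x≢ with isRep? x | x ~? y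
    ... | no ¬r | _       = 𝟙-*-no (no ¬r) _ ¬r
    ... | yes r | yes x~y = contradiction (rep-unique r (rep-isRep y) (~-trans x~y (~-rep y))) x≢
    ... | yes r | no ¬x~y = trans (𝟙-*-yes (yes r) _ r) (𝟙-*-no (no ¬x~y) (f y) ¬x~y)

-- Pair-partitions and the loops of 𝓛(S₁,S₂)

module _ {n : ℕ} where

  ⟦⟧-involutive : ∀ (S : PairPartition n) i → ⟦ S ⟧ (⟦ S ⟧ i) ≡ i
  ⟦⟧-involutive (mkPairPartition v inv _) i = recompute (lookup v (lookup v i) Fin.≟ i) (inv i)

  ⟦⟧-fixedPointFree : ∀ (S : PairPartition n) i → ⟦ S ⟧ i ≢ i
  ⟦⟧-fixedPointFree (mkPairPartition v _ fpf) i = recompute (¬? (lookup v i Fin.≟ i)) (fpf i)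

  partner-injective : ∀ {S T : PairPartition n} → partner S ≡ partner T → S ≡ T
  partner-injective refl = refl

  ⟦⟧-injective : ∀ {S T : PairPartition n} → (∀ i → ⟦ S ⟧ i ≡ ⟦ T ⟧ i) → S ≡ T
  ⟦⟧-injective {S} {T} eq = partner-injective (begin
    partner S       ≡⟨ sym (Vecₚ.tabulate∘lookup (partner S)) ⟩
    tabulate ⟦ S ⟧  ≡⟨ Vecₚ.tabulate-cong eq ⟩
    tabulate ⟦ T ⟧  ≡⟨ Vecₚ.tabulate∘lookup (partner T) ⟩
    partner T       ∎)
    where open ≡-Reasoning

  pairPartition : (f : Fin (n ℕ.* 2) → Fin (n ℕ.* 2)) → (∀ i → f (f i) ≡ i) → (∀ i → f i ≢ i) → PairPartition n
  pairPartition f inv fpf = mkPairPartition (tabulate f)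
    (λ i → trans (cong (lookup (tabulate f)) (at i)) (trans (at (f i)) (inv i)))
    (λ i eq → fpf i (trans (sym (at i)) eq))
    where
    at : ∀ i → lookup (tabulate f) i ≡ f i
    at = Vecₚ.lookup∘tabulate f

  _≟ˢ_ : DecidableEquality (PairPartition n)
  S ≟ˢ T = map′ partner-injective (cong partner) (Vecₚ.≡-dec Fin._≟_ (partner S) (partner T))

pairPartitionsE : ∀ n → Enumeration (PairPartition n)
pairPartitionsE n = record { elements = pairPartitions n ; _≟_ = _≟ˢ_ ; once = once′ }
  where
  vectors = tuplesE (finE (n ℕ.* 2)) (n ℕ.* 2)
  _≟ᵛ_ = Enumeration._≟_ vectors
  once′ : ∀ T → ∑ (pairPartitions n) (λ S → 𝟙 (S ≟ˢ T)) ≡ 1ℚ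
  once′ T = trans (∑-mapMaybe (toPairPartition {n}) (elements vectors) (λ S → 𝟙 (S ≟ˢ T)))
    (trans (∑-cong (elements vectors) pick) (once vectors (partner T)))
    where
    pick : ∀ v → Data.Maybe.maybe′ (λ S → 𝟙 (S ≟ˢ T)) 0ℚ (toPairPartition {n} v) ≡ 𝟙 (v ≟ᵛ partner T)
    pick v with Finₚ.all? (λ i → lookup v (lookup v i) Fin.≟ i) | Finₚ.all? (λ i → ¬? (lookup v i Fin.≟ i))
    ... | yes inv | yes fpf =
      𝟙-cong (mkPairPartition v inv fpf ≟ˢ T) (v ≟ᵛ partner T) (cong partner) partner-injective
    ... | no ¬inv | _       = sym (𝟙-no (v ≟ᵛ partner T) (λ { refl → ¬inv (⟦⟧-involutive T) }))
    ... | yes _   | no ¬fpf = sym (𝟙-no (v ≟ᵛ partner T) (λ { refl → ¬fpf (⟦⟧-fixedPointFree T) }))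

∨-true : ∀ a {b} → a ∨ b ≡ true → (a ≡ true) ⊎ (b ≡ true)
∨-true true  _  = inj₁ refl
∨-true false eq = inj₂ eq

∨-trueˡ : ∀ {a} b → a ≡ true → a ∨ b ≡ true
∨-trueˡ b refl = refl

∨-trueʳ : ∀ a {b} → b ≡ true → a ∨ b ≡ true
∨-trueʳ true  _    = refl
∨-trueʳ false refl = refl

does-true : ∀ {P : Set} (P? : Dec P) → does P? ≡ true → P
does-true (yes p) _ = p

∑-lookup : ∀ {A : Set} (xs : List A) (f : A → ℚ) → ∑ xs f ≡ ∑ (allFin (length xs)) (f ∘ List.lookup xs)
∑-lookup []       f = refl
∑-lookup (x ∷ xs) f = trans (cong (f x +_) (∑-lookup xs f)) (sym (∑-allFin-suc (length xs) _))

fromℕ-length-filter : ∀ {A : Set} {P : A → Set} (P? : ∀ x → Dec (P x)) xs →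
                      fromℕ (length (filter P? xs)) ≡ ∑ xs (λ x → 𝟙 (P? x))
fromℕ-length-filter P? xs = begin
  fromℕ (length (filter P? xs))                ≡⟨ sym (∑-one _) ⟩
  ∑ (allFin (length (filter P? xs))) (λ _ → 1ℚ) ≡⟨ sym (∑-lookup (filter P? xs) (λ _ → 1ℚ)) ⟩
  ∑ (filter P? xs) (λ _ → 1ℚ)                   ≡⟨ ∑-filter P? xs (λ _ → 1ℚ) ⟩
  ∑ xs (λ x → 𝟙 (P? x) * 1ℚ)                    ≡⟨ ∑-cong xs (λ x → *-identityʳ _) ⟩
  ∑ xs (λ x → 𝟙 (P? x))                         ∎
  where open ≡-Reasoning

lookup-injective : ∀ {A : Set} {xs : List A} → Unique xs → ∀ i j →
                   List.lookup xs i ≡ List.lookup xs j → i ≡ j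
lookup-injective (x∉ ∷ u) Fin.zero    Fin.zero    eq = refl
lookup-injective (x∉ ∷ u) Fin.zero    (Fin.suc j) eq = contradiction eq (All.lookup x∉ (Memₚ.∈-lookup j))
lookup-injective (x∉ ∷ u) (Fin.suc i) Fin.zero    eq = contradiction (sym eq) (All.lookup x∉ (Memₚ.∈-lookup i))
lookup-injective (x∉ ∷ u) (Fin.suc i) (Fin.suc j) eq = cong Fin.suc (lookup-injective u i j eq)

module Graph {n : ℕ} (S₁ S₂ : PairPartition n) where

  τ : Bool → Fin (n ℕ.* 2) → Fin (n ℕ.* 2)
  τ false = ⟦ S₁ ⟧
  τ true  = ⟦ S₂ ⟧

  τ-inv : ∀ b i → τ b (τ b i) ≡ i
  τ-inv false = ⟦⟧-involutive S₁
  τ-inv true  = ⟦⟧-involutive S₂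

  τ-fpf : ∀ b i → τ b i ≢ i
  τ-fpf false = ⟦⟧-fixedPointFree S₁
  τ-fpf true  = ⟦⟧-fixedPointFree S₂

  open Loops τ τ-inv τ-fpf public

  linked⇒~ : ∀ k {i j} → linked S₁ S₂ k i j ≡ true → i ~ j
  linked⇒~ zero    {i} {j} eq with does-true (i Fin.≟ j) eq
  ... | refl = ~-refl
  linked⇒~ (suc k) {i} {j} eq with ∨-true (linked S₁ S₂ k i j) eq
  ... | inj₁ eq₀ = linked⇒~ k eq₀
  ... | inj₂ eq′ with ∨-true (linked S₁ S₂ k (⟦ S₁ ⟧ i) j) eq′
  ...   | inj₁ eq₁ = ~-trans (~-τ false ~-refl) (linked⇒~ k eq₁)
  ...   | inj₂ eq₂ = ~-trans (~-τ true ~-refl) (linked⇒~ k eq₂)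

  linked-weaken : ∀ k {i j} → linked S₁ S₂ k i j ≡ true → linked S₁ S₂ (suc k) i j ≡ true
  linked-weaken k = ∨-trueˡ _

  linked-τ : ∀ b k {i j} → linked S₁ S₂ k i j ≡ true → linked S₁ S₂ (suc k) i (τ b j) ≡ true
  linked-τ b zero {i} {j} eq with does-true (i Fin.≟ j) eq
  ... | refl = ∨-trueʳ (linked S₁ S₂ 0 i (τ b i)) (step b)
    where
    step : ∀ b → linked S₁ S₂ 0 (⟦ S₁ ⟧ i) (τ b i) ∨ linked S₁ S₂ 0 (⟦ S₂ ⟧ i) (τ b i) ≡ true
    step false = ∨-trueˡ _ (dec-true (⟦ S₁ ⟧ i Fin.≟ ⟦ S₁ ⟧ i) refl)
    step true  = ∨-trueʳ (linked S₁ S₂ 0 (⟦ S₁ ⟧ i) (⟦ S₂ ⟧ i)) (dec-true (⟦ S₂ ⟧ i Fin.≟ ⟦ S₂ ⟧ i) refl)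
  linked-τ b (suc k) {i} {j} eq with ∨-true (linked S₁ S₂ k i j) eq
  ... | inj₁ eq₀ = ∨-trueˡ _ (linked-τ b k eq₀)
  ... | inj₂ eq′ with ∨-true (linked S₁ S₂ k (⟦ S₁ ⟧ i) j) eq′
  ...   | inj₁ eq₁ = ∨-trueʳ (linked S₁ S₂ (suc k) i (τ b j)) (∨-trueˡ _ (linked-τ b k eq₁))
  ...   | inj₂ eq₂ = ∨-trueʳ (linked S₁ S₂ (suc k) i (τ b j))
                       (∨-trueʳ (linked S₁ S₂ (suc k) (⟦ S₁ ⟧ i) (τ b j)) (linked-τ b k eq₂))

  linked-walk : ∀ k i → linked S₁ S₂ k i (walk k i) ≡ true
  linked-walk zero    i = dec-true (i Fin.≟ i) refl
  linked-walk (suc k) i = linked-τ (odd k) k (linked-walk k i)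

  linked-mono : ∀ d {k i j} → linked S₁ S₂ k i j ≡ true → linked S₁ S₂ (d ℕ.+ k) i j ≡ true
  linked-mono zero    eq = eq
  linked-mono (suc d) {k} {i} {j} eq = linked-weaken (d ℕ.+ k) {i} {j} (linked-mono d eq)

  ~⇒linked : ∀ {i j} → i ~ j → linked S₁ S₂ (n ℕ.* 2) i j ≡ true
  ~⇒linked {i} i~j with ~-normal i~j
  ... | k , refl = subst (λ l → linked S₁ S₂ l i (walk (toℕ k) i) ≡ true)
    (ℕₚ.m∸n+n≡m (ℕₚ.≤-trans (ℕₚ.<⇒≤ (Finₚ.toℕ<n k)) (period-bound i)))
    (linked-mono (n ℕ.* 2 ∸ toℕ k) (linked-walk (toℕ k) i))

  T-linked⇒~ : ∀ {i j} → Data.Bool.T (linked S₁ S₂ (n ℕ.* 2) i j) → i ~ j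
  T-linked⇒~ {i} {j} t = linked⇒~ (n ℕ.* 2) (Equivalence.to Data.Bool.Properties.T-≡ t)

  ~⇒T-linked : ∀ {i j} → i ~ j → Data.Bool.T (linked S₁ S₂ (n ℕ.* 2) i j)
  ~⇒T-linked i~j = Equivalence.from Data.Bool.Properties.T-≡ (~⇒linked i~j)

  ∈-loopEdges⁻ : ∀ {i j} → j ∈ loopEdges S₁ S₂ i → i ~ j
  ∈-loopEdges⁻ {i} j∈ = T-linked⇒~ (proj₂ (Memₚ.∈-filter⁻ (Data.Bool.T? ∘ linked S₁ S₂ (n ℕ.* 2) i) {xs = allFin (n ℕ.* 2)} j∈))

  ∈-loopEdges⁺ : ∀ {i j} → i ~ j → j ∈ loopEdges S₁ S₂ i
  ∈-loopEdges⁺ {i} {j} i~j = Memₚ.∈-filter⁺ (Data.Bool.T? ∘ linked S₁ S₂ (n ℕ.* 2) i) (Memₚ.∈-allFin j) (~⇒T-linked i~j)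

  length-loopEdges : ∀ i → length (loopEdges S₁ S₂ i) ≡ period i ℕ.* 2
  length-loopEdges i = fromℕ-injective (begin
    fromℕ (length (loopEdges S₁ S₂ i))
      ≡⟨ fromℕ-length-filter (Data.Bool.T? ∘ linked S₁ S₂ (n ℕ.* 2) i) (allFin (n ℕ.* 2)) ⟩
    ∑ (allFin (n ℕ.* 2)) (λ j → 𝟙 (Data.Bool.T? (linked S₁ S₂ (n ℕ.* 2) i j)))
      ≡⟨ ∑-cong (allFin (n ℕ.* 2)) (λ j → 𝟙-cong (Data.Bool.T? _) (i ~? j) T-linked⇒~ ~⇒T-linked) ⟩
    ∑ (allFin (n ℕ.* 2)) (λ j → 𝟙 (i ~? j))
      ≡⟨ ∑-loop i ⟩
    fromℕ (period i ℕ.* 2) ∎)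
    where open ≡-Reasoning

  reps : List (Fin (n ℕ.* 2))
  reps = loopRepresentatives S₁ S₂

  private
    rep′? : ∀ i → Dec (All (i Fin.≤_) (loopEdges S₁ S₂ i))
    rep′? i = All.all? (i Fin.≤?_) (loopEdges S₁ S₂ i)

    rep′⇒IsRep : ∀ {i} → All (i Fin.≤_) (loopEdges S₁ S₂ i) → IsRep i
    rep′⇒IsRep all j i~j = All.lookup all (∈-loopEdges⁺ i~j)

    IsRep⇒rep′ : ∀ {i} → IsRep i → All (i Fin.≤_) (loopEdges S₁ S₂ i)
    IsRep⇒rep′ i-rep = All.tabulate (λ j∈ → i-rep _ (∈-loopEdges⁻ j∈))

  ∈-reps : ∀ {i} → IsRep i → i ∈ reps
  ∈-reps {i} i-rep = Memₚ.∈-filter⁺ rep′? (Memₚ.∈-allFin i) (IsRep⇒rep′ i-rep)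

  reps-IsRep : ∀ {i} → i ∈ reps → IsRep i
  reps-IsRep i∈ = rep′⇒IsRep (proj₂ (Memₚ.∈-filter⁻ rep′? {xs = allFin (n ℕ.* 2)} i∈))

  reps-unique : Unique reps
  reps-unique = Uniqueₚ.filter⁺ rep′? (Uniqueₚ.allFin⁺ (n ℕ.* 2))

  ∑-over-reps : ∀ f → ∑ reps f ≡ ∑ (allFin (n ℕ.* 2)) (λ i → 𝟙 (isRep? i) * f i)
  ∑-over-reps f = trans (∑-filter rep′? (allFin (n ℕ.* 2)) f)
    (∑-cong (allFin (n ℕ.* 2)) (λ i → cong (_* f i) (𝟙-cong (rep′? i) (isRep? i) rep′⇒IsRep IsRep⇒rep′)))

  loops≡ : loops S₁ S₂ ≡ map period reps
  loops≡ = Listₚ.map-cong (λ i → trans (cong ⌊_/2⌋ (length-loopEdges i)) (half-*2 (period i))) reps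
    where
    half-*2 : ∀ k → ⌊ k ℕ.* 2 /2⌋ ≡ k
    half-*2 zero    = refl
    half-*2 (suc k) = cong suc (half-*2 k)

  loops-positive : Positive (loops S₁ S₂)
  loops-positive = subst Positive (sym loops≡) (Allₚ.map⁺ (All.universal (λ _ → s≤s z≤n) reps))

  ∑-by-loop : ∀ (f g : Fin (n ℕ.* 2) → ℚ) →
              (∀ i → IsRep i → ∑ (allFin (n ℕ.* 2)) (λ j → 𝟙 (i ~? j) * f j) ≡ g i) →
              ∑ (allFin (n ℕ.* 2)) f ≡ ∑ reps g
  ∑-by-loop f g loop = trans (∑-reps f g loop) (sym (∑-over-reps g))

  sum-loops : sum (loops S₁ S₂) ≡ n
  sum-loops = ℕₚ.*-cancelʳ-≡ (sum (loops S₁ S₂)) n 2 (fromℕ-injective (begin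
    fromℕ (sum (loops S₁ S₂) ℕ.* 2)
      ≡⟨ fromℕ-* (sum (loops S₁ S₂)) 2 ⟩
    fromℕ (sum (loops S₁ S₂)) * fromℕ 2
      ≡⟨ cong (λ ls → fromℕ (sum ls) * fromℕ 2) loops≡ ⟩
    fromℕ (sum (map period reps)) * fromℕ 2
      ≡⟨ cong (_* fromℕ 2) (fromℕ-sum period reps) ⟩
    ∑ reps (fromℕ ∘ period) * fromℕ 2
      ≡⟨ ∑-*ʳ (fromℕ 2) reps _ ⟩
    ∑ reps (λ i → fromℕ (period i) * fromℕ 2)
      ≡⟨ sym (∑-by-loop (λ _ → 1ℚ) _ (λ i _ → trans (∑-cong (allFin (n ℕ.* 2)) (λ j → *-identityʳ _))
           (trans (∑-loop i) (fromℕ-* (period i) 2)))) ⟩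
    ∑ (allFin (n ℕ.* 2)) (λ _ → 1ℚ)
      ≡⟨ ∑-one (n ℕ.* 2) ⟩
    fromℕ (n ℕ.* 2) ∎))
    where open ≡-Reasoning

  length-loops : length (loops S₁ S₂) ≡ length reps
  length-loops = trans (cong length loops≡) (Listₚ.length-map period reps)

  length-loops≤n : length (loops S₁ S₂) ≤ n
  length-loops≤n = subst (length (loops S₁ S₂) ≤_) sum-loops (length≤sum loops-positive)

  repIndex : Fin (n ℕ.* 2) → Fin (length reps)
  repIndex i = Any.index (∈-reps (rep-isRep i))

  lookup-repIndex : ∀ i → List.lookup reps (repIndex i) ≡ rep i
  lookup-repIndex i = sym (Anyₚ.lookup-index (∈-reps (rep-isRep i)))

  lookup-reps-injective : ∀ {i j} → List.lookup reps i ≡ List.lookup reps j → i ≡ j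
  lookup-reps-injective = lookup-injective reps-unique _ _

  lookup-reps-IsRep : ∀ i → IsRep (List.lookup reps i)
  lookup-reps-IsRep i = reps-IsRep (Memₚ.∈-lookup i)

  rep-lookup-reps : ∀ i → rep (List.lookup reps i) ≡ List.lookup reps i
  rep-lookup-reps i = sym (rep-unique (lookup-reps-IsRep i) (rep-isRep _) (~-rep _))

  repIndex-lookup : ∀ i → repIndex (List.lookup reps i) ≡ i
  repIndex-lookup i = lookup-reps-injective (trans (lookup-repIndex _) (rep-lookup-reps i))

  repIndex-cong : ∀ {i j} → i ~ j → repIndex i ≡ repIndex j
  repIndex-cong {i} {j} i~j = lookup-reps-injective (trans (lookup-repIndex i) (trans
    (rep-unique (rep-isRep i) (rep-isRep j) (~-trans (~-sym (~-rep i)) (~-trans i~j (~-rep j))))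
    (sym (lookup-repIndex j))))

-- Equivariant maps out of the edge set of 𝓛(S₁,S₂): such a map is determined
-- by the images of the loop representatives.

module Equivariant {n : ℕ} (S₁ S₂ : PairPartition n) {X : Set} (EX : Enumeration X)
                   (σ : Bool → X → X) (σ-inv : ∀ b x → σ b (σ b x) ≡ x) where

  open Graph S₁ S₂
  private
    module X = Walk σ σ-inv
    _≟X_ = Enumeration._≟_ EX

  IsEquivariant : Vec X (n ℕ.* 2) → Set
  IsEquivariant w = (∀ i → lookup w (⟦ S₁ ⟧ i) ≡ σ false (lookup w i)) ×
                    (∀ i → lookup w (⟦ S₂ ⟧ i) ≡ σ true (lookup w i))

  equivariant? : ∀ w → Dec (IsEquivariant w)
  equivariant? w = Finₚ.all? (λ i → lookup w (⟦ S₁ ⟧ i) ≟X σ false (lookup w i)) ×-dec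
                   Finₚ.all? (λ i → lookup w (⟦ S₂ ⟧ i) ≟X σ true (lookup w i))

  Compatible : Vec X (length reps) → Set
  Compatible c = ∀ q → X.Closes (lookup c q) (period (List.lookup reps q))

  compatible? : ∀ c → Dec (Compatible c)
  compatible? c = Finₚ.all? (λ q → X.walk (period (List.lookup reps q) ℕ.* 2) (lookup c q) ≟X lookup c q)

  steps : Fin (n ℕ.* 2) → ℕ
  steps i = proj₁ (~-sym (~-rep i))

  restrict : Vec X (n ℕ.* 2) → Vec X (length reps)
  restrict w = tabulate (λ q → lookup w (List.lookup reps q))

  extend : Vec X (length reps) → Vec X (n ℕ.* 2)
  extend c = tabulate (λ i → X.walk (steps i) (lookup c (repIndex i)))

  opaque
    from-rep : ∀ i → List.lookup reps (repIndex i) ~ i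
    from-rep i = subst (_~ i) (sym (lookup-repIndex i)) (~-sym (~-rep i))

  equivariant-τ : ∀ w → IsEquivariant w → ∀ b i → lookup w (τ b i) ≡ σ b (lookup w i)
  equivariant-τ w eqv false = proj₁ eqv
  equivariant-τ w eqv true  = proj₂ eqv

  equivariant-walk : ∀ w → IsEquivariant w → ∀ k i → lookup w (walk k i) ≡ X.walk k (lookup w i)
  equivariant-walk w eqv zero    i = refl
  equivariant-walk w eqv (suc k) i =
    trans (equivariant-τ w eqv (odd k) (walk k i)) (cong (σ (odd k)) (equivariant-walk w eqv k i))

  restrict-compatible : ∀ w → IsEquivariant w → Compatible (restrict w)
  restrict-compatible w eqv q = subst (λ x → X.Closes x (period r)) (sym (Vecₚ.lookup∘tabulate _ q))
    (trans (sym (equivariant-walk w eqv (period r ℕ.* 2) r)) (cong (lookup w) (period-closes r)))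
    where r = List.lookup reps q

  walk-determines : ∀ {x k k′} i → X.Closes x (period i) → walk k i ≡ walk k′ i → X.walk k x ≡ X.walk k′ x
  walk-determines {x} {k} {k′} i closes eq = begin
    X.walk k x                        ≡⟨ X.walk-% {ℓ = predPeriod i} closes k ⟩
    X.walk (k ℕ.% (period i ℕ.* 2)) x  ≡⟨ cong (λ j → X.walk j x) (walk-injective i
                                          (m%n<n k (period i ℕ.* 2)) (m%n<n k′ (period i ℕ.* 2))
                                          (trans (sym (walk-% {ℓ = predPeriod i} (period-closes i) k))
                                            (trans eq (walk-% {ℓ = predPeriod i} (period-closes i) k′)))) ⟩
    X.walk (k′ ℕ.% (period i ℕ.* 2)) x ≡⟨ sym (X.walk-% {ℓ = predPeriod i} closes k′) ⟩
    X.walk k′ x                       ∎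
    where open ≡-Reasoning

  extend-walk : ∀ c → Compatible c → ∀ q k →
                lookup (extend c) (walk k (List.lookup reps q)) ≡ X.walk k (lookup c q)
  extend-walk c comp q k = begin
    lookup (extend c) i                          ≡⟨ Vecₚ.lookup∘tabulate _ i ⟩
    X.walk (steps i) (lookup c (repIndex i))     ≡⟨ cong (X.walk (steps i) ∘ lookup c) index≡ ⟩
    X.walk (steps i) (lookup c q)                ≡⟨ walk-determines {k = steps i} {k′ = k} (List.lookup reps q) (comp q) walks ⟩
    X.walk k (lookup c q)                        ∎
    where
    open ≡-Reasoning
    i = walk k (List.lookup reps q)
    index≡ : repIndex i ≡ q
    index≡ = trans (repIndex-cong (~-sym (k , refl))) (repIndex-lookup q)
    walks : walk (steps i) (List.lookup reps q) ≡ walk k (List.lookup reps q)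
    walks = trans (cong (walk (steps i)) (trans (cong (List.lookup reps) (sym index≡)) (lookup-repIndex i)))
                  (proj₂ (~-sym (~-rep i)))

  extend-τ : ∀ c → Compatible c → ∀ b i → lookup (extend c) (τ b i) ≡ σ b (lookup (extend c) i)
  extend-τ c comp b i with ~-positive (from-rep i)
  ... | k , eq = subst (λ i → lookup (extend c) (τ b i) ≡ σ b (lookup (extend c) i)) eq (step (odd k Data.Bool.≟ b))
    where
    q = repIndex i
    r = List.lookup reps q
    open ≡-Reasoning
    step : Dec (odd k ≡ b) → lookup (extend c) (τ b (walk (suc k) r)) ≡ σ b (lookup (extend c) (walk (suc k) r))
    step (yes refl) = begin
      lookup (extend c) (τ b (walk (suc k) r)) ≡⟨ cong (lookup (extend c)) (walk-back k r) ⟩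
      lookup (extend c) (walk k r)             ≡⟨ extend-walk c comp q k ⟩
      X.walk k (lookup c q)                    ≡⟨ sym (X.walk-back k (lookup c q)) ⟩
      σ b (X.walk (suc k) (lookup c q))        ≡⟨ cong (σ b) (sym (extend-walk c comp q (suc k))) ⟩
      σ b (lookup (extend c) (walk (suc k) r)) ∎
    step (no neq) = begin
      lookup (extend c) (τ b (walk (suc k) r)) ≡⟨ cong (λ b → lookup (extend c) (τ b (walk (suc k) r))) b≡ ⟩
      lookup (extend c) (walk (suc (suc k)) r) ≡⟨ extend-walk c comp q (suc (suc k)) ⟩
      X.walk (suc (suc k)) (lookup c q)        ≡⟨ cong (λ b → σ b (X.walk (suc k) (lookup c q))) (sym b≡) ⟩
      σ b (X.walk (suc k) (lookup c q))        ≡⟨ cong (σ b) (sym (extend-walk c comp q (suc k))) ⟩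
      σ b (lookup (extend c) (walk (suc k) r)) ∎
      where
      b≡ : b ≡ odd (suc k)
      b≡ = ¬-not (neq ∘ sym)

  extend-equivariant : ∀ c → Compatible c → IsEquivariant (extend c)
  extend-equivariant c comp = extend-τ c comp false , extend-τ c comp true

  extend-restrict : ∀ w → IsEquivariant w → extend (restrict w) ≡ w
  extend-restrict w eqv = trans (Vecₚ.tabulate-cong at) (Vecₚ.tabulate∘lookup w)
    where
    open ≡-Reasoning
    at : ∀ i → X.walk (steps i) (lookup (restrict w) (repIndex i)) ≡ lookup w i
    at i = begin
      X.walk (steps i) (lookup (restrict w) (repIndex i))
        ≡⟨ cong (X.walk (steps i)) (trans (Vecₚ.lookup∘tabulate _ (repIndex i)) (cong (lookup w) (lookup-repIndex i))) ⟩
      X.walk (steps i) (lookup w (rep i))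
        ≡⟨ sym (equivariant-walk w eqv (steps i) (rep i)) ⟩
      lookup w (walk (steps i) (rep i))
        ≡⟨ cong (lookup w) (proj₂ (~-sym (~-rep i))) ⟩
      lookup w i ∎

  restrict-extend : ∀ c → Compatible c → restrict (extend c) ≡ c
  restrict-extend c comp = trans (Vecₚ.tabulate-cong (λ q → extend-walk c comp q 0)) (Vecₚ.tabulate∘lookup c)

  ∑-equivariant : ∀ (W : Vec X (n ℕ.* 2) → ℚ) →
                  ∑ (tuples (elements EX) (n ℕ.* 2)) (λ w → 𝟙 (equivariant? w) * W w) ≡
                  ∑ (tuples (elements EX) (length reps)) (λ c → 𝟙 (compatible? c) * W (extend c))
  ∑-equivariant W = ∑-bijection (tuplesE EX (n ℕ.* 2)) (tuplesE EX (length reps)) equivariant? compatible?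
    restrict extend restrict-compatible extend-equivariant extend-restrict restrict-extend
    W (W ∘ extend) (λ w eqv → cong W (sym (extend-restrict w eqv)))

-- Colourings of the loops

∑-weight : ∀ {A : Set} (f : A → ℕ) {k} rs (c : Vec (Fin k) (length rs)) j →
           fromℕ (weight f rs c j) ≡
           ∑ (allFin (length rs)) (λ q → fromℕ (f (List.lookup rs q)) * 𝟙 (lookup c q Fin.≟ j))
∑-weight f []       []       j = fromℕ-0
∑-weight f (r ∷ rs) (x ∷ c) j = begin
  fromℕ ((if does (x Fin.≟ j) then f r else 0) ℕ.+ weight f rs c j)
    ≡⟨ fromℕ-+ (if does (x Fin.≟ j) then f r else 0) _ ⟩
  fromℕ (if does (x Fin.≟ j) then f r else 0) + fromℕ (weight f rs c j)
    ≡⟨ cong₂ _+_ (head (x Fin.≟ j)) (∑-weight f rs c j) ⟩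
  fromℕ (f r) * 𝟙 (x Fin.≟ j) +
  ∑ (allFin (length rs)) (λ q → fromℕ (f (List.lookup rs q)) * 𝟙 (lookup c q Fin.≟ j))
    ≡⟨ sym (∑-allFin-suc (length rs) _) ⟩
  ∑ (allFin (suc (length rs))) (λ q → fromℕ (f (List.lookup (r ∷ rs) q)) * 𝟙 (lookup (x ∷ c) q Fin.≟ j)) ∎
  where
  open ≡-Reasoning
  head : ∀ {P : Set} (P? : Dec P) → fromℕ (if does P? then f r else 0) ≡ fromℕ (f r) * 𝟙 P?
  head P?@(yes p) = sym (trans (cong (fromℕ (f r) *_) (𝟙-yes P? p)) (*-identityʳ _))
  head P?@(no ¬p) = trans fromℕ-0 (sym (trans (cong (fromℕ (f r) *_) (𝟙-no P? ¬p)) (zeroʳ _)))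

HasContent : ∀ {k m} → Vec ℕ k → Vec (Fin k) m → Set
HasContent {m = m} e w = ∀ j → ∑ (allFin m) (λ i → 𝟙 (lookup w i Fin.≟ j)) ≡ fromℕ (lookup e j ℕ.* 2)

hasContent? : ∀ {k m} (e : Vec ℕ k) (w : Vec (Fin k) m) → Dec (HasContent e w)
hasContent? {m = m} e w =
  Finₚ.all? (λ j → ∑ (allFin m) (λ i → 𝟙 (lookup w i Fin.≟ j)) ℚ.≟ fromℕ (lookup e j ℕ.* 2))

invariant? : ∀ {k n} (S : PairPartition n) (w : Vec (Fin k) (n ℕ.* 2)) →
             Dec (∀ i → lookup w (⟦ S ⟧ i) ≡ lookup w i)
invariant? S w = Finₚ.all? (λ i → lookup w (⟦ S ⟧ i) Fin.≟ lookup w i)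

module Colouring {n : ℕ} (S₁ S₂ : PairPartition n) {k : ℕ} where

  open Graph S₁ S₂
  open Equivariant S₁ S₂ (finE k) (λ _ → id) (λ _ _ → refl)
  private module X = Walk {Fin k} (λ _ → id) (λ _ _ → refl)

  walk-constant : ∀ j x → X.walk j x ≡ x
  walk-constant zero    x = refl
  walk-constant (suc j) x = walk-constant j x

  lookup-extend : ∀ c i → lookup (extend c) i ≡ lookup c (repIndex i)
  lookup-extend c i = trans (Vecₚ.lookup∘tabulate _ i) (walk-constant (steps i) _)

  content-extend : ∀ c j → ∑ (allFin (n ℕ.* 2)) (λ i → 𝟙 (lookup (extend c) i Fin.≟ j)) ≡
                   fromℕ (weight period reps c j ℕ.* 2)
  content-extend c j = begin
    ∑ (allFin (n ℕ.* 2)) (λ i → 𝟙 (lookup (extend c) i Fin.≟ j))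
      ≡⟨ ∑-by-loop _ (λ r → fromℕ (period r) * 𝟙 (lookup c (repIndex r) Fin.≟ j) * fromℕ 2) (λ r _ → loop r) ⟩
    ∑ reps (λ r → fromℕ (period r) * 𝟙 (lookup c (repIndex r) Fin.≟ j) * fromℕ 2)
      ≡⟨ ∑-lookup reps _ ⟩
    ∑ (allFin (length reps)) (λ q → fromℕ (period (List.lookup reps q)) *
                                    𝟙 (lookup c (repIndex (List.lookup reps q)) Fin.≟ j) * fromℕ 2)
      ≡⟨ ∑-cong (allFin (length reps)) (λ q → cong (λ q′ → fromℕ (period (List.lookup reps q)) *
                                              𝟙 (lookup c q′ Fin.≟ j) * fromℕ 2) (repIndex-lookup q)) ⟩
    ∑ (allFin (length reps)) (λ q → fromℕ (period (List.lookup reps q)) * 𝟙 (lookup c q Fin.≟ j) * fromℕ 2)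
      ≡⟨ sym (∑-*ʳ (fromℕ 2) (allFin (length reps)) _) ⟩
    ∑ (allFin (length reps)) (λ q → fromℕ (period (List.lookup reps q)) * 𝟙 (lookup c q Fin.≟ j)) * fromℕ 2
      ≡⟨ cong (_* fromℕ 2) (sym (∑-weight period reps c j)) ⟩
    fromℕ (weight period reps c j) * fromℕ 2
      ≡⟨ sym (fromℕ-* (weight period reps c j) 2) ⟩
    fromℕ (weight period reps c j ℕ.* 2) ∎
    where
    open ≡-Reasoning
    regroup : ∀ a b d → (a * b) * d ≡ (a * d) * b
    regroup = solve 3 (λ a b d → (a :* b) :* d := (a :* d) :* b) refl
    loop : ∀ r → ∑ (allFin (n ℕ.* 2)) (λ i → 𝟙 (r ~? i) * 𝟙 (lookup (extend c) i Fin.≟ j)) ≡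
                 fromℕ (period r) * 𝟙 (lookup c (repIndex r) Fin.≟ j) * fromℕ 2
    loop r = begin
      ∑ (allFin (n ℕ.* 2)) (λ i → 𝟙 (r ~? i) * 𝟙 (lookup (extend c) i Fin.≟ j))
        ≡⟨ ∑-cong (allFin (n ℕ.* 2)) (λ i → 𝟙-guard (r ~? i) (λ r~i → cong (λ x → 𝟙 (x Fin.≟ j))
             (trans (lookup-extend c i) (cong (lookup c) (repIndex-cong (~-sym r~i)))))) ⟩
      ∑ (allFin (n ℕ.* 2)) (λ i → 𝟙 (r ~? i) * 𝟙 (lookup c (repIndex r) Fin.≟ j))
        ≡⟨ sym (∑-*ʳ _ (allFin (n ℕ.* 2)) _) ⟩
      ∑ (allFin (n ℕ.* 2)) (λ i → 𝟙 (r ~? i)) * 𝟙 (lookup c (repIndex r) Fin.≟ j)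
        ≡⟨ cong (_* 𝟙 (lookup c (repIndex r) Fin.≟ j)) (trans (∑-loop r) (fromℕ-* (period r) 2)) ⟩
      (fromℕ (period r) * fromℕ 2) * 𝟙 (lookup c (repIndex r) Fin.≟ j)
        ≡⟨ regroup (fromℕ (period r)) (fromℕ 2) _ ⟩
      fromℕ (period r) * 𝟙 (lookup c (repIndex r) Fin.≟ j) * fromℕ 2 ∎

  powerSumCoeff-loops : ∀ (e : Vec ℕ k) →
    fromℕ (powerSumCoeff (loops S₁ S₂) (Vec.toList e)) ≡
    ∑ (tuples (allFin k) (n ℕ.* 2)) (λ w → 𝟙 (invariant? S₁ w) * 𝟙 (invariant? S₂ w) * 𝟙 (hasContent? e w))
  powerSumCoeff-loops e = begin
    fromℕ (powerSumCoeff (loops S₁ S₂) (Vec.toList e))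
      ≡⟨ cong (λ ls → fromℕ (powerSumCoeff ls (Vec.toList e))) loops≡ ⟩
    fromℕ (powerSumCoeff (map period reps) (Vec.toList e))
      ≡⟨ powerSumCoeff≡ period reps e ⟩
    ∑ (tuples (allFin k) (length reps)) (λ c → 𝟙 (hasWeight? period e reps c))
      ≡⟨ ∑-cong (tuples (allFin k) (length reps)) (λ c → trans
           (𝟙-cong (hasWeight? period e reps c) (hasContent? e (extend c))
             (λ eqs j → trans (content-extend c j) (cong (λ a → fromℕ (a ℕ.* 2)) (eqs j)))
             (λ eqs j → ℕₚ.*-cancelʳ-≡ _ _ 2 (fromℕ-injective (trans (sym (content-extend c j)) (eqs j)))))
           (sym (𝟙-*-yes (compatible? c) _ (λ q → walk-constant (period (List.lookup reps q) ℕ.* 2) _)))) ⟩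
    ∑ (tuples (allFin k) (length reps)) (λ c → 𝟙 (compatible? c) * 𝟙 (hasContent? e (extend c)))
      ≡⟨ sym (∑-equivariant (λ w → 𝟙 (hasContent? e w))) ⟩
    ∑ (tuples (allFin k) (n ℕ.* 2)) (λ w → 𝟙 (equivariant? w) * 𝟙 (hasContent? e w))
      ≡⟨ ∑-cong (tuples (allFin k) (n ℕ.* 2)) (λ w →
           cong (_* 𝟙 (hasContent? e w)) (𝟙-× (invariant? S₁ w) (invariant? S₂ w))) ⟩
    ∑ (tuples (allFin k) (n ℕ.* 2)) (λ w → 𝟙 (invariant? S₁ w) * 𝟙 (invariant? S₂ w) * 𝟙 (hasContent? e w)) ∎
    where open ≡-Reasoning

-- Counting isomorphisms between the graphs of two couples

-- The number of ways to match loops of half-lengths k₁, k₂, … one after the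
-- other with a point on a new loop of the same half-length, when initially
-- M k points lie on loops of half-length k.
matchings : List ℕ → (ℕ → ℚ) → ℚ
matchings []       M = 1ℚ
matchings (k ∷ ks) M = M k * matchings ks (λ j → M j + - (𝟙 (j ℕ.≟ k) * fromℕ (k ℕ.* 2)))

matchings-cong : ∀ ks {M M′} → (∀ j → M j ≡ M′ j) → matchings ks M ≡ matchings ks M′
matchings-cong []       eq = refl
matchings-cong (k ∷ ks) eq = cong₂ _*_ (eq k) (matchings-cong ks (λ j → cong (_+ _) (eq j)))

Injective : ∀ {m} → Vec (Fin m) m → Set
Injective w = ∀ i j → lookup w i ≡ lookup w j → i ≡ j

injective? : ∀ {m} (w : Vec (Fin m) m) → Dec (Injective w)
injective? w = Finₚ.all? (λ i → Finₚ.all? (λ j → (lookup w i Fin.≟ lookup w j) →-dec (i Fin.≟ j)))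

module Isomorphism {n : ℕ} (S₁ S₂ T₁ T₂ : PairPartition n) where

  private
    m = n ℕ.* 2
    module S = Graph S₁ S₂
    module T = Graph T₁ T₂
    module W = Walk T.τ T.τ-inv
  open Equivariant S₁ S₂ (finE m) T.τ T.τ-inv
  open Graph S₁ S₂ using (reps)

  module _ {A : Set} (f : A → ℕ) where

    Free : List (Fin m) → Fin m → Set
    Free us x = All (λ u → ¬ u T.~ x) us

    free? : ∀ us x → Dec (Free us x)
    free? us x = All.all? (λ u → ¬? (u T.~? x)) us

    Matching : (rs : List A) → List (Fin m) → Vec (Fin m) (length rs) → Set
    Matching rs us c = (∀ q → T.period (lookup c q) ≡ f (List.lookup rs q)) ×
                       (∀ q → Free us (lookup c q)) ×
                       (∀ q q′ → lookup c q T.~ lookup c q′ → q ≡ q′)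

    matching? : ∀ rs us c → Dec (Matching rs us c)
    matching? rs us c = Finₚ.all? (λ q → T.period (lookup c q) ℕ.≟ f (List.lookup rs q)) ×-dec
                        Finₚ.all? (λ q → free? us (lookup c q)) ×-dec
                        Finₚ.all? (λ q → Finₚ.all? (λ q′ → (lookup c q T.~? lookup c q′) →-dec (q Fin.≟ q′)))

    matching-∷⁻ : ∀ {r rs us x c} → Matching (r ∷ rs) us (x ∷ c) →
                  (T.period x ≡ f r × Free us x) × Matching rs (x ∷ us) c
    matching-∷⁻ (per , free , dist) =
      (per Fin.zero , free Fin.zero) ,
      per ∘ Fin.suc ,
      (λ q → (λ x~ → case dist Fin.zero (Fin.suc q) x~ of λ ()) ∷ free (Fin.suc q)) ,
      (λ q q′ c~ → Finₚ.suc-injective (dist (Fin.suc q) (Fin.suc q′) c~))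

    matching-∷⁺ : ∀ {r rs us x c} → (T.period x ≡ f r × Free us x) × Matching rs (x ∷ us) c →
                  Matching (r ∷ rs) us (x ∷ c)
    matching-∷⁺ {x = x} {c} ((per₀ , free₀) , per , free , dist) = per′ , free′ , dist′
      where
      per′ : ∀ q → _
      per′ Fin.zero    = per₀
      per′ (Fin.suc q) = per q
      free′ : ∀ q → _
      free′ Fin.zero    = free₀
      free′ (Fin.suc q) = All.tail (free q)
      dist′ : ∀ q q′ → lookup (x ∷ c) q T.~ lookup (x ∷ c) q′ → q ≡ q′
      dist′ Fin.zero    Fin.zero     _  = refl
      dist′ Fin.zero    (Fin.suc q′) c~ = contradiction c~ (All.head (free q′))
      dist′ (Fin.suc q) Fin.zero     c~ = contradiction (T.~-sym c~) (All.head (free q))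
      dist′ (Fin.suc q) (Fin.suc q′) c~ = cong Fin.suc (dist q q′ c~)

    available : List (Fin m) → ℕ → ℚ
    available us k = ∑ (allFin m) (λ x → 𝟙 ((T.period x ℕ.≟ k) ×-dec free? us x))

    available-∷ : ∀ {us x} → Free us x → ∀ j →
      available (x ∷ us) j ≡ available us j + - (𝟙 (j ℕ.≟ T.period x) * fromℕ (T.period x ℕ.* 2))
    available-∷ {us} {x} free j = begin
      available (x ∷ us) j
        ≡⟨ cancel (available (x ∷ us) j) onLoop ⟩
      (available (x ∷ us) j + onLoop) + - onLoop
        ≡⟨ cong₂ (λ a b → a + - b) (trans (sym (∑-+ (allFin m) _ _)) (∑-cong (allFin m) (sym ∘ split))) onLoop≡ ⟩
      available us j + - (𝟙 (j ℕ.≟ T.period x) * fromℕ (T.period x ℕ.* 2)) ∎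
      where
      open ≡-Reasoning
      cancel : ∀ a b → a ≡ (a + b) + - b
      cancel = solve 2 (λ a b → a := (a :+ b) :+ :- b) refl
      onLoop = ∑ (allFin m) (λ y → 𝟙 ((T.period y ℕ.≟ j) ×-dec (x T.~? y)))
      free-on-loop : ∀ {y} → x T.~ y → Free us y
      free-on-loop x~y = All.map (λ ¬u~x u~y → ¬u~x (T.~-trans u~y (T.~-sym x~y))) free
      split : ∀ y → 𝟙 ((T.period y ℕ.≟ j) ×-dec free? us y) ≡
              𝟙 ((T.period y ℕ.≟ j) ×-dec free? (x ∷ us) y) + 𝟙 ((T.period y ℕ.≟ j) ×-dec (x T.~? y))
      split y = by (x T.~? y)
        where
        by : Dec (x T.~ y) → _
        by (yes x~y) = sym (trans (zero-+ _ (𝟙-no ((T.period y ℕ.≟ j) ×-dec free? (x ∷ us) y)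
            (λ { (_ , ¬x~y ∷ _) → ¬x~y x~y })))
          (𝟙-cong ((T.period y ℕ.≟ j) ×-dec (x T.~? y)) ((T.period y ℕ.≟ j) ×-dec free? us y)
            (λ (eq , _) → eq , free-on-loop x~y) (λ (eq , _) → eq , x~y)))
        by (no ¬x~y) = sym (trans (+-comm _ _) (trans (zero-+ _ (𝟙-no ((T.period y ℕ.≟ j) ×-dec (x T.~? y))
            (λ (_ , x~y) → ¬x~y x~y)))
          (𝟙-cong ((T.period y ℕ.≟ j) ×-dec free? (x ∷ us) y) ((T.period y ℕ.≟ j) ×-dec free? us y)
            (λ { (eq , _ ∷ free-y) → eq , free-y }) (λ (eq , free-y) → eq , ¬x~y ∷ free-y))))
      onLoop≡ : onLoop ≡ 𝟙 (j ℕ.≟ T.period x) * fromℕ (T.period x ℕ.* 2)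
      onLoop≡ = begin
        onLoop
          ≡⟨ ∑-cong (allFin m) (λ y → trans
               (𝟙-cong ((T.period y ℕ.≟ j) ×-dec (x T.~? y)) ((j ℕ.≟ T.period x) ×-dec (x T.~? y))
                 (λ (eq , x~y) → trans (sym eq) (sym (T.period-resp-~ x~y)) , x~y)
                 (λ (eq , x~y) → trans (sym (T.period-resp-~ x~y)) (sym eq) , x~y))
               (𝟙-× (j ℕ.≟ T.period x) (x T.~? y))) ⟩
        ∑ (allFin m) (λ y → 𝟙 (j ℕ.≟ T.period x) * 𝟙 (x T.~? y))
          ≡⟨ sym (∑-*ˡ _ (allFin m) _) ⟩
        𝟙 (j ℕ.≟ T.period x) * ∑ (allFin m) (λ y → 𝟙 (x T.~? y))
          ≡⟨ cong (𝟙 (j ℕ.≟ T.period x) *_) (T.∑-loop x) ⟩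
        𝟙 (j ℕ.≟ T.period x) * fromℕ (T.period x ℕ.* 2) ∎

    ∑-matching : ∀ rs us → ∑ (tuples (allFin m) (length rs)) (λ c → 𝟙 (matching? rs us c)) ≡
                 matchings (map f rs) (available us)
    ∑-matching []       us = trans (+-identityʳ _) (𝟙-yes (matching? [] us []) ((λ ()) , (λ ()) , (λ ())))
    ∑-matching (r ∷ rs) us = begin
      ∑ (tuples (allFin m) (suc (length rs))) (λ c → 𝟙 (matching? (r ∷ rs) us c))
        ≡⟨ ∑-cartesianProductWith _∷_ (allFin m) _ _ ⟩
      ∑ (allFin m) (λ x → ∑ (tuples (allFin m) (length rs)) (λ c → 𝟙 (matching? (r ∷ rs) us (x ∷ c))))
        ≡⟨ ∑-cong (allFin m) (λ x → trans
             (∑-cong (tuples (allFin m) (length rs)) (λ c → trans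
               (𝟙-cong (matching? (r ∷ rs) us (x ∷ c)) (first? x ×-dec matching? rs (x ∷ us) c) matching-∷⁻ matching-∷⁺)
               (𝟙-× (first? x) (matching? rs (x ∷ us) c))))
             (sym (∑-*ˡ (𝟙 (first? x)) (tuples (allFin m) (length rs)) _))) ⟩
      ∑ (allFin m) (λ x → 𝟙 (first? x) * ∑ (tuples (allFin m) (length rs)) (λ c → 𝟙 (matching? rs (x ∷ us) c)))
        ≡⟨ ∑-cong (allFin m) (λ x → 𝟙-guard (first? x) (λ (per , free) → trans (∑-matching rs (x ∷ us))
             (matchings-cong (map f rs) (λ j → trans (available-∷ free j)
               (cong (λ k → available us j + - (𝟙 (j ℕ.≟ k) * fromℕ (k ℕ.* 2))) per))))) ⟩
      ∑ (allFin m) (λ x → 𝟙 (first? x) * rest)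
        ≡⟨ sym (∑-*ʳ rest (allFin m) _) ⟩
      available us (f r) * rest ∎
      where
      open ≡-Reasoning
      first? : ∀ x → Dec (T.period x ≡ f r × Free us x)
      first? x = (T.period x ℕ.≟ f r) ×-dec free? us x
      rest = matchings (map f rs) (λ j → available us j + - (𝟙 (j ℕ.≟ f r) * fromℕ (f r ℕ.* 2)))

  isomorphism⇒matching : ∀ c → Compatible c → Injective (extend c) → Matching S.period reps [] c
  isomorphism⇒matching c comp inj = periods , (λ _ → []) , distinct
    where
    at = List.lookup reps
    extend-0 : ∀ q → lookup (extend c) (at q) ≡ lookup c q
    extend-0 q = extend-walk c comp q 0
    periods : ∀ q → T.period (lookup c q) ≡ S.period (at q)
    periods q = ℕₚ.≤-antisym
      (ℕₚ.≮⇒≥ (λ lt → T.period-minimal (lookup c q) (S.period (at q)) (s≤s z≤n) lt (comp q)))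
      (ℕₚ.≮⇒≥ (λ lt → S.period-minimal (at q) (T.period (lookup c q)) (s≤s z≤n) lt
        (inj _ _ (trans (extend-walk c comp q (T.period (lookup c q) ℕ.* 2))
          (trans (T.period-closes (lookup c q)) (sym (extend-0 q)))))))
    distinct : ∀ q q′ → lookup c q T.~ lookup c q′ → q ≡ q′
    distinct q q′ (k , eq) = S.lookup-reps-injective (S.rep-unique (S.lookup-reps-IsRep q) (S.lookup-reps-IsRep q′)
      (k , inj _ _ (trans (extend-walk c comp q k) (trans eq (sym (extend-0 q′))))))

  matching⇒compatible : ∀ c → Matching S.period reps [] c → Compatible c
  matching⇒compatible c (periods , _) q =
    subst (W.Closes (lookup c q)) (periods q) (T.period-closes (lookup c q))

  matching⇒injective : ∀ c → Matching S.period reps [] c → Injective (extend c)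
  matching⇒injective c match@(periods , _ , distinct) i j eq =
    trans (sym i≡) (trans same (trans (cong (λ q → S.walk l (at q)) q≡) j≡))
    where
    at = List.lookup reps
    k = proj₁ (from-rep i)
    l = proj₁ (from-rep j)
    i≡ = proj₂ (from-rep i)
    j≡ = proj₂ (from-rep j)
    q = S.repIndex i
    comp = matching⇒compatible c match
    value : ∀ i → lookup (extend c) i ≡ W.walk (proj₁ (from-rep i)) (lookup c (S.repIndex i))
    value i = trans (cong (lookup (extend c)) (sym (proj₂ (from-rep i)))) (extend-walk c comp (S.repIndex i) (proj₁ (from-rep i)))
    walks : W.walk k (lookup c q) ≡ W.walk l (lookup c (S.repIndex j))
    walks = trans (sym (value i)) (trans eq (value j))
    q≡ : q ≡ S.repIndex j
    q≡ = distinct q (S.repIndex j) (T.~-trans (k , walks) (T.~-sym (l , refl)))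
    closes : S.Closes (at q) (T.period (lookup c q))
    closes = subst (S.Closes (at q)) (sym (periods q)) (S.period-closes (at q))
    same : S.walk k (at q) ≡ S.walk l (at q)
    same = trans (S.walk-% {ℓ = T.predPeriod (lookup c q)} closes k)
      (trans (cong (λ j → S.walk j (at q)) (T.walk-injective (lookup c q)
        (m%n<n k (T.period (lookup c q) ℕ.* 2)) (m%n<n l (T.period (lookup c q) ℕ.* 2))
        (trans (sym (T.walk-% {ℓ = T.predPeriod (lookup c q)} (T.period-closes (lookup c q)) k))
          (trans (trans walks (cong (λ q → W.walk l (lookup c q)) (sym q≡)))
            (T.walk-% {ℓ = T.predPeriod (lookup c q)} (T.period-closes (lookup c q)) l)))))
      (sym (S.walk-% {ℓ = T.predPeriod (lookup c q)} closes l)))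

  available-[] : ∀ k → available S.period [] k ≡ fromℕ (k ℕ.* 2) * fromℕ (multiplicity k (loops T₁ T₂))
  available-[] k = begin
    ∑ (allFin m) (λ x → 𝟙 ((T.period x ℕ.≟ k) ×-dec free? S.period [] x))
      ≡⟨ ∑-cong (allFin m) (λ x → 𝟙-cong ((T.period x ℕ.≟ k) ×-dec free? S.period [] x) (k ℕ.≟ T.period x)
           (sym ∘ proj₁) (λ eq → sym eq , [])) ⟩
    ∑ (allFin m) (λ x → 𝟙 (k ℕ.≟ T.period x))
      ≡⟨ T.∑-by-loop _ (λ r → fromℕ (k ℕ.* 2) * 𝟙 (k ℕ.≟ T.period r)) (λ r _ → loop r) ⟩
    ∑ T.reps (λ r → fromℕ (k ℕ.* 2) * 𝟙 (k ℕ.≟ T.period r))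
      ≡⟨ sym (∑-*ˡ (fromℕ (k ℕ.* 2)) T.reps _) ⟩
    fromℕ (k ℕ.* 2) * ∑ T.reps (λ r → 𝟙 (k ℕ.≟ T.period r))
      ≡⟨ cong (fromℕ (k ℕ.* 2) *_) (sym (trans (fromℕ-length-filter (k ℕ.≟_) (loops T₁ T₂))
           (trans (cong (λ ls → ∑ ls (λ l → 𝟙 (k ℕ.≟ l))) T.loops≡) (∑-map T.period T.reps _)))) ⟩
    fromℕ (k ℕ.* 2) * fromℕ (multiplicity k (loops T₁ T₂)) ∎
    where
    open ≡-Reasoning
    loop : ∀ r → ∑ (allFin m) (λ x → 𝟙 (r T.~? x) * 𝟙 (k ℕ.≟ T.period x)) ≡ fromℕ (k ℕ.* 2) * 𝟙 (k ℕ.≟ T.period r)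
    loop r = begin
      ∑ (allFin m) (λ x → 𝟙 (r T.~? x) * 𝟙 (k ℕ.≟ T.period x))
        ≡⟨ ∑-cong (allFin m) (λ x → 𝟙-guard (r T.~? x) (λ r~x → cong (λ p → 𝟙 (k ℕ.≟ p)) (sym (T.period-resp-~ r~x)))) ⟩
      ∑ (allFin m) (λ x → 𝟙 (r T.~? x) * 𝟙 (k ℕ.≟ T.period r))
        ≡⟨ sym (∑-*ʳ _ (allFin m) _) ⟩
      ∑ (allFin m) (λ x → 𝟙 (r T.~? x)) * 𝟙 (k ℕ.≟ T.period r)
        ≡⟨ cong (_* 𝟙 (k ℕ.≟ T.period r)) (T.∑-loop r) ⟩
      fromℕ (T.period r ℕ.* 2) * 𝟙 (k ℕ.≟ T.period r)
        ≡⟨ trans (*-comm _ _) (trans (𝟙-guard (k ℕ.≟ T.period r) (λ { refl → refl })) (*-comm _ _)) ⟩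
      fromℕ (k ℕ.* 2) * 𝟙 (k ℕ.≟ T.period r) ∎

  ∑-isomorphism : ∑ (tuples (allFin m) m) (λ w → 𝟙 (equivariant? w) * 𝟙 (injective? w)) ≡
                  matchings (loops S₁ S₂) (λ k → fromℕ (k ℕ.* 2) * fromℕ (multiplicity k (loops T₁ T₂)))
  ∑-isomorphism = begin
    ∑ (tuples (allFin m) m) (λ w → 𝟙 (equivariant? w) * 𝟙 (injective? w))
      ≡⟨ ∑-equivariant (λ w → 𝟙 (injective? w)) ⟩
    ∑ (tuples (allFin m) (length reps)) (λ c → 𝟙 (compatible? c) * 𝟙 (injective? (extend c)))
      ≡⟨ ∑-cong (tuples (allFin m) (length reps)) (λ c → trans (sym (𝟙-× (compatible? c) (injective? (extend c))))
           (𝟙-cong (compatible? c ×-dec injective? (extend c)) (matching? S.period reps [] c)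
             (λ (comp , inj) → isomorphism⇒matching c comp inj)
             (λ match → matching⇒compatible c match , matching⇒injective c match))) ⟩
    ∑ (tuples (allFin m) (length reps)) (λ c → 𝟙 (matching? S.period reps [] c))
      ≡⟨ ∑-matching S.period reps [] ⟩
    matchings (map S.period reps) (available S.period [])
      ≡⟨ matchings-cong (map S.period reps) available-[] ⟩
    matchings (map S.period reps) (λ k → fromℕ (k ℕ.* 2) * fromℕ (multiplicity k (loops T₁ T₂)))
      ≡⟨ cong (λ ls → matchings ls _) (sym S.loops≡) ⟩
    matchings (loops S₁ S₂) (λ k → fromℕ (k ℕ.* 2) * fromℕ (multiplicity k (loops T₁ T₂))) ∎
    where open ≡-Reasoning

-- The norm of p_ρ, z_ρ 2^ℓ(ρ), as a number of automorphisms

multiplicity-∷ : ∀ k l ls → fromℕ (multiplicity k (l ∷ ls)) ≡ 𝟙 (k ℕ.≟ l) + fromℕ (multiplicity k ls)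
multiplicity-∷ k l ls = trans (fromℕ-length-filter (k ℕ.≟_) (l ∷ ls))
  (cong (𝟙 (k ℕ.≟ l) +_) (sym (fromℕ-length-filter (k ℕ.≟_) ls)))

multiplicity-↭ : ∀ k {ks ls} → ks ↭ ls → multiplicity k ks ≡ multiplicity k ls
multiplicity-↭ k eq = Permₚ.↭-length (Permₚ.filter-↭ (k ℕ.≟_) eq)

automorphisms : List ℕ → ℕ
automorphisms []       = 1
automorphisms (k ∷ ks) = k ℕ.* 2 ℕ.* multiplicity k (k ∷ ks) ℕ.* automorphisms ks

_↭?_ : ∀ (ks ls : List ℕ) → Dec (ks ↭ ls)
ks ↭? ls = map′ sort≡⇒↭ ↭⇒sort≡ (sort≤ ks ≟ˡ sort≤ ls)

matchings-loops : ∀ ks ls → Positive ls → sum ks ≡ sum ls →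
                  matchings ks (λ k → fromℕ (k ℕ.* 2) * fromℕ (multiplicity k ls)) ≡
                  𝟙 (ks ↭? ls) * fromℕ (automorphisms ks)
matchings-loops [] []       _ _ = sym (trans (𝟙-*-yes ([] ↭? []) _ ↭-refl) fromℕ-1)
matchings-loops [] (zero ∷ ls) (() ∷ _) _
matchings-loops [] (suc _ ∷ ls) _ ()
matchings-loops (k ∷ ks) ls ls>0 ∑≡ with Any.any? (k ℕ.≟_) ls
... | no k∉ = trans (trans (cong (_* matchings ks rest) none) (zeroˡ (matchings ks rest)))
                    (sym (𝟙-*-no ((k ∷ ks) ↭? ls) _ (λ eq → k∉ (Permₚ.∈-resp-↭ eq (here refl)))))
  where
  rest : ℕ → ℚ
  rest j = fromℕ (j ℕ.* 2) * fromℕ (multiplicity j ls) + - (𝟙 (j ℕ.≟ k) * fromℕ (k ℕ.* 2))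
  none : fromℕ (k ℕ.* 2) * fromℕ (multiplicity k ls) ≡ 0ℚ
  none = trans (cong (fromℕ (k ℕ.* 2) *_) (trans (cong (fromℕ ∘ length)
    (Listₚ.filter-none (k ℕ.≟_) (Allₚ.¬Any⇒All¬ ls k∉))) fromℕ-0)) (zeroʳ _)
... | yes k∈ with Memₚ.∈-∃++ k∈
...   | as , bs , refl = begin
  M k * matchings ks (λ j → M j + - (𝟙 (j ℕ.≟ k) * fromℕ (k ℕ.* 2)))
    ≡⟨ cong (M k *_) (trans (matchings-cong ks remove) (matchings-loops ks ls′ ls′>0 ∑≡′)) ⟩
  M k * (𝟙 (ks ↭? ls′) * fromℕ (automorphisms ks))
    ≡⟨ regroup (M k) _ _ ⟩
  𝟙 (ks ↭? ls′) * (M k * fromℕ (automorphisms ks))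
    ≡⟨ 𝟙-guard (ks ↭? ls′) (λ eq → trans (cong (_* fromℕ (automorphisms ks)) (trans
         (cong (λ a → fromℕ (k ℕ.* 2) * fromℕ a) (multiplicity-↭ k (↭-trans perm (Perm.prep k (↭-sym eq)))))
         (sym (fromℕ-* (k ℕ.* 2) (multiplicity k (k ∷ ks)))))) (sym (fromℕ-* _ (automorphisms ks)))) ⟩
  𝟙 (ks ↭? ls′) * fromℕ (automorphisms (k ∷ ks))
    ≡⟨ cong (_* fromℕ (automorphisms (k ∷ ks))) (𝟙-cong (ks ↭? ls′) ((k ∷ ks) ↭? ls₀)
         (λ eq → ↭-trans (Perm.prep k eq) (↭-sym perm))
         (λ eq → Permₚ.drop-∷ (↭-trans eq perm))) ⟩
  𝟙 ((k ∷ ks) ↭? ls₀) * fromℕ (automorphisms (k ∷ ks)) ∎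
  where
  open ≡-Reasoning
  ls₀ = as ++ k ∷ bs
  ls′ = as ++ bs
  perm : ls₀ ↭ k ∷ ls′
  perm = Permₚ.shift k as bs
  M : ℕ → ℚ
  M j = fromℕ (j ℕ.* 2) * fromℕ (multiplicity j ls₀)
  ls′>0 : Positive ls′
  ls′>0 = All.tail (Permₚ.All-resp-↭ perm ls>0)
  ∑≡′ : sum ks ≡ sum ls′
  ∑≡′ = ℕₚ.+-cancelˡ-≡ k _ _ (trans ∑≡ (sum-↭ perm))
  regroup : ∀ a b c → a * (b * c) ≡ b * (a * c)
  regroup = solve 3 (λ a b c → a :* (b :* c) := b :* (a :* c)) refl
  distribute : ∀ a b c → a * (b + c) + - (b * a) ≡ a * c
  distribute = solve 3 (λ a b c → a :* (b :+ c) :+ :- (b :* a) := a :* c) refl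
  remove : ∀ j → M j + - (𝟙 (j ℕ.≟ k) * fromℕ (k ℕ.* 2)) ≡ fromℕ (j ℕ.* 2) * fromℕ (multiplicity j ls′)
  remove j = begin
    M j + - (𝟙 (j ℕ.≟ k) * fromℕ (k ℕ.* 2))
      ≡⟨ cong₂ (λ a b → fromℕ (j ℕ.* 2) * a + - b)
           (trans (cong fromℕ (multiplicity-↭ j perm)) (multiplicity-∷ j k ls′))
           (𝟙-guard (j ℕ.≟ k) (λ { refl → refl })) ⟩
    fromℕ (j ℕ.* 2) * (𝟙 (j ℕ.≟ k) + fromℕ (multiplicity j ls′)) + - (𝟙 (j ℕ.≟ k) * fromℕ (j ℕ.* 2))
      ≡⟨ distribute (fromℕ (j ℕ.* 2)) (𝟙 (j ℕ.≟ k)) _ ⟩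
    fromℕ (j ℕ.* 2) * fromℕ (multiplicity j ls′) ∎

module _ (ks : List ℕ) where

  zFactor : ℕ → ℕ
  zFactor i = i ^ multiplicity i ks ℕ.* multiplicity i ks !

multiplicity-≡ : ∀ k ks → multiplicity k (k ∷ ks) ≡ suc (multiplicity k ks)
multiplicity-≡ k ks = cong length (Listₚ.filter-accept (k ℕ.≟_) refl)

multiplicity-≢ : ∀ {i k} ks → i ≢ k → multiplicity i (k ∷ ks) ≡ multiplicity i ks
multiplicity-≢ {i} ks i≢k = cong length (Listₚ.filter-reject (i ℕ.≟_) i≢k)

product-change : ∀ {A : Set} {f g : A → ℕ} c {x xs} → Unique xs → x ∈ xs →
                 f x ≡ c ℕ.* g x → (∀ y → y ≢ x → f y ≡ g y) → product (map f xs) ≡ c ℕ.* product (map g xs)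
product-change {f = f} {g} c {xs = y ∷ xs} (y∉ ∷ u) (here refl) fx fy =
  trans (cong₂ ℕ._*_ fx (cong product (Listₚ.map-cong-local
          (All.map (λ y≢z → fy _ (y≢z ∘ sym)) y∉))))
        (ℕₚ.*-assoc c (g y) _)
product-change {f = f} {g} c {xs = y ∷ xs} (y∉ ∷ u) (there x∈) fx fy = begin
  f y ℕ.* product (map f xs)         ≡⟨ cong₂ ℕ._*_ (fy y (All.lookup y∉ x∈)) (product-change c u x∈ fx fy) ⟩
  g y ℕ.* (c ℕ.* product (map g xs)) ≡⟨ exchange (g y) c _ ⟩
  c ℕ.* (g y ℕ.* product (map g xs)) ∎
  where
  open ≡-Reasoning
  exchange : ∀ a b d → a ℕ.* (b ℕ.* d) ≡ b ℕ.* (a ℕ.* d)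
  exchange = ℕ-solver.solve-∀

automorphisms≡ : ∀ n ks → All (λ k → 0 < k × k ≤ n) ks →
                 product (map (zFactor ks ∘ suc) (upTo n)) ℕ.* 2 ^ length ks ≡ automorphisms ks
automorphisms≡ n []       _ = cong (ℕ._* 1) (ones (upTo n))
  where
  ones : ∀ xs → product (map (zFactor [] ∘ suc) xs) ≡ 1
  ones []       = refl
  ones (x ∷ xs) = trans (ℕₚ.+-identityʳ _) (ones xs)
automorphisms≡ n (suc k ∷ ks) ((_ , k<n) ∷ bounds) = begin
  product (map (zFactor (suc k ∷ ks) ∘ suc) (upTo n)) ℕ.* (2 ℕ.* 2 ^ length ks)
    ≡⟨ cong (ℕ._* (2 ℕ.* 2 ^ length ks)) (product-change (suc k ℕ.* suc mult) (Uniqueₚ.upTo⁺ n) (Memₚ.∈-upTo⁺ k<n) at-k others) ⟩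
  suc k ℕ.* suc mult ℕ.* product (map (zFactor ks ∘ suc) (upTo n)) ℕ.* (2 ℕ.* 2 ^ length ks)
    ≡⟨ regroup (suc k) (suc mult) (product (map (zFactor ks ∘ suc) (upTo n))) (2 ^ length ks) ⟩
  suc k ℕ.* 2 ℕ.* suc mult ℕ.* (product (map (zFactor ks ∘ suc) (upTo n)) ℕ.* 2 ^ length ks)
    ≡⟨ cong₂ (λ a b → suc k ℕ.* 2 ℕ.* a ℕ.* b) (sym (multiplicity-≡ (suc k) ks)) (automorphisms≡ n ks bounds) ⟩
  automorphisms (suc k ∷ ks) ∎
  where
  open ≡-Reasoning
  mult = multiplicity (suc k) ks
  regroup : ∀ a b d e → a ℕ.* b ℕ.* d ℕ.* (2 ℕ.* e) ≡ a ℕ.* 2 ℕ.* b ℕ.* (d ℕ.* e)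
  regroup = ℕ-solver.solve-∀
  interchange : ∀ a b d e → (a ℕ.* b) ℕ.* (d ℕ.* e) ≡ a ℕ.* d ℕ.* (b ℕ.* e)
  interchange = ℕ-solver.solve-∀
  at-k : zFactor (suc k ∷ ks) (suc k) ≡ suc k ℕ.* suc mult ℕ.* zFactor ks (suc k)
  at-k = trans (cong (λ a → suc k ^ a ℕ.* a !) (multiplicity-≡ (suc k) ks))
               (interchange (suc k) (suc k ^ mult) (suc mult) (mult !))
  others : ∀ y → y ≢ k → zFactor (suc k ∷ ks) (suc y) ≡ zFactor ks (suc y)
  others y y≢k = cong (λ a → suc y ^ a ℕ.* a !) (multiplicity-≢ ks (y≢k ∘ ℕₚ.suc-injective))

parts-bounded : ∀ {ks} → Positive ks → All (λ k → 0 < k × k ≤ sum ks) ks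
parts-bounded []           = []
parts-bounded {k ∷ ks} (0<k ∷ ks>0) = (0<k , ℕₚ.m≤m+n k (sum ks)) ∷
  All.map (λ (0<l , l≤) → 0<l , ℕₚ.≤-trans l≤ (ℕₚ.m≤n+m (sum ks) k)) (parts-bounded ks>0)

module _ {n : ℕ} (ks : List ℕ) (ks>0 : Positive ks) (∑ks : sum ks ≡ n) where

  jackWeight-partition : jackWeight (partition ks ks>0 ∑ks) ≡ fromℕ (automorphisms ks)
  jackWeight-partition = cong fromℕ (trans
    (cong₂ ℕ._*_ (cong product (Listₚ.map-cong (λ i → cong (λ a → suc i ^ a ℕ.* a !)
                   (multiplicity-↭ (suc i) (sortedDecreasing-↭ ks))) (upTo n)))
                 (cong (2 ^_) (Permₚ.↭-length (sortedDecreasing-↭ ks))))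
    (automorphisms≡ n ks (subst (λ n → All (λ k → 0 < k × k ≤ n) ks) ∑ks (parts-bounded ks>0))))

  ⟨p,p⟩ : ∀ ls → Positive ls → sum ls ≡ n →
          ⟨ p {n} ks , p ls ⟩ ≡ 𝟙 (ks ↭? ls) * fromℕ (automorphisms ks)
  ⟨p,p⟩ ls ls>0 ∑ls = begin
    ⟨ p {n} ks , p ls ⟩
      ≡⟨ ⟨⟩≡ (p {n} ks) (p ls) ⟩
    ∑ (partitions n) (λ ρ → p ks ρ * p ls ρ * jackWeight ρ)
      ≡⟨ ∑-cong (partitions n) (λ ρ → *-assoc (p ks ρ) (p ls ρ) (jackWeight ρ)) ⟩
    ∑ (partitions n) (λ ρ → p ks ρ * (p ls ρ * jackWeight ρ))
      ≡⟨ ∑-p ks ks>0 ∑ks (λ ρ → p ls ρ * jackWeight ρ) ⟩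
    p ls ρ₀ * jackWeight ρ₀
      ≡⟨ cong₂ _*_ (trans (p-𝟙 ls ls>0 ∑ls ρ₀) (𝟙-cong (ρ₀ ≟ᵖ partition ls ls>0 ∑ls) (ks ↭? ls)
           (λ eq → ↭-trans (↭-sym (sortedDecreasing-↭ ks)) (subst (_↭ ls) (sym (cong parts eq)) (sortedDecreasing-↭ ls)))
           (λ eq → parts-injective (↭⇒≡-decreasing (sortedDecreasing-≥ ks) (sortedDecreasing-≥ ls)
             (↭-trans (sortedDecreasing-↭ ks) (↭-trans eq (↭-sym (sortedDecreasing-↭ ls))))))))
           jackWeight-partition ⟩
    𝟙 (ks ↭? ls) * fromℕ (automorphisms ks) ∎
    where
    open ≡-Reasoning
    ρ₀ = partition ks ks>0 ∑ks

module _ {n : ℕ} (S₁ S₂ T₁ T₂ : PairPartition n) where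

  private
    module S = Graph S₁ S₂
    module T = Graph T₁ T₂
  open Isomorphism S₁ S₂ T₁ T₂
  open Equivariant S₁ S₂ (finE (n ℕ.* 2)) T.τ T.τ-inv

  ⟨loops,loops⟩ : ⟨ p {n} (loops S₁ S₂) , p (loops T₁ T₂) ⟩ ≡
                  ∑ (tuples (allFin (n ℕ.* 2)) (n ℕ.* 2)) (λ w → 𝟙 (equivariant? w) * 𝟙 (injective? w))
  ⟨loops,loops⟩ = trans
    (⟨p,p⟩ (loops S₁ S₂) S.loops-positive S.sum-loops (loops T₁ T₂) T.loops-positive T.sum-loops)
    (sym (trans ∑-isomorphism (matchings-loops (loops S₁ S₂) (loops T₁ T₂) T.loops-positive
      (trans S.sum-loops (sym T.sum-loops)))))

-- Transposing two points changes the number of loops by one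

module _ {m : ℕ} (a b : Fin m) where

  transpose : Fin m → Fin m
  transpose x = if does (x Fin.≟ a) then b else if does (x Fin.≟ b) then a else x

  transpose-a : transpose a ≡ b
  transpose-a rewrite dec-true (a Fin.≟ a) refl = refl

  transpose-b : transpose b ≡ a
  transpose-b with b Fin.≟ a
  ... | yes b≡a = b≡a
  ... | no _ rewrite dec-true (b Fin.≟ b) refl = refl

  transpose-≢ : ∀ {x} → x ≢ a → x ≢ b → transpose x ≡ x
  transpose-≢ {x} x≢a x≢b rewrite dec-false (x Fin.≟ a) x≢a | dec-false (x Fin.≟ b) x≢b = refl

  transpose-elim : ∀ (P : Fin m → Fin m → Set) → P a b → P b a → (∀ x → P x x) → ∀ x → P x (transpose x)
  transpose-elim P ab ba xx x = case x Fin.≟ a of λ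
    { (yes refl) → subst (P x) (sym transpose-a) ab
    ; (no x≢a)   → case x Fin.≟ b of λ
        { (yes refl) → subst (P x) (sym transpose-b) ba
        ; (no x≢b)   → subst (P x) (sym (transpose-≢ x≢a x≢b)) (xx x) } }

  transpose-involutive : ∀ x → transpose (transpose x) ≡ x
  transpose-involutive x = case x Fin.≟ a of λ
    { (yes refl) → trans (cong transpose transpose-a) transpose-b
    ; (no x≢a)   → case x Fin.≟ b of λ
        { (yes refl) → trans (cong transpose transpose-b) transpose-a
        ; (no x≢b)   → trans (cong transpose (transpose-≢ x≢a x≢b)) (transpose-≢ x≢a x≢b) } }

  transpose-invariant : ∀ {A : Set} (f : Fin m → A) → f a ≡ f b → ∀ x → f (transpose x) ≡ f x
  transpose-invariant f fa≡fb = transpose-elim (λ x y → f y ≡ f x) (sym fa≡fb) fa≡fb (λ _ → refl)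

module _ {n : ℕ} (a b : Fin (n ℕ.* 2)) where

  private
    t = transpose a b
    t-inv = transpose-involutive a b

  conjugate : PairPartition n → PairPartition n
  conjugate S = pairPartition (t ∘ ⟦ S ⟧ ∘ t)
    (λ i → trans (cong (t ∘ ⟦ S ⟧) (t-inv _)) (trans (cong t (⟦⟧-involutive S (t i))) (t-inv i)))
    (λ i eq → ⟦⟧-fixedPointFree S (t i) (trans (sym (t-inv _)) (cong t eq)))

  ⟦conjugate⟧ : ∀ S i → ⟦ conjugate S ⟧ i ≡ t (⟦ S ⟧ (t i))
  ⟦conjugate⟧ S = Vecₚ.lookup∘tabulate _

  conjugate-involutive : ∀ S → conjugate (conjugate S) ≡ S
  conjugate-involutive S = ⟦⟧-injective (λ i → begin
    ⟦ conjugate (conjugate S) ⟧ i ≡⟨ ⟦conjugate⟧ (conjugate S) i ⟩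
    t (⟦ conjugate S ⟧ (t i))     ≡⟨ cong t (⟦conjugate⟧ S (t i)) ⟩
    t (t (⟦ S ⟧ (t (t i))))       ≡⟨ t-inv _ ⟩
    ⟦ S ⟧ (t (t i))               ≡⟨ cong ⟦ S ⟧ (t-inv i) ⟩
    ⟦ S ⟧ i                       ∎)
    where open ≡-Reasoning

  module Conjugation (S S₁ : PairPartition n) (a≢b : a ≢ b) where

    private
      module G = Graph S S₁
      module G′ = Graph S (conjugate S₁)

    private
      t-fix : ∀ {x} → x ≢ a → x ≢ b → t x ≡ x
      t-fix = transpose-≢ a b

    -- If a and b lie on different loops, the loop of a loses only the edge
    -- joining it to its partner c, which becomes joined to b.
    separate⇒joined : ¬ a G.~ b → a G′.~ b
    separate⇒joined a≁b = G′.~-trans a~c (G′.~-sym b~c)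
      where
      c = ⟦ S₁ ⟧ a
      last = G.period a ℕ.* 2 ∸ 1
      off-b : ∀ {x} → a G.~ x → x ≢ b
      off-b a~x refl = a≁b a~x
      off-a : ∀ k → 0 < k → k < G.period a ℕ.* 2 → G.walk k a ≢ a
      off-a k 0<k k<P eq = G.walk-<-≢ a 0<k k<P (sym eq)
      along : ∀ k → k < G.period a ℕ.* 2 → a G′.~ G.walk k a
      along zero    _   = G′.~-refl
      along (suc k) k<P = step (odd k) refl
        where
        prev : a G′.~ G.walk k a
        prev = along k (ℕₚ.<-trans (ℕₚ.n<1+n k) k<P)
        step : ∀ β → odd k ≡ β → a G′.~ G.walk (suc k) a
        step false eq = subst (a G′.~_) (cong (λ β → G.τ β (G.walk k a)) (sym eq)) (G′.~-τ false prev)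
        step true  eq = subst (a G′.~_) moved (G′.~-τ true prev)
          where
          0<k : 0 < k
          0<k = ℕₚ.n≢0⇒n>0 (λ { refl → case eq of λ () })
          fixed : ∀ l → 0 < l → l < G.period a ℕ.* 2 → t (G.walk l a) ≡ G.walk l a
          fixed l 0<l l<P = t-fix (off-a l 0<l l<P) (off-b (l , refl))
          moved : ⟦ conjugate S₁ ⟧ (G.walk k a) ≡ G.walk (suc k) a
          moved = trans (⟦conjugate⟧ S₁ (G.walk k a))
            (trans (cong (t ∘ ⟦ S₁ ⟧) (fixed k 0<k (ℕₚ.<-trans (ℕₚ.n<1+n k) k<P)))
            (trans (cong t (cong (λ β → G.τ β (G.walk k a)) (sym eq))) (fixed (suc k) (s≤s z≤n) k<P)))
      last-c : G.walk (suc (G.predPeriod a ℕ.* 2)) a ≡ c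
      last-c = G.τ-injective true (trans
        (cong (λ β → G.τ (not β) (G.walk (suc (G.predPeriod a ℕ.* 2)) a)) (sym (odd-*2 (G.predPeriod a))))
        (trans (G.period-closes a) (sym (⟦⟧-involutive S₁ a))))
      a~c : a G′.~ c
      a~c = subst (a G′.~_) last-c (along (suc (G.predPeriod a ℕ.* 2)) (ℕₚ.n<1+n _))
      b~c : b G′.~ c
      b~c = subst (b G′.~_) (trans (⟦conjugate⟧ S₁ b) (trans (cong (t ∘ ⟦ S₁ ⟧) (transpose-b a b))
        (t-fix (⟦⟧-fixedPointFree S₁ a) (off-b (G.~-τ true G.~-refl))))) (G′.~-τ true G′.~-refl)

    Joined : Fin (n ℕ.* 2) → Fin (n ℕ.* 2) → Set
    Joined x y = (x G.~ y) ⊎ ((x G.~ a ⊎ x G.~ b) × (y G.~ a ⊎ y G.~ b))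

    G′⇒Joined : ∀ {x y} → x G′.~ y → Joined x y
    G′⇒Joined (zero  , refl) = inj₁ G.~-refl
    G′⇒Joined {x} (suc k , refl) = step (odd k) (G′⇒Joined (k , refl))
      where
      joined-τ : ∀ β {y} → Joined x y → Joined x (G.τ β y)
      joined-τ β (inj₁ x~y) = inj₁ (G.~-τ β x~y)
      joined-τ β {y} (inj₂ (x~ , y~)) = inj₂ (x~ , [ inj₁ ∘ G.~-trans τy~y , inj₂ ∘ G.~-trans τy~y ]′ y~)
        where
        τy~y : G.τ β y G.~ y
        τy~y = G.~-sym (G.~-τ β G.~-refl)
      joined-t : ∀ {y} → Joined x y → Joined x (t y)
      joined-t {y} = transpose-elim a b (λ y ty → Joined x y → Joined x ty)
        (λ { (inj₁ x~a) → inj₂ (inj₁ x~a , inj₂ G.~-refl) ; (inj₂ (x~ , _)) → inj₂ (x~ , inj₂ G.~-refl) })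
        (λ { (inj₁ x~b) → inj₂ (inj₂ x~b , inj₁ G.~-refl) ; (inj₂ (x~ , _)) → inj₂ (x~ , inj₁ G.~-refl) })
        (λ _ → id) y
      step : ∀ β {y} → Joined x y → Joined x (G′.τ β y)
      step false j = joined-τ false j
      step true {y} j = subst (Joined x) (sym (⟦conjugate⟧ S₁ y)) (joined-t (joined-τ true (joined-t j)))

    module _ (a~b : a G′.~ b) where

      ~-t : ∀ x → x G′.~ t x
      ~-t = transpose-elim a b G′._~_ a~b (G′.~-sym a~b) (λ _ → G′.~-refl)

      G⇒G′ : ∀ {x y} → x G.~ y → x G′.~ y
      G⇒G′ (zero  , refl) = G′.~-refl
      G⇒G′ {x} (suc k , refl) = step (odd k) (G⇒G′ (k , refl))
        where
        step : ∀ β {y} → x G′.~ y → x G′.~ G.τ β y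
        step false x~y = G′.~-τ false x~y
        step true {y} x~y = G′.~-trans x~y (G′.~-trans (~-t y)
          (G′.~-trans (subst (t y G′.~_) eq (G′.~-τ true G′.~-refl)) (G′.~-sym (~-t (⟦ S₁ ⟧ y)))))
          where
          eq : ⟦ conjugate S₁ ⟧ (t y) ≡ t (⟦ S₁ ⟧ y)
          eq = trans (⟦conjugate⟧ S₁ (t y)) (cong (t ∘ ⟦ S₁ ⟧) (t-inv y))

    length-reps-joined : ∀ x y → (x ≡ a × y ≡ b) ⊎ (x ≡ b × y ≡ a) → ¬ a G.~ b → G.rep x Fin.< G.rep y →
                         length G.reps ≡ suc (length G′.reps)
    length-reps-joined x y xy a≁b rx<ry = fromℕ-injective (begin
      fromℕ (length G.reps)
        ≡⟨ count-G ⟩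
      ∑ (allFin (n ℕ.* 2)) (λ i → 𝟙 (G.isRep? i))
        ≡⟨ ∑-cong (allFin (n ℕ.* 2)) split ⟩
      ∑ (allFin (n ℕ.* 2)) (λ i → 𝟙 (i Fin.≟ G.rep y) + 𝟙 (G′.isRep? i))
        ≡⟨ ∑-+ (allFin (n ℕ.* 2)) _ _ ⟩
      ∑ (allFin (n ℕ.* 2)) (λ i → 𝟙 (i Fin.≟ G.rep y)) + ∑ (allFin (n ℕ.* 2)) (λ i → 𝟙 (G′.isRep? i))
        ≡⟨ cong₂ _+_ (trans (allFin-once (n ℕ.* 2) (G.rep y)) (sym fromℕ-1)) (sym count-G′) ⟩
      fromℕ 1 + fromℕ (length G′.reps)
        ≡⟨ sym (fromℕ-+ 1 (length G′.reps)) ⟩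
      fromℕ (suc (length G′.reps)) ∎)
      where
      open ≡-Reasoning
      count : ∀ {A : Set} (xs : List A) → fromℕ (length xs) ≡ ∑ xs (λ _ → 1ℚ)
      count xs = trans (sym (∑-one (length xs))) (sym (∑-lookup xs (λ _ → 1ℚ)))
      count-G : fromℕ (length G.reps) ≡ ∑ (allFin (n ℕ.* 2)) (λ i → 𝟙 (G.isRep? i))
      count-G = trans (count G.reps) (trans (G.∑-over-reps (λ _ → 1ℚ)) (∑-cong (allFin (n ℕ.* 2)) (λ i → *-identityʳ _)))
      count-G′ : fromℕ (length G′.reps) ≡ ∑ (allFin (n ℕ.* 2)) (λ i → 𝟙 (G′.isRep? i))
      count-G′ = trans (count G′.reps) (trans (G′.∑-over-reps (λ _ → 1ℚ)) (∑-cong (allFin (n ℕ.* 2)) (λ i → *-identityʳ _)))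
      a~′b : a G′.~ b
      a~′b = separate⇒joined a≁b
      to-x-or-y : ∀ {i} → i G.~ a ⊎ i G.~ b → i G.~ x ⊎ i G.~ y
      to-x-or-y = by xy
        where
        by : (x ≡ a × y ≡ b) ⊎ (x ≡ b × y ≡ a) → ∀ {i} → i G.~ a ⊎ i G.~ b → i G.~ x ⊎ i G.~ y
        by (inj₁ (refl , refl)) i~ = i~
        by (inj₂ (refl , refl)) (inj₁ i~a) = inj₂ i~a
        by (inj₂ (refl , refl)) (inj₂ i~b) = inj₁ i~b
      x~′y : x G′.~ y
      x~′y = by xy
        where
        by : (x ≡ a × y ≡ b) ⊎ (x ≡ b × y ≡ a) → x G′.~ y
        by (inj₁ (refl , refl)) = a~′b
        by (inj₂ (refl , refl)) = G′.~-sym a~′b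
      ry~′rx : G.rep y G′.~ G.rep x
      ry~′rx = G′.~-trans (G⇒G′ a~′b (G.~-sym (G.~-rep y))) (G′.~-trans (G′.~-sym x~′y) (G⇒G′ a~′b (G.~-rep x)))
      split : ∀ i → 𝟙 (G.isRep? i) ≡ 𝟙 (i Fin.≟ G.rep y) + 𝟙 (G′.isRep? i)
      split i = case i Fin.≟ G.rep y of λ
        { (yes refl) → trans (𝟙-yes (G.isRep? i) (G.rep-isRep y)) (sym (trans (cong₂ _+_
            (𝟙-yes (i Fin.≟ G.rep y) refl)
            (𝟙-no (G′.isRep? i) (λ i-rep → ℕₚ.<⇒≱ rx<ry (i-rep (G.rep x) ry~′rx))))
            (+-identityʳ 1ℚ)))
        ; (no i≢ry) → sym (trans (zero-+ _ (𝟙-no (i Fin.≟ G.rep y) i≢ry))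
            (𝟙-cong (G′.isRep? i) (G.isRep? i)
              (λ i-rep j i~j → i-rep j (G⇒G′ a~′b i~j))
              (λ i-rep j i~j → rep⇒rep′ i≢ry i-rep (G′⇒Joined i~j)))) }
        where
        rep⇒rep′ : ∀ {j} → i ≢ G.rep y → G.IsRep i → Joined i j → i Fin.≤ j
        rep⇒rep′ i≢ry i-rep (inj₁ i~j) = i-rep _ i~j
        rep⇒rep′ {j} i≢ry i-rep (inj₂ (i~ , j~)) with to-x-or-y i~
        ... | inj₂ i~y = contradiction (G.rep-unique i-rep (G.rep-isRep y) (G.~-trans i~y (G.~-rep y))) i≢ry
        ... | inj₁ i~x = subst (Fin._≤ j) (sym (G.rep-unique i-rep (G.rep-isRep x) (G.~-trans i~x (G.~-rep x))))
          ([ (λ j~x → G.rep-isRep x j (G.~-trans (G.~-sym (G.~-rep x)) (G.~-sym j~x)))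
           , (λ j~y → ℕₚ.≤-trans (ℕₚ.<⇒≤ rx<ry)
               (G.rep-isRep y j (G.~-trans (G.~-sym (G.~-rep y)) (G.~-sym j~y)))) ]′ (to-x-or-y j~))

    separate⇒length : ¬ a G.~ b → length (loops S S₁) ≡ suc (length (loops S (conjugate S₁)))
    separate⇒length a≁b = trans G.length-loops (trans by-order (cong suc (sym G′.length-loops)))
      where
      by-order : length G.reps ≡ suc (length G′.reps)
      by-order with Finₚ.<-cmp (G.rep a) (G.rep b)
      ... | tri< lt _ _ = length-reps-joined a b (inj₁ (refl , refl)) a≁b lt
      ... | tri> _ _ gt = length-reps-joined b a (inj₂ (refl , refl)) a≁b gt
      ... | tri≈ _ eq _ = contradiction
        (G.~-trans (G.~-rep a) (subst (G._~ b) (sym eq) (G.~-sym (G.~-rep b)))) a≁b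

    module _ (χ : Fin (n ℕ.* 2) → Bool) (χ-S : ∀ i → χ (⟦ S ⟧ i) ≡ not (χ i))
             (χ-S₁ : ∀ i → χ (⟦ S₁ ⟧ i) ≡ not (χ i)) (χa≡χb : χ a ≡ χ b) where

      χ-walk : ∀ k x → χ (G.walk k x) ≡ odd k xor χ x
      χ-walk zero    x = refl
      χ-walk (suc k) x = trans (χ-τ (odd k) (G.walk k x)) (trans (cong not (χ-walk k x)) (not-xor (odd k) (χ x)))
        where
        χ-τ : ∀ β i → χ (G.τ β i) ≡ not (χ i)
        χ-τ false = χ-S
        χ-τ true  = χ-S₁
        not-xor : ∀ c d → not (c xor d) ≡ not c xor d
        not-xor false d = refl
        not-xor true  d = not-involutive d

      -- If b is the k-th point of the walk from a, then k is even, and in the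
      -- new graph the points before it form a loop of their own.
      joined⇒separate : a G.~ b → ¬ a G′.~ b
      joined⇒separate a~b a~′b = b∉ (closed-~ (0 , 0<k , refl) a~′b)
        where
        normal = G.~-normal a~b
        k = toℕ (proj₁ normal)
        walk-k : G.walk k a ≡ b
        walk-k = proj₂ normal
        k<P : k < G.period a ℕ.* 2
        k<P = Finₚ.toℕ<n (proj₁ normal)
        0<k : 0 < k
        0<k = ℕₚ.n≢0⇒n>0 (λ eq → a≢b (trans (cong (λ l → G.walk l a) (sym eq)) walk-k))
        even-k : odd k ≡ false
        even-k = xor-same (odd k) (χ a) (trans (sym (χ-walk k a)) (trans (cong χ walk-k) (sym χa≡χb)))
          where
          xor-same : ∀ c d → c xor d ≡ d → c ≡ false
          xor-same false d     _  = refl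
          xor-same true  false ()
          xor-same true  true  ()
        InLoop : Fin (n ℕ.* 2) → Set
        InLoop y = ∃ λ i → i < k × G.walk i a ≡ y
        b∉ : ¬ InLoop b
        b∉ (i , i<k , eq) = G.walk-<-≢ a i<k k<P (trans eq (sym walk-k))
        fixed : ∀ i → 0 < i → i < k → t (G.walk i a) ≡ G.walk i a
        fixed i 0<i i<k = t-fix (λ eq → G.walk-<-≢ a 0<i (ℕₚ.<-trans i<k k<P) (sym eq)) (λ eq → b∉ (i , i<k , eq))
        odd⇒pos : ∀ {j} → odd j ≡ true → 0 < j
        odd⇒pos {suc j} _ = s≤s z≤n
        step-S₁ : ∀ j → odd j ≡ true → ⟦ S₁ ⟧ (G.walk j a) ≡ G.walk (suc j) a
        step-S₁ j eq = cong (λ β → G.τ β (G.walk j a)) (sym eq)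
        back-S₁ : ∀ j → odd j ≡ true → ⟦ S₁ ⟧ (G.walk (suc j) a) ≡ G.walk j a
        back-S₁ j eq = trans (cong ⟦ S₁ ⟧ (sym (step-S₁ j eq))) (⟦⟧-involutive S₁ _)
        closed-S : ∀ {y} → InLoop y → InLoop (⟦ S ⟧ y)
        closed-S (i , i<k , refl) = by (odd i) refl
          where
          by : ∀ β → odd i ≡ β → InLoop (⟦ S ⟧ (G.walk i a))
          by false eq = suc i , ℕₚ.≤∧≢⇒< i<k (λ eq′ → case trans (sym even-k) (trans (cong odd (sym eq′)) (cong not eq)) of λ ()) ,
            cong (λ β → G.τ β (G.walk i a)) eq
          by true  eq = pred-case i eq i<k
            where
            pred-case : ∀ i → odd i ≡ true → i < k → InLoop (⟦ S ⟧ (G.walk i a))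
            pred-case (suc j) eq j<k = j , ℕₚ.<-trans (ℕₚ.n<1+n j) j<k ,
              trans (sym (G.walk-back j a)) (cong (λ β → G.τ β (G.walk (suc j) a)) (trans (sym (not-involutive (odd j))) (cong not eq)))
        closed-S₁ : ∀ {y} → InLoop y → InLoop (⟦ conjugate S₁ ⟧ y)
        closed-S₁ (zero , _ , refl) = to-last k even-k 0<k walk-k fixed
          where
          to-last : ∀ k → odd k ≡ false → 0 < k → G.walk k a ≡ b →
                    (∀ i → 0 < i → i < k → t (G.walk i a) ≡ G.walk i a) →
                    ∃ λ i → i < k × G.walk i a ≡ ⟦ conjugate S₁ ⟧ a
          to-last (suc k′) even _ eq fixed = k′ , ℕₚ.n<1+n k′ , sym (begin
            ⟦ conjugate S₁ ⟧ a        ≡⟨ ⟦conjugate⟧ S₁ a ⟩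
            t (⟦ S₁ ⟧ (t a))          ≡⟨ cong (t ∘ ⟦ S₁ ⟧) (trans (transpose-a a b) (sym eq)) ⟩
            t (⟦ S₁ ⟧ (G.walk (suc k′) a)) ≡⟨ cong t (back-S₁ k′ odd-k′) ⟩
            t (G.walk k′ a)           ≡⟨ fixed k′ (odd⇒pos odd-k′) (ℕₚ.n<1+n k′) ⟩
            G.walk k′ a               ∎)
            where
            open ≡-Reasoning
            odd-k′ : odd k′ ≡ true
            odd-k′ = trans (sym (not-involutive (odd k′))) (cong not even)
        closed-S₁ (suc j , j<k , refl) = by (odd j) refl
          where
          conj≡ : ⟦ conjugate S₁ ⟧ (G.walk (suc j) a) ≡ t (⟦ S₁ ⟧ (G.walk (suc j) a))
          conj≡ = trans (⟦conjugate⟧ S₁ _) (cong (t ∘ ⟦ S₁ ⟧) (fixed (suc j) (s≤s z≤n) j<k))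
          by : ∀ β → odd j ≡ β → InLoop (⟦ conjugate S₁ ⟧ (G.walk (suc j) a))
          by true eq = j , j<k′ , sym (trans conj≡ (trans (cong t (back-S₁ j eq)) (fixed j (odd⇒pos eq) j<k′)))
            where
            j<k′ = ℕₚ.<-trans (ℕₚ.n<1+n j) j<k
          by false eq with suc (suc j) ℕ.≟ k
          ... | yes eq′ = 0 , 0<k , sym (trans conj≡ (trans (cong t (trans (step-S₁ (suc j) (cong not eq))
                            (trans (cong (λ l → G.walk l a) eq′) walk-k))) (transpose-b a b)))
          ... | no neq  = suc (suc j) , ℕₚ.≤∧≢⇒< j<k neq ,
                            sym (trans conj≡ (trans (cong t (step-S₁ (suc j) (cong not eq)))
                              (fixed (suc (suc j)) (s≤s z≤n) (ℕₚ.≤∧≢⇒< j<k neq))))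
        closed-~ : ∀ {x y} → InLoop x → x G′.~ y → InLoop y
        closed-~ x∈ (zero  , refl) = x∈
        closed-~ x∈ (suc l , refl) = by (odd l) (closed-~ x∈ (l , refl))
          where
          by : ∀ β {y} → InLoop y → InLoop (G′.τ β y)
          by false = closed-S
          by true  = closed-S₁

  sign-conjugate : ∀ S S₁ → a ≢ b → (χ : Fin (n ℕ.* 2) → Bool) → (∀ i → χ (⟦ S ⟧ i) ≡ not (χ i)) →
                   (∀ i → χ (⟦ S₁ ⟧ i) ≡ not (χ i)) → χ a ≡ χ b → sign S (conjugate S₁) ≡ - sign S S₁
  sign-conjugate S S₁ a≢b χ χ-S χ-S₁ χa≡χb with Graph._~?_ S S₁ a b
  ... | no a≁b = trans (cong -1^_ (∸-suc (Conjugation.separate⇒length S S₁ a≢b a≁b) (Graph.length-loops≤n S S₁)))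
                       (-≡ _)
    where
    ∸-suc : ∀ {k l} → k ≡ suc l → k ≤ n → n ∸ l ≡ suc (n ∸ k)
    ∸-suc {l = l} refl l<n = ℕₚ.+-∸-assoc 1 l<n
  ... | yes a~b = trans (sym (neg-neg _)) (cong -_ (sym (trans (cong -1^_ (∸-suc joined
                        (Graph.length-loops≤n S (conjugate S₁)))) (-≡ _))))
    where
    ∸-suc : ∀ {k l} → k ≡ suc l → k ≤ n → n ∸ l ≡ suc (n ∸ k)
    ∸-suc {l = l} refl l<n = ℕₚ.+-∸-assoc 1 l<n
    neg-neg : ∀ x → - - x ≡ x
    neg-neg = solve 1 (λ x → :- :- x := x) refl
    joined : length (loops S (conjugate S₁)) ≡ suc (length (loops S S₁))
    joined = trans (Conjugation.separate⇒length S (conjugate S₁) a≢b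
        (Conjugation.joined⇒separate S S₁ a≢b χ χ-S χ-S₁ χa≡χb a~b))
      (cong (λ S₂ → suc (length (loops S S₂))) (conjugate-involutive S₁))

-- Boxes of the diagram of 2λ

∑-atMostOne : ∀ {m} {P : Fin m → Set} (P? : ∀ i → Dec (P i)) → (∀ i j → P i → P j → i ≡ j) →
              ∑ (allFin m) (λ i → 𝟙 (P? i)) ℚ.≤ 1ℚ
∑-atMostOne {m} P? unique with Finₚ.any? P?
... | yes (i , pi) = ℚₚ.≤-reflexive (trans
        (∑-single (finE m) i _ (λ j j≢i → 𝟙-no (P? j) (λ pj → j≢i (unique j i pj pi)))) (𝟙-yes (P? i) pi))
... | no none = subst (ℚ._≤ 1ℚ) (sym (∑-zero (allFin m) (λ i → 𝟙-no (P? i) (λ pi → none (i , pi)))))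
                      (ℚₚ.nonNegative⁻¹ 1ℚ)

∑-exactlyOne : ∀ {m} {P : Fin m → Set} (P? : ∀ i → Dec (P i)) → (∀ i j → P i → P j → i ≡ j) →
               ∃ P → ∑ (allFin m) (λ i → 𝟙 (P? i)) ≡ 1ℚ
∑-exactlyOne {m} P? unique (i , pi) = trans
  (∑-single (finE m) i _ (λ j j≢i → 𝟙-no (P? j) (λ pj → j≢i (unique j i pj pi)))) (𝟙-yes (P? i) pi)

∑-below : ∀ l k → ∑ (allFin l) (λ q → 𝟙 (k ℕ.≟ toℕ q)) ≡ 𝟙 (k ℕ.<? l)
∑-below l k = case k ℕ.<? l of λ
  { (yes k<l) → trans (∑-exactlyOne (λ q → k ℕ.≟ toℕ q) (λ q q′ eq eq′ → Finₚ.toℕ-injective (trans (sym eq) eq′))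
                        (fromℕ< k<l , sym (Finₚ.toℕ-fromℕ< k<l)))
                      (sym (𝟙-yes (k ℕ.<? l) k<l))
  ; (no k≮l)  → trans (∑-zero (allFin l) (λ q → 𝟙-no (k ℕ.≟ toℕ q) (λ { refl → k≮l (Finₚ.toℕ<n q) })))
                      (sym (𝟙-no (k ℕ.<? l) k≮l)) }

∑-toℕ< : ∀ m s → s ≤ m → ∑ (allFin m) (λ i → 𝟙 (toℕ i ℕ.<? s)) ≡ fromℕ s
∑-toℕ< m s s≤m = begin
  ∑ (allFin m) (λ i → 𝟙 (toℕ i ℕ.<? s))
    ≡⟨ ∑-cong (allFin m) (λ i → sym (∑-below s (toℕ i))) ⟩
  ∑ (allFin m) (λ i → ∑ (allFin s) (λ q → 𝟙 (toℕ i ℕ.≟ toℕ q)))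
    ≡⟨ ∑-swap (allFin m) (allFin s) _ ⟩
  ∑ (allFin s) (λ q → ∑ (allFin m) (λ i → 𝟙 (toℕ i ℕ.≟ toℕ q)))
    ≡⟨ ∑-cong (allFin s) (λ q → ∑-exactlyOne (λ i → toℕ i ℕ.≟ toℕ q)
         (λ i j eq eq′ → Finₚ.toℕ-injective (trans eq (sym eq′)))
         (Fin.inject≤ q s≤m , Finₚ.toℕ-inject≤ q s≤m)) ⟩
  ∑ (allFin s) (λ _ → 1ℚ)
    ≡⟨ ∑-one s ⟩
  fromℕ s ∎
  where open ≡-Reasoning

injective⇒surjective : ∀ {m} (w : Fin m → Fin m) → (∀ i j → w i ≡ w j → i ≡ j) → ∀ y → ∃ λ i → w i ≡ y
injective⇒surjective {suc m} w inj y with Finₚ.any? (λ i → w i Fin.≟ y)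
... | yes hit = hit
... | no none with Finₚ.pigeonhole (ℕₚ.n<1+n m) (λ i → Fin.punchOut {i = y} {j = w i} (λ eq → none (i , sym eq)))
...   | i , j , i<j , eq = contradiction (inj i j (Finₚ.punchOut-injective {i = y} {j = w i} {k = w j} _ _ eq)) (Finₚ.<⇒≢ i<j)

∑-permute : ∀ {m} (w : Fin m → Fin m) → (∀ i j → w i ≡ w j → i ≡ j) → ∀ (g : Fin m → ℚ) →
            ∑ (allFin m) (g ∘ w) ≡ ∑ (allFin m) g
∑-permute {m} w inj g = begin
  ∑ (allFin m) (g ∘ w)
    ≡⟨ ∑-cong (allFin m) (λ i → sym (∑-δ (finE m) (w i) g)) ⟩
  ∑ (allFin m) (λ i → ∑ (allFin m) (λ y → 𝟙 (y Fin.≟ w i) * g y))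
    ≡⟨ ∑-swap (allFin m) (allFin m) _ ⟩
  ∑ (allFin m) (λ y → ∑ (allFin m) (λ i → 𝟙 (y Fin.≟ w i) * g y))
    ≡⟨ ∑-cong (allFin m) (λ y → trans (sym (∑-*ʳ (g y) (allFin m) _)) (trans (cong (_* g y)
         (∑-exactlyOne (λ i → y Fin.≟ w i) (λ i j eq eq′ → inj i j (trans (sym eq) eq′))
           (proj₁ (injective⇒surjective w inj y) , sym (proj₂ (injective⇒surjective w inj y)))))
         (*-identityˡ (g y)))) ⟩
  ∑ (allFin m) g ∎
  where open ≡-Reasoning

swapℕ : ℕ → ℕ
swapℕ 0             = 1
swapℕ 1             = 0
swapℕ (suc (suc k)) = suc (suc (swapℕ k))

swapℕ-involutive : ∀ k → swapℕ (swapℕ k) ≡ k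
swapℕ-involutive 0             = refl
swapℕ-involutive 1             = refl
swapℕ-involutive (suc (suc k)) = cong (suc ∘ suc) (swapℕ-involutive k)

odd-swapℕ : ∀ k → odd (swapℕ k) ≡ not (odd k)
odd-swapℕ 0             = refl
odd-swapℕ 1             = refl
odd-swapℕ (suc (suc k)) = cong (not ∘ not) (odd-swapℕ k)

swapℕ-*2+ : ∀ q k → swapℕ (q ℕ.* 2 ℕ.+ k) ≡ q ℕ.* 2 ℕ.+ swapℕ k
swapℕ-*2+ zero    k = refl
swapℕ-*2+ (suc q) k = cong (suc ∘ suc) (swapℕ-*2+ q k)

swapℕ-< : ∀ q {k} → k < q ℕ.* 2 → swapℕ k < q ℕ.* 2
swapℕ-< (suc q) {0}             _               = s≤s (s≤s z≤n)
swapℕ-< (suc q) {1}             _               = s≤s z≤n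
swapℕ-< (suc q) {suc (suc k)} (s≤s (s≤s k<)) = s≤s (s≤s (swapℕ-< q k<))

toℕ-standard : ∀ n i → toℕ (⟦ standard n ⟧ i) ≡ swapℕ (toℕ i)
toℕ-standard n i = begin
  toℕ (⟦ standard n ⟧ i)                    ≡⟨ cong toℕ (Vecₚ.lookup∘tabulate (swap {n}) i) ⟩
  toℕ (Fin.combine q (Fin.opposite r))      ≡⟨ Finₚ.toℕ-combine q (Fin.opposite r) ⟩
  2 ℕ.* toℕ q ℕ.+ toℕ (Fin.opposite r)      ≡⟨ cong₂ ℕ._+_ (ℕₚ.*-comm 2 (toℕ q)) (opposite₂ r) ⟩
  toℕ q ℕ.* 2 ℕ.+ swapℕ (toℕ r)             ≡⟨ sym (swapℕ-*2+ (toℕ q) (toℕ r)) ⟩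
  swapℕ (toℕ q ℕ.* 2 ℕ.+ toℕ r)             ≡⟨ cong (λ a → swapℕ (a ℕ.+ toℕ r)) (ℕₚ.*-comm (toℕ q) 2) ⟩
  swapℕ (2 ℕ.* toℕ q ℕ.+ toℕ r)             ≡⟨ cong swapℕ (sym (Finₚ.toℕ-combine q r)) ⟩
  swapℕ (toℕ (Fin.combine q r))             ≡⟨ cong (swapℕ ∘ toℕ) (Finₚ.combine-remQuot {n} 2 i) ⟩
  swapℕ (toℕ i)                             ∎
  where
  open ≡-Reasoning
  q = proj₁ (Fin.remQuot {n} 2 i)
  r = proj₂ (Fin.remQuot {n} 2 i)
  opposite₂ : ∀ (r : Fin 2) → toℕ (Fin.opposite r) ≡ swapℕ (toℕ r)
  opposite₂ Fin.zero           = refl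
  opposite₂ (Fin.suc Fin.zero) = refl

module _ (r : ℕ) (rs : List ℕ) where

  box-< : ∀ {m} → m < r → box (r ∷ rs) m ≡ (0 , m)
  box-< {m} m<r with m ℕ.<? r | box rs (m ∸ r)
  ... | yes _  | _ = refl
  ... | no m≮r | _ = contradiction m<r m≮r

  box-≥ : ∀ {m} → ¬ m < r → box (r ∷ rs) m ≡ (suc (proj₁ (box rs (m ∸ r))) , proj₂ (box rs (m ∸ r)))
  box-≥ {m} m≮r with m ℕ.<? r | box rs (m ∸ r)
  ... | yes m<r | _ = contradiction m<r m≮r
  ... | no _    | _ = refl

box-swapℕ : ∀ ks m → box (map (2 ℕ.*_) ks) (swapℕ m) ≡
            (proj₁ (box (map (2 ℕ.*_) ks) m) , swapℕ (proj₂ (box (map (2 ℕ.*_) ks) m)))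
box-swapℕ []       m = refl
box-swapℕ (k ∷ ks) m = case m ℕ.<? 2 ℕ.* k of λ
  { (yes m<) → trans (box-< (2 ℕ.* k) rs (swap-< m m<)) (sym (cong (λ (i , j) → i , swapℕ j) (box-< (2 ℕ.* k) rs m<)))
  ; (no m≮)  → trans (box-≥ (2 ℕ.* k) rs (λ sm< → m≮ (subst (_< 2 ℕ.* k) (swapℕ-involutive m) (swap-< (swapℕ m) sm<))))
      (trans (cong (λ b → suc (proj₁ b) , proj₂ b) (trans (cong (box rs) (swap-∸ m (ℕₚ.≮⇒≥ m≮))) (box-swapℕ ks (m ∸ 2 ℕ.* k))))
             (sym (cong (λ (i , j) → i , swapℕ j) (box-≥ (2 ℕ.* k) rs m≮)))) }
  where
  rs = map (2 ℕ.*_) ks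
  swap-< : ∀ m → m < 2 ℕ.* k → swapℕ m < 2 ℕ.* k
  swap-< m m< = subst (swapℕ m <_) (ℕₚ.*-comm k 2) (swapℕ-< k (subst (m <_) (ℕₚ.*-comm 2 k) m<))
  swap-∸ : ∀ m → 2 ℕ.* k ≤ m → swapℕ m ∸ 2 ℕ.* k ≡ swapℕ (m ∸ 2 ℕ.* k)
  swap-∸ m k≤m = begin
    swapℕ m ∸ 2 ℕ.* k                              ≡⟨ cong (λ a → swapℕ a ∸ 2 ℕ.* k) (sym (ℕₚ.m+[n∸m]≡n k≤m)) ⟩
    swapℕ (2 ℕ.* k ℕ.+ d) ∸ 2 ℕ.* k                ≡⟨ cong (λ a → swapℕ (a ℕ.+ d) ∸ a) (ℕₚ.*-comm 2 k) ⟩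
    swapℕ (k ℕ.* 2 ℕ.+ d) ∸ k ℕ.* 2                ≡⟨ cong (_∸ k ℕ.* 2) (swapℕ-*2+ k d) ⟩
    k ℕ.* 2 ℕ.+ swapℕ d ∸ k ℕ.* 2                  ≡⟨ ℕₚ.m+n∸m≡n (k ℕ.* 2) (swapℕ d) ⟩
    swapℕ d                                        ∎
    where
    open ≡-Reasoning
    d = m ∸ 2 ℕ.* k

box-position : ∀ rs m → m ≡ sum (take (proj₁ (box rs m)) rs) ℕ.+ proj₂ (box rs m)
box-position []       m = refl
box-position (r ∷ rs) m = case m ℕ.<? r of λ
  { (yes m<r) → sym (cong (λ (i , j) → sum (take i (r ∷ rs)) ℕ.+ j) (box-< r rs m<r))
  ; (no m≮r)  → trans (sym (ℕₚ.m+[n∸m]≡n (ℕₚ.≮⇒≥ m≮r))) (trans (cong (r ℕ.+_) (box-position rs (m ∸ r)))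
      (trans (sym (ℕₚ.+-assoc r _ _)) (sym (cong (λ (i , j) → sum (take i (r ∷ rs)) ℕ.+ j) (box-≥ r rs m≮r))))) }

box-row-< : ∀ l rs m → m < sum rs → proj₁ (box rs m) < l → m < sum (take l rs)
box-row-< (suc l) (r ∷ rs) m m<∑ row< = case m ℕ.<? r of λ
  { (yes m<r) → ℕₚ.≤-trans m<r (ℕₚ.m≤m+n r _)
  ; (no m≮r)  → subst (_< r ℕ.+ sum (take l rs)) (ℕₚ.m+[n∸m]≡n (ℕₚ.≮⇒≥ m≮r)) (ℕₚ.+-monoʳ-< r
      (box-row-< l rs (m ∸ r) (ℕₚ.+-cancelˡ-< r _ _ (subst (_< r ℕ.+ sum rs) (sym (ℕₚ.m+[n∸m]≡n (ℕₚ.≮⇒≥ m≮r))) m<∑))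
        (ℕₚ.≤-pred (subst (λ b → proj₁ b < suc l) (box-≥ r rs m≮r) row<)))) }

<-box-row : ∀ l rs m → m < sum (take l rs) → proj₁ (box rs m) < l
<-box-row (suc l) (r ∷ rs) m m< = case m ℕ.<? r of λ
  { (yes m<r) → subst (λ b → proj₁ b < suc l) (sym (box-< r rs m<r)) (s≤s z≤n)
  ; (no m≮r)  → subst (λ b → proj₁ b < suc l) (sym (box-≥ r rs m≮r)) (s≤s (<-box-row l rs (m ∸ r)
      (ℕₚ.+-cancelˡ-< r _ _ (subst (_< r ℕ.+ sum (take l rs)) (sym (ℕₚ.m+[n∸m]≡n (ℕₚ.≮⇒≥ m≮r))) m<)))) }

box-column-< : ∀ {r} rs m → All (_≤ r) rs → m < sum rs → proj₂ (box rs m) < r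
box-column-< (r′ ∷ rs) m (r′≤r ∷ rs≤r) m<∑ = case m ℕ.<? r′ of λ
  { (yes m<r′) → subst (λ b → proj₂ b < _) (sym (box-< r′ rs m<r′)) (ℕₚ.≤-trans m<r′ r′≤r)
  ; (no m≮r′)  → subst (λ b → proj₂ b < _) (sym (box-≥ r′ rs m≮r′)) (box-column-< rs (m ∸ r′) rs≤r
      (ℕₚ.+-cancelˡ-< r′ _ _ (subst (_< r′ ℕ.+ sum rs) (sym (ℕₚ.m+[n∸m]≡n (ℕₚ.≮⇒≥ m≮r′))) m<∑))) }

box-above : ∀ rs → AllPairs _≥_ rs → ∀ m → m < sum rs → ∀ q → q ≤ proj₁ (box rs m) →
            ∃ λ m′ → m′ < sum rs × box rs m′ ≡ (q , proj₂ (box rs m))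
box-above (r ∷ rs) (r≥ ∷ rs≥) m m<∑ q q≤ = case m ℕ.<? r of λ
  { (yes m<r) → m , m<∑ , cong (_, proj₂ (box (r ∷ rs) m)) (trans (cong proj₁ (box-< r rs m<r))
      (sym (ℕₚ.n≤0⇒n≡0 (subst (λ b → q ≤ proj₁ b) (box-< r rs m<r) q≤))))
  ; (no m≮r)  → subst (λ b → ∃ λ m′ → m′ < sum (r ∷ rs) × box (r ∷ rs) m′ ≡ (q , proj₂ b)) (sym (box-≥ r rs m≮r))
      (above m≮r q (subst (λ b → q ≤ proj₁ b) (box-≥ r rs m≮r) q≤)) }
  where
  m∸r< : ¬ m < r → m ∸ r < sum rs
  m∸r< m≮r = ℕₚ.+-cancelˡ-< r _ _ (subst (_< r ℕ.+ sum rs) (sym (ℕₚ.m+[n∸m]≡n (ℕₚ.≮⇒≥ m≮r))) m<∑)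
  above : ¬ m < r → ∀ q → q ≤ suc (proj₁ (box rs (m ∸ r))) →
          ∃ λ m′ → m′ < sum (r ∷ rs) × box (r ∷ rs) m′ ≡ (q , proj₂ (box rs (m ∸ r)))
  above m≮r zero    _        = proj₂ (box rs (m ∸ r)) , ℕₚ.≤-trans col<r (ℕₚ.m≤m+n r _) , box-< r rs col<r
    where
    col<r : proj₂ (box rs (m ∸ r)) < r
    col<r = box-column-< rs (m ∸ r) r≥ (m∸r< m≮r)
  above m≮r (suc q) (s≤s q≤) with box-above rs rs≥ (m ∸ r) (m∸r< m≮r) q q≤
  ... | m′ , m′< , eq = r ℕ.+ m′ , ℕₚ.+-monoʳ-< r m′< ,
    trans (box-≥ r rs (ℕₚ.≤⇒≯ (ℕₚ.m≤m+n r m′)))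
          (cong (λ b → suc (proj₁ b) , proj₂ b) (trans (cong (box rs) (ℕₚ.m+n∸m≡n r m′)) eq))

sum-take-double : ∀ l ks → sum (take l (map (2 ℕ.*_) ks)) ≡ 2 ℕ.* sum (take l ks)
sum-take-double zero    ks       = refl
sum-take-double (suc l) []       = refl
sum-take-double (suc l) (k ∷ ks) =
  trans (cong (2 ℕ.* k ℕ.+_) (sum-take-double l ks)) (sym (ℕₚ.*-distribˡ-+ 2 k (sum (take l ks))))

sum-double : ∀ ks → sum (map (2 ℕ.*_) ks) ≡ sum ks ℕ.* 2
sum-double []       = refl
sum-double (k ∷ ks) = trans (cong₂ ℕ._+_ (ℕₚ.*-comm 2 k) (sum-double ks)) (sym (ℕₚ.*-distribʳ-+ 2 k (sum ks)))

sum-take-≤ : ∀ l ks → sum (take l ks) ≤ sum ks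
sum-take-≤ zero    ks       = z≤n
sum-take-≤ (suc l) []       = z≤n
sum-take-≤ (suc l) (k ∷ ks) = ℕₚ.+-monoʳ-≤ k (sum-take-≤ l ks)

module Tableau {n : ℕ} (la : Partition n) where

  private
    m = n ℕ.* 2
    rs = map (2 ℕ.*_) (parts la)
    sum-rs : sum rs ≡ m
    sum-rs = trans (sum-double (parts la)) (cong (ℕ._* 2) (sum-parts la))
    toℕ<sum : ∀ (i : Fin m) → toℕ i < sum rs
    toℕ<sum i = subst (toℕ i <_) (sym sum-rs) (Finₚ.toℕ<n i)

  row-standard : ∀ i → row la (⟦ standard n ⟧ i) ≡ row la i
  row-standard i = trans (cong (proj₁ ∘ box rs) (toℕ-standard n i)) (cong proj₁ (box-swapℕ (parts la) (toℕ i)))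

  column-standard : ∀ i → column la (⟦ standard n ⟧ i) ≡ swapℕ (column la i)
  column-standard i = trans (cong (proj₂ ∘ box rs) (toℕ-standard n i)) (cong proj₂ (box-swapℕ (parts la) (toℕ i)))

  box-injective : ∀ {i j} → row la i ≡ row la j → column la i ≡ column la j → i ≡ j
  box-injective {i} {j} row≡ column≡ = Finₚ.toℕ-injective (trans (box-position rs (toℕ i))
    (trans (cong₂ (λ a b → sum (take a rs) ℕ.+ b) row≡ column≡) (sym (box-position rs (toℕ j)))))

  column-< : ∀ i → column la i < m
  column-< i = ℕₚ.≤-<-trans
    (subst (column la i ≤_) (sym (box-position rs (toℕ i))) (ℕₚ.m≤n+m _ _)) (Finₚ.toℕ<n i)

  above : ∀ i q → q ≤ row la i → ∃ λ j → row la j ≡ q × column la j ≡ column la i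
  above i q q≤ with box-above rs decreasing′ (toℕ i) (toℕ<sum i) q q≤
    where
    decreasing′ : AllPairs _≥_ rs
    decreasing′ = AllPairsₚ.map⁺ (AllPairs.map (ℕₚ.*-monoʳ-≤ 2)
      (Linkedₚ.Linked⇒AllPairs (λ i≥j j≥k → ℕₚ.≤-trans j≥k i≥j) (parts-decreasing la)))
  ... | m′ , m′< , eq = fromℕ< m′<m , cong proj₁ eq′ , cong proj₂ eq′
    where
    m′<m : m′ < m
    m′<m = subst (m′ <_) sum-rs m′<
    eq′ : box rs (toℕ (fromℕ< m′<m)) ≡ (q , column la i)
    eq′ = trans (cong (box rs) (Finₚ.toℕ-fromℕ< m′<m)) eq

  ∑-rows-below : ∀ l → ∑ (allFin m) (λ i → 𝟙 (row la i ℕ.<? l)) ≡ fromℕ (2 ℕ.* sum (take l (parts la)))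
  ∑-rows-below l = begin
    ∑ (allFin m) (λ i → 𝟙 (row la i ℕ.<? l))
      ≡⟨ ∑-cong (allFin m) (λ i → 𝟙-cong (row la i ℕ.<? l) (toℕ i ℕ.<? sum (take l rs))
           (box-row-< l rs (toℕ i) (toℕ<sum i)) (<-box-row l rs (toℕ i))) ⟩
    ∑ (allFin m) (λ i → 𝟙 (toℕ i ℕ.<? sum (take l rs)))
      ≡⟨ ∑-toℕ< m _ (subst (sum (take l rs) ≤_) sum-rs (sum-take-≤ l rs)) ⟩
    fromℕ (sum (take l rs))
      ≡⟨ cong fromℕ (sum-take-double l (parts la)) ⟩
    fromℕ (2 ℕ.* sum (take l (parts la))) ∎
    where open ≡-Reasoning

  -- Column by column: a column either lies within the first l rows or meets
  -- all of them, and in the latter case has at most l boxes with f < l.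
  ∑-below-≤ : ∀ (f : Fin m → ℕ) → (∀ i j → column la i ≡ column la j → f i ≡ f j → i ≡ j) → ∀ l →
              ∑ (allFin m) (λ i → 𝟙 (f i ℕ.<? l)) ℚ.≤ ∑ (allFin m) (λ i → 𝟙 (row la i ℕ.<? l))
  ∑-below-≤ f f-inj l = subst₂ ℚ._≤_ (sym (by-columns f)) (sym (by-columns (row la))) (∑-mono (allFin m) in-column)
    where
    open ≡-Reasoning
    column? : ∀ j i → Dec (column la i ≡ toℕ j)
    column? j i = column la i ℕ.≟ toℕ j
    by-columns : ∀ (g : Fin m → ℕ) → ∑ (allFin m) (λ i → 𝟙 (g i ℕ.<? l)) ≡
                 ∑ (allFin m) (λ j → ∑ (allFin m) (λ i → 𝟙 (column? j i ×-dec (g i ℕ.<? l))))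
    by-columns g = begin
      ∑ (allFin m) (λ i → 𝟙 (g i ℕ.<? l))
        ≡⟨ ∑-cong (allFin m) (λ i → sym (trans (sym (∑-*ʳ (𝟙 (g i ℕ.<? l)) (allFin m) _))
             (trans (cong (_* 𝟙 (g i ℕ.<? l)) (trans (∑-below m (column la i)) (𝟙-yes (column la i ℕ.<? m) (column-< i))))
                    (*-identityˡ _)))) ⟩
      ∑ (allFin m) (λ i → ∑ (allFin m) (λ j → 𝟙 (column? j i) * 𝟙 (g i ℕ.<? l)))
        ≡⟨ ∑-swap (allFin m) (allFin m) _ ⟩
      ∑ (allFin m) (λ j → ∑ (allFin m) (λ i → 𝟙 (column? j i) * 𝟙 (g i ℕ.<? l)))
        ≡⟨ ∑-cong (allFin m) (λ j → ∑-cong (allFin m) (λ i → sym (𝟙-× (column? j i) (g i ℕ.<? l)))) ⟩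
      ∑ (allFin m) (λ j → ∑ (allFin m) (λ i → 𝟙 (column? j i ×-dec (g i ℕ.<? l)))) ∎
    by-values : ∀ (g : Fin m → ℕ) j → ∑ (allFin m) (λ i → 𝟙 (column? j i ×-dec (g i ℕ.<? l))) ≡
                ∑ (allFin l) (λ q → ∑ (allFin m) (λ i → 𝟙 (column? j i ×-dec (g i ℕ.≟ toℕ q))))
    by-values g j = begin
      ∑ (allFin m) (λ i → 𝟙 (column? j i ×-dec (g i ℕ.<? l)))
        ≡⟨ ∑-cong (allFin m) (λ i → trans (𝟙-× (column? j i) (g i ℕ.<? l))
             (trans (cong (𝟙 (column? j i) *_) (sym (∑-below l (g i))))
             (trans (∑-*ˡ (𝟙 (column? j i)) (allFin l) _)
                    (∑-cong (allFin l) (λ q → sym (𝟙-× (column? j i) (g i ℕ.≟ toℕ q))))))) ⟩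
      ∑ (allFin m) (λ i → ∑ (allFin l) (λ q → 𝟙 (column? j i ×-dec (g i ℕ.≟ toℕ q))))
        ≡⟨ ∑-swap (allFin m) (allFin l) _ ⟩
      ∑ (allFin l) (λ q → ∑ (allFin m) (λ i → 𝟙 (column? j i ×-dec (g i ℕ.≟ toℕ q)))) ∎
    in-column : ∀ j → ∑ (allFin m) (λ i → 𝟙 (column? j i ×-dec (f i ℕ.<? l))) ℚ.≤
                      ∑ (allFin m) (λ i → 𝟙 (column? j i ×-dec (row la i ℕ.<? l)))
    in-column j with Finₚ.any? (λ i → column? j i ×-dec (l ℕ.≤? row la i))
    ... | no short = ∑-mono (allFin m) (λ i → 𝟙-mono (column? j i ×-dec (f i ℕ.<? l)) (column? j i ×-dec (row la i ℕ.<? l))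
      (λ (col , _) → col , ℕₚ.≰⇒> (λ l≤ → short (i , col , l≤))))
    ... | yes (x , col , l≤) = subst₂ ℚ._≤_ (sym (by-values f j)) (sym (by-values (row la) j))
      (∑-mono (allFin l) (λ q → ℚₚ.≤-trans
        (∑-atMostOne (λ i → column? j i ×-dec (f i ℕ.≟ toℕ q))
          (λ i i′ (c , v) (c′ , v′) → f-inj i i′ (trans c (sym c′)) (trans v (sym v′))))
        (ℚₚ.≤-reflexive (sym (∑-exactlyOne (λ i → column? j i ×-dec (row la i ℕ.≟ toℕ q))
          (λ i i′ (c , v) (c′ , v′) → box-injective (trans v (sym v′)) (trans c (sym c′)))
          (meets q))))))
      where
      meets : ∀ (q : Fin l) → ∃ λ i → column la i ≡ toℕ j × row la i ≡ toℕ q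
      meets q with above x (toℕ q) (ℕₚ.≤-trans (ℕₚ.<⇒≤ (Finₚ.toℕ<n q)) l≤)
      ... | y , row≡ , col≡ = y , trans col≡ col , row≡

  column-injective⇒⊴ : ∀ (μ : Partition n) (f : Fin m → ℕ) →
    (∀ i j → column la i ≡ column la j → f i ≡ f j → i ≡ j) →
    (∀ l → ∑ (allFin m) (λ i → 𝟙 (f i ℕ.<? l)) ≡ fromℕ (2 ℕ.* sum (take l (parts μ)))) → μ ⊴ la
  column-injective⇒⊴ μ f f-inj counts l = ℕₚ.*-cancelˡ-≤ 2 (fromℕ-cancel-≤
    (subst₂ ℚ._≤_ (counts l) (∑-rows-below l) (∑-below-≤ f f-inj l)))

⊴-antisym : ∀ {n} {μ ν : Partition n} → μ ⊴ ν → ν ⊴ μ → μ ≡ ν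
⊴-antisym {μ = μ} {ν} μ⊴ν ν⊴μ = parts-injective (prefix-sums-injective (parts μ) (parts ν)
  (parts-positive μ) (parts-positive ν) (λ k → ℕₚ.≤-antisym (μ⊴ν k) (ν⊴μ k)))
  where
  prefix-sums-injective : ∀ ks ls → Positive ks → Positive ls →
                          (∀ k → sum (take k ks) ≡ sum (take k ls)) → ks ≡ ls
  prefix-sums-injective []       []       _ _ _  = refl
  prefix-sums-injective []       (l ∷ ls) _ (0<l ∷ _) eq =
    contradiction (trans (eq 1) (ℕₚ.+-identityʳ l)) (ℕₚ.<⇒≢ 0<l)
  prefix-sums-injective (k ∷ ks) []       (0<k ∷ _) _ eq =
    contradiction (trans (sym (eq 1)) (ℕₚ.+-identityʳ k)) (ℕₚ.<⇒≢ 0<k)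
  prefix-sums-injective (k ∷ ks) (l ∷ ls) (_ ∷ ks>0) (_ ∷ ls>0) eq = cong₂ _∷_ k≡l
    (prefix-sums-injective ks ls ks>0 ls>0 (λ j → ℕₚ.+-cancelˡ-≡ k _ _
      (trans (eq (suc j)) (cong (ℕ._+ sum (take j ls)) (sym k≡l)))))
    where
    k≡l : k ≡ l
    k≡l = trans (sym (ℕₚ.+-identityʳ k)) (trans (eq 1) (ℕₚ.+-identityʳ l))

-- The right-hand side of the theorem

∑-factor : ∀ {A B W : Set} (as : List A) (bs : List B) (ws : List W)
           (c e : A → ℚ) (d : B → ℚ) (x : A → W → ℚ) (y : B → W → ℚ) (k : W → ℚ) →
           ∑ as (λ a → ∑ bs (λ b → c a * d b * (e a * ∑ ws (λ w → x a w * y b w * k w)))) ≡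
           ∑ ws (λ w → k w * (∑ as (λ a → c a * (e a * x a w)) * ∑ bs (λ b → d b * y b w)))
∑-factor as bs ws c e d x y k = begin
  ∑ as (λ a → ∑ bs (λ b → c a * d b * (e a * ∑ ws (λ w → x a w * y b w * k w))))
    ≡⟨ ∑-cong as (λ a → ∑-cong bs (λ b → trans (cong (c a * d b *_) (∑-*ˡ (e a) ws _))
         (trans (∑-*ˡ (c a * d b) ws _)
                (∑-cong ws (λ w → regroup (c a) (d b) (e a) (x a w) (y b w) (k w)))))) ⟩
  ∑ as (λ a → ∑ bs (λ b → ∑ ws (λ w → k w * ((c a * (e a * x a w)) * (d b * y b w)))))
    ≡⟨ ∑-cong as (λ a → ∑-swap bs ws _) ⟩
  ∑ as (λ a → ∑ ws (λ w → ∑ bs (λ b → k w * ((c a * (e a * x a w)) * (d b * y b w)))))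
    ≡⟨ ∑-swap as ws _ ⟩
  ∑ ws (λ w → ∑ as (λ a → ∑ bs (λ b → k w * ((c a * (e a * x a w)) * (d b * y b w)))))
    ≡⟨ ∑-cong ws (λ w → trans (∑-cong as (λ a → sym (∑-*ˡ (k w) bs _))) (trans (sym (∑-*ˡ (k w) as _))
         (cong (k w *_) (sym (∑-*-∑ as bs (λ a → c a * (e a * x a w)) (λ b → d b * y b w)))))) ⟩
  ∑ ws (λ w → k w * (∑ as (λ a → c a * (e a * x a w)) * ∑ bs (λ b → d b * y b w))) ∎
  where
  open ≡-Reasoning
  regroup : ∀ c d e x y k → c * d * (e * (x * y * k)) ≡ k * ((c * (e * x)) * (d * y))
  regroup = solve 6 (λ c d e x y k → c :* d :* (e :* (x :* y :* k)) := k :* ((c :* (e :* x)) :* (d :* y))) refl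

conjugate-equivariant : ∀ {n} {A : Set} (a b : Fin (n ℕ.* 2)) (f : Fin (n ℕ.* 2) → A) (h : A → A) → f a ≡ f b →
                        ∀ (S : PairPartition n) → (∀ i → f (⟦ S ⟧ i) ≡ h (f i)) →
                        ∀ i → f (⟦ conjugate a b S ⟧ i) ≡ h (f i)
conjugate-equivariant a b f h fa≡fb S eqv i = begin
  f (⟦ conjugate a b S ⟧ i) ≡⟨ cong f (⟦conjugate⟧ a b S i) ⟩
  f (t (⟦ S ⟧ (t i)))       ≡⟨ transpose-invariant a b f fa≡fb (⟦ S ⟧ (t i)) ⟩
  f (⟦ S ⟧ (t i))           ≡⟨ eqv (t i) ⟩
  h (f (t i))               ≡⟨ cong h (transpose-invariant a b f fa≡fb i) ⟩
  h (f i)                   ∎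
  where
  open ≡-Reasoning
  t = transpose a b

module Admissibility {n : ℕ} (la : Partition n) where

  open Tableau la public

  PreservesColumns : PairPartition n → Set
  PreservesColumns S = ∀ i → column la (⟦ standard n ⟧ (⟦ S ⟧ i)) ≡ column la i

  preservesColumns? : ∀ S → Dec (PreservesColumns S)
  preservesColumns? S = Finₚ.all? (λ i → column la (⟦ standard n ⟧ (⟦ S ⟧ i)) ℕ.≟ column la i)

  PreservesRows : PairPartition n → Set
  PreservesRows S = ∀ i → row la (⟦ S ⟧ i) ≡ row la i

  preservesRows? : ∀ S → Dec (PreservesRows S)
  preservesRows? S = Finₚ.all? (λ i → row la (⟦ S ⟧ i) ℕ.≟ row la i)

  columns⇒swap : ∀ S → PreservesColumns S → ∀ i → column la (⟦ S ⟧ i) ≡ swapℕ (column la i)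
  columns⇒swap S pres i = trans (sym (swapℕ-involutive _))
    (cong swapℕ (trans (sym (column-standard (⟦ S ⟧ i))) (pres i)))

  swap⇒columns : ∀ S → (∀ i → column la (⟦ S ⟧ i) ≡ swapℕ (column la i)) → PreservesColumns S
  swap⇒columns S eqv i = trans (column-standard (⟦ S ⟧ i))
    (trans (cong swapℕ (eqv i)) (swapℕ-involutive (column la i)))

  𝟙-conjugate : ∀ (a b : Fin (n ℕ.* 2)) {P : PairPartition n → Set} (P? : ∀ S → Dec (P S)) →
                (∀ S → P S → P (conjugate a b S)) → ∀ S → 𝟙 (P? (conjugate a b S)) ≡ 𝟙 (P? S)
  𝟙-conjugate a b {P} P? closed S = 𝟙-cong (P? (conjugate a b S)) (P? S)
    (λ pS → subst P (conjugate-involutive a b S) (closed (conjugate a b S) pS)) (closed S)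

  conjugate-columns : ∀ {a b} → column la a ≡ column la b → ∀ S →
                      𝟙 (preservesColumns? (conjugate a b S)) ≡ 𝟙 (preservesColumns? S)
  conjugate-columns {a} {b} col≡ = 𝟙-conjugate a b preservesColumns? (λ S pres → swap⇒columns (conjugate a b S)
    (conjugate-equivariant a b (column la) swapℕ col≡ S (columns⇒swap S pres)))

  conjugate-rows : ∀ {a b} → row la a ≡ row la b → ∀ S →
                   𝟙 (preservesRows? (conjugate a b S)) ≡ 𝟙 (preservesRows? S)
  conjugate-rows {a} {b} row≡ = 𝟙-conjugate a b preservesRows?
    (conjugate-equivariant a b (row la) id row≡)

  ε : PairPartition n → ℚ
  ε = sign (standard n)

  ε-conjugate : ∀ {a b} → a ≢ b → column la a ≡ column la b → ∀ S → PreservesColumns S →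
                ε (conjugate a b S) ≡ - ε S
  ε-conjugate {a} {b} a≢b col≡ S pres = sign-conjugate a b (standard n) S a≢b (odd ∘ column la)
    (λ i → trans (cong odd (column-standard i)) (odd-swapℕ (column la i)))
    (λ i → trans (cong odd (columns⇒swap S pres i)) (odd-swapℕ (column la i)))
    (cong odd col≡)

  columnSum-conjugate : ∀ {a b} → a ≢ b → column la a ≡ column la b → ∀ (g g′ : PairPartition n → ℚ) →
    (∀ S → g′ (conjugate a b S) ≡ g S) →
    ∑ (pairPartitions n) (λ S → 𝟙 (preservesColumns? S) * (ε S * g′ S)) ≡
    - ∑ (pairPartitions n) (λ S → 𝟙 (preservesColumns? S) * (ε S * g S))
  columnSum-conjugate {a} {b} a≢b col≡ g g′ g′≡g = trans
    (∑-involution (pairPartitionsE n) (conjugate a b) (conjugate-involutive a b) _)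
    (trans (∑-cong (pairPartitions n) flip) (∑-neg (pairPartitions n) _))
    where
    open ≡-Reasoning
    neg-out : ∀ c e x → c * ((- e) * x) ≡ - (c * (e * x))
    neg-out = solve 3 (λ c e x → c :* ((:- e) :* x) := :- (c :* (e :* x))) refl
    flip : ∀ S → 𝟙 (preservesColumns? (conjugate a b S)) * (ε (conjugate a b S) * g′ (conjugate a b S)) ≡
                 - (𝟙 (preservesColumns? S) * (ε S * g S))
    flip S = begin
      𝟙 (preservesColumns? (conjugate a b S)) * (ε (conjugate a b S) * g′ (conjugate a b S))
        ≡⟨ cong₂ (λ u v → u * (ε (conjugate a b S) * v)) (conjugate-columns col≡ S) (g′≡g S) ⟩
      𝟙 (preservesColumns? S) * (ε (conjugate a b S) * g S)
        ≡⟨ 𝟙-guard (preservesColumns? S) (λ pres → cong (_* g S) (ε-conjugate a≢b col≡ S pres)) ⟩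
      𝟙 (preservesColumns? S) * ((- ε S) * g S)
        ≡⟨ neg-out _ (ε S) (g S) ⟩
      - (𝟙 (preservesColumns? S) * (ε S * g S)) ∎

  Collision : {A : Set} → (Fin (n ℕ.* 2) → A) → Set
  Collision f = ∃₂ λ a b → column la a ≡ column la b × f a ≡ f b × a ≢ b

  collision? : ∀ {A : Set} → DecidableEquality A → (f : Fin (n ℕ.* 2) → A) → Dec (Collision f)
  collision? _≟A_ f = Finₚ.any? (λ a → Finₚ.any? (λ b →
    (column la a ℕ.≟ column la b) ×-dec (f a ≟A f b) ×-dec ¬? (a Fin.≟ b)))

  ¬collision⇒injective : ∀ {A : Set} {f : Fin (n ℕ.* 2) → A} → ¬ Collision f →
                         ∀ i j → column la i ≡ column la j → f i ≡ f j → i ≡ j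
  ¬collision⇒injective none i j col≡ f≡ = case i Fin.≟ j of λ
    { (yes i≡j) → i≡j ; (no i≢j) → contradiction (i , j , col≡ , f≡ , i≢j) none }

  zonal : SymFun n
  zonal = Sum (admissibleCouples la) (λ (S₁ , S₂) → sign (standard n) S₁ • p (loops S₁ S₂))

  zonal≡ : ∀ ρ → zonal ρ ≡ ∑ (pairPartitions n) (λ S₁ → ∑ (pairPartitions n) (λ S₂ →
           𝟙 (preservesColumns? S₁) * 𝟙 (preservesRows? S₂) * (ε S₁ * p (loops S₁ S₂) ρ)))
  zonal≡ ρ = begin
    zonal ρ
      ≡⟨ ∑≡ (admissibleCouples la) _ ⟩
    ∑ (admissibleCouples la) (λ (S₁ , S₂) → ε S₁ ℚ.* p (loops S₁ S₂) ρ)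
      ≡⟨ ∑-filter (admissible? la) (cartesianProduct (pairPartitions n) (pairPartitions n)) _ ⟩
    ∑ (cartesianProduct (pairPartitions n) (pairPartitions n))
      (λ (S₁ , S₂) → 𝟙 (admissible? la (S₁ , S₂)) * (ε S₁ ℚ.* p (loops S₁ S₂) ρ))
      ≡⟨ ∑-cartesianProductWith _,_ (pairPartitions n) (pairPartitions n) _ ⟩
    ∑ (pairPartitions n) (λ S₁ → ∑ (pairPartitions n) (λ S₂ →
      𝟙 (preservesColumns? S₁ ×-dec preservesRows? S₂) * (ε S₁ ℚ.* p (loops S₁ S₂) ρ)))
      ≡⟨ ∑-cong (pairPartitions n) (λ S₁ → ∑-cong (pairPartitions n) (λ S₂ →
           cong₂ _*_ (𝟙-× (preservesColumns? S₁) (preservesRows? S₂)) (*≡ (ε S₁) (p (loops S₁ S₂) ρ)))) ⟩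
    ∑ (pairPartitions n) (λ S₁ → ∑ (pairPartitions n) (λ S₂ →
      𝟙 (preservesColumns? S₁) * 𝟙 (preservesRows? S₂) * (ε S₁ * p (loops S₁ S₂) ρ))) ∎
    where open ≡-Reasoning

  ∑-zonal : ∀ (c : Partition n → ℚ) → ∑ (partitions n) (λ ρ → zonal ρ * c ρ) ≡
    ∑ (pairPartitions n) (λ S₁ → ∑ (pairPartitions n) (λ S₂ →
      𝟙 (preservesColumns? S₁) * 𝟙 (preservesRows? S₂) *
      (ε S₁ * ∑ (partitions n) (λ ρ → p (loops S₁ S₂) ρ * c ρ))))
  ∑-zonal c = begin
    ∑ Ps (λ ρ → zonal ρ * c ρ)
      ≡⟨ ∑-cong Ps (λ ρ → trans (cong (_* c ρ) (zonal≡ ρ)) (trans (∑-*ʳ (c ρ) PP _)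
           (∑-cong PP (λ S₁ → trans (∑-*ʳ (c ρ) PP _) (∑-cong PP (λ S₂ → assoc _ _ (ε S₁) _ (c ρ))))))) ⟩
    ∑ Ps (λ ρ → ∑ PP (λ S₁ → ∑ PP (λ S₂ → u S₁ S₂ * (ε S₁ * (p (loops S₁ S₂) ρ * c ρ)))))
      ≡⟨ ∑-swap Ps PP _ ⟩
    ∑ PP (λ S₁ → ∑ Ps (λ ρ → ∑ PP (λ S₂ → u S₁ S₂ * (ε S₁ * (p (loops S₁ S₂) ρ * c ρ)))))
      ≡⟨ ∑-cong PP (λ S₁ → trans (∑-swap Ps PP _) (∑-cong PP (λ S₂ → sym
           (trans (cong (u S₁ S₂ *_) (∑-*ˡ (ε S₁) Ps _)) (∑-*ˡ (u S₁ S₂) Ps _))))) ⟩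
    ∑ PP (λ S₁ → ∑ PP (λ S₂ → u S₁ S₂ * (ε S₁ * ∑ Ps (λ ρ → p (loops S₁ S₂) ρ * c ρ)))) ∎
    where
    open ≡-Reasoning
    Ps = partitions n
    PP = pairPartitions n
    u : PairPartition n → PairPartition n → ℚ
    u S₁ S₂ = 𝟙 (preservesColumns? S₁) * 𝟙 (preservesRows? S₂)
    assoc : ∀ a b d e f → (a * b * (d * e)) * f ≡ a * b * (d * (e * f))
    assoc = solve 5 (λ a b d e f → (a :* b :* (d :* e)) :* f := a :* b :* (d :* (e :* f))) refl

  coeff-zonal : ∀ e → coeff e zonal ≡
    ∑ (pairPartitions n) (λ S₁ → ∑ (pairPartitions n) (λ S₂ →
      𝟙 (preservesColumns? S₁) * 𝟙 (preservesRows? S₂) * (ε S₁ * fromℕ (powerSumCoeff (loops S₁ S₂) e))))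
  coeff-zonal e = trans (coeff≡ e zonal) (trans (∑-zonal _)
    (∑-cong (pairPartitions n) (λ S₁ → ∑-cong (pairPartitions n) (λ S₂ →
      cong (λ x → 𝟙 (preservesColumns? S₁) * 𝟙 (preservesRows? S₂) * (ε S₁ * x)) (value S₁ S₂)))))
    where
    value : ∀ S₁ S₂ → ∑ (partitions n) (λ ρ → p (loops S₁ S₂) ρ * fromℕ (powerSumCoeff (parts ρ) e)) ≡
                      fromℕ (powerSumCoeff (loops S₁ S₂) e)
    value S₁ S₂ = trans (∑-p (loops S₁ S₂) (Graph.loops-positive S₁ S₂) (Graph.sum-loops S₁ S₂) _)
      (cong fromℕ (powerSumCoeff-↭ (sortedDecreasing-↭ (loops S₁ S₂)) e))

  content-below : ∀ {k} (e : Vec ℕ k) (w : Vec (Fin k) (n ℕ.* 2)) → HasContent e w → ∀ l →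
    ∑ (allFin (n ℕ.* 2)) (λ i → 𝟙 (toℕ (lookup w i) ℕ.<? l)) ≡ fromℕ (2 ℕ.* sum (take l (Vec.toList e)))
  content-below {k} e w content l = begin
    ∑ (allFin (n ℕ.* 2)) (λ i → 𝟙 (toℕ (lookup w i) ℕ.<? l))
      ≡⟨ ∑-cong (allFin (n ℕ.* 2)) (λ i → sym (∑-δ (finE k) (lookup w i) (λ j → 𝟙 (toℕ j ℕ.<? l)))) ⟩
    ∑ (allFin (n ℕ.* 2)) (λ i → ∑ (allFin k) (λ j → 𝟙 (j Fin.≟ lookup w i) * 𝟙 (toℕ j ℕ.<? l)))
      ≡⟨ ∑-swap (allFin (n ℕ.* 2)) (allFin k) _ ⟩
    ∑ (allFin k) (λ j → ∑ (allFin (n ℕ.* 2)) (λ i → 𝟙 (j Fin.≟ lookup w i) * 𝟙 (toℕ j ℕ.<? l)))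
      ≡⟨ ∑-cong (allFin k) (λ j → trans (sym (∑-*ʳ (𝟙 (toℕ j ℕ.<? l)) (allFin (n ℕ.* 2)) _))
           (cong (_* 𝟙 (toℕ j ℕ.<? l)) (trans (∑-cong (allFin (n ℕ.* 2)) (λ i →
             𝟙-cong (j Fin.≟ lookup w i) (lookup w i Fin.≟ j) sym sym)) (content j)))) ⟩
    ∑ (allFin k) (λ j → fromℕ (lookup e j ℕ.* 2) * 𝟙 (toℕ j ℕ.<? l))
      ≡⟨ prefix e l ⟩
    fromℕ (2 ℕ.* sum (take l (Vec.toList e))) ∎
    where
    open ≡-Reasoning
    prefix : ∀ {k} (e : Vec ℕ k) l → ∑ (allFin k) (λ j → fromℕ (lookup e j ℕ.* 2) * 𝟙 (toℕ j ℕ.<? l)) ≡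
             fromℕ (2 ℕ.* sum (take l (Vec.toList e)))
    prefix {k} e zero = trans (∑-zero (allFin k) (λ j → trans (cong (fromℕ (lookup e j ℕ.* 2) *_)
      (𝟙-no (toℕ j ℕ.<? 0) λ ())) (zeroʳ _))) (sym fromℕ-0)
    prefix []      (suc l) = sym fromℕ-0
    prefix {suc k} (a ∷ e) (suc l) = begin
      ∑ (allFin (suc k)) (λ j → fromℕ (lookup (a ∷ e) j ℕ.* 2) * 𝟙 (toℕ j ℕ.<? suc l))
        ≡⟨ ∑-allFin-suc k _ ⟩
      fromℕ (a ℕ.* 2) * 𝟙 (0 ℕ.<? suc l) + ∑ (allFin k) (λ j → fromℕ (lookup e j ℕ.* 2) * 𝟙 (suc (toℕ j) ℕ.<? suc l))
        ≡⟨ cong₂ _+_ (trans (cong (fromℕ (a ℕ.* 2) *_) (𝟙-yes (0 ℕ.<? suc l) (s≤s z≤n))) (*-identityʳ _))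
             (trans (∑-cong (allFin k) (λ j → cong (fromℕ (lookup e j ℕ.* 2) *_)
               (𝟙-cong (suc (toℕ j) ℕ.<? suc l) (toℕ j ℕ.<? l) ℕₚ.≤-pred s≤s))) (prefix e l)) ⟩
      fromℕ (a ℕ.* 2) + fromℕ (2 ℕ.* sum (take l (Vec.toList e)))
        ≡⟨ sym (fromℕ-+ (a ℕ.* 2) _) ⟩
      fromℕ (a ℕ.* 2 ℕ.+ 2 ℕ.* sum (take l (Vec.toList e)))
        ≡⟨ cong fromℕ (trans (cong (ℕ._+ 2 ℕ.* sum (take l (Vec.toList e))) (ℕₚ.*-comm a 2))
             (sym (ℕₚ.*-distribˡ-+ 2 a (sum (take l (Vec.toList e)))))) ⟩
      fromℕ (2 ℕ.* (a ℕ.+ sum (take l (Vec.toList e)))) ∎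

  zonal-triangular : ∀ μ → ¬ (μ ⊴ la) → coeff (parts μ) zonal ≡ 0ℚ
  zonal-triangular μ μ⋬la = begin
    coeff (parts μ) zonal
      ≡⟨ coeff-zonal (parts μ) ⟩
    ∑ PP (λ S₁ → ∑ PP (λ S₂ → C S₁ * R S₂ * (ε S₁ * fromℕ (powerSumCoeff (loops S₁ S₂) (parts μ)))))
      ≡⟨ ∑-cong PP (λ S₁ → ∑-cong PP (λ S₂ → cong (λ x → C S₁ * R S₂ * (ε S₁ * x))
           (trans (cong (λ e → fromℕ (powerSumCoeff (loops S₁ S₂) e)) (sym (Vecₚ.toList∘fromList (parts μ))))
                  (Colouring.powerSumCoeff-loops S₁ S₂ e)))) ⟩
    ∑ PP (λ S₁ → ∑ PP (λ S₂ → C S₁ * R S₂ * (ε S₁ * ∑ ws (λ w →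
      𝟙 (invariant? S₁ w) * 𝟙 (invariant? S₂ w) * 𝟙 (hasContent? e w)))))
      ≡⟨ ∑-factor PP PP ws C ε R (λ S w → 𝟙 (invariant? S w)) (λ S w → 𝟙 (invariant? S w)) (λ w → 𝟙 (hasContent? e w)) ⟩
    ∑ ws (λ w → 𝟙 (hasContent? e w) * (∑ PP (λ S → C S * (ε S * 𝟙 (invariant? S w))) * ∑ PP (λ S → R S * 𝟙 (invariant? S w))))
      ≡⟨ ∑-zero ws (λ w → trans (𝟙-guard (hasContent? e w) (λ content →
           trans (cong (_* rowSum w) (columnSum≡0 w content)) (zeroˡ (rowSum w)))) (zeroʳ (𝟙 (hasContent? e w)))) ⟩
    0ℚ ∎
    where
    open ≡-Reasoning
    PP = pairPartitions n
    C R : PairPartition n → ℚ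
    C S = 𝟙 (preservesColumns? S)
    R S = 𝟙 (preservesRows? S)
    k = length (parts μ)
    e = Vec.fromList (parts μ)
    ws = tuples (allFin k) (n ℕ.* 2)
    rowSum : Vec (Fin k) (n ℕ.* 2) → ℚ
    rowSum w = ∑ PP (λ S → R S * 𝟙 (invariant? S w))
    columnSum≡0 : ∀ w → HasContent e w → ∑ PP (λ S → C S * (ε S * 𝟙 (invariant? S w))) ≡ 0ℚ
    columnSum≡0 w content with collision? Fin._≟_ (lookup w)
    ... | yes (a , b , col≡ , w≡ , a≢b) = ≡-neg⇒≡0 _ (columnSum-conjugate a≢b col≡ _ _
            (𝟙-conjugate a b (λ S → invariant? S w) (conjugate-equivariant a b (lookup w) id w≡)))
    ... | no none = contradiction (column-injective⇒⊴ μ (toℕ ∘ lookup w)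
            (λ i j col≡ w≡ → ¬collision⇒injective none i j col≡ (Finₚ.toℕ-injective w≡))
            (λ l → trans (content-below e w content l)
              (cong (λ ks → fromℕ (2 ℕ.* sum (take l ks))) (Vecₚ.toList∘fromList (parts μ))))) μ⋬la

-- Orthogonality

intertwines? : ∀ {n} (S T : PairPartition n) (w : Vec (Fin (n ℕ.* 2)) (n ℕ.* 2)) →
               Dec (∀ i → lookup w (⟦ S ⟧ i) ≡ ⟦ T ⟧ (lookup w i))
intertwines? S T w = Finₚ.all? (λ i → lookup w (⟦ S ⟧ i) Fin.≟ ⟦ T ⟧ (lookup w i))

⟨zonal,zonal⟩ : ∀ {n} (la μ : Partition n) →
  let module L = Admissibility la
      module M = Admissibility μ
  in ⟨ L.zonal , M.zonal ⟩ ≡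
     ∑ (tuples (allFin (n ℕ.* 2)) (n ℕ.* 2)) (λ w → 𝟙 (injective? w) *
       (∑ (pairPartitions n) (λ S → 𝟙 (L.preservesColumns? S) * (L.ε S *
          ∑ (pairPartitions n) (λ T → 𝟙 (M.preservesColumns? T) * (M.ε T * 𝟙 (intertwines? S T w))))) *
        ∑ (pairPartitions n) (λ S → 𝟙 (L.preservesRows? S) *
          ∑ (pairPartitions n) (λ T → 𝟙 (M.preservesRows? T) * 𝟙 (intertwines? S T w)))))
⟨zonal,zonal⟩ {n} la μ = begin
  ⟨ L.zonal , M.zonal ⟩
    ≡⟨ ⟨⟩≡ L.zonal M.zonal ⟩
  ∑ Ps (λ ρ → L.zonal ρ * M.zonal ρ * jackWeight ρ)
    ≡⟨ ∑-cong Ps (λ ρ → *-assoc (L.zonal ρ) (M.zonal ρ) (jackWeight ρ)) ⟩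
  ∑ Ps (λ ρ → L.zonal ρ * (M.zonal ρ * jackWeight ρ))
    ≡⟨ L.∑-zonal (λ ρ → M.zonal ρ * jackWeight ρ) ⟩
  ∑ PP (λ S₁ → ∑ PP (λ S₂ → 𝟙 (L.preservesColumns? S₁) * 𝟙 (L.preservesRows? S₂) *
    (L.ε S₁ * ∑ Ps (λ ρ → p (loops S₁ S₂) ρ * (M.zonal ρ * jackWeight ρ)))))
    ≡⟨ ∑-cong PP (λ S₁ → ∑-cong PP (λ S₂ →
         cong (λ x → 𝟙 (L.preservesColumns? S₁) * 𝟙 (L.preservesRows? S₂) * (L.ε S₁ * x)) (inner S₁ S₂))) ⟩
  ∑ PP (λ S₁ → ∑ PP (λ S₂ → 𝟙 (L.preservesColumns? S₁) * 𝟙 (L.preservesRows? S₂) *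
    (L.ε S₁ * ∑ ws (λ w → x S₁ w * y S₂ w * 𝟙 (injective? w)))))
    ≡⟨ ∑-factor PP PP ws (λ S → 𝟙 (L.preservesColumns? S)) L.ε (λ S → 𝟙 (L.preservesRows? S)) x y (λ w → 𝟙 (injective? w)) ⟩
  ∑ ws (λ w → 𝟙 (injective? w) *
    (∑ PP (λ S → 𝟙 (L.preservesColumns? S) * (L.ε S * x S w)) * ∑ PP (λ S → 𝟙 (L.preservesRows? S) * y S w))) ∎
  where
  open ≡-Reasoning
  module L = Admissibility la
  module M = Admissibility μ
  Ps = partitions n
  PP = pairPartitions n
  ws = tuples (allFin (n ℕ.* 2)) (n ℕ.* 2)
  x y : PairPartition n → Vec (Fin (n ℕ.* 2)) (n ℕ.* 2) → ℚ
  x S w = ∑ PP (λ T → 𝟙 (M.preservesColumns? T) * (M.ε T * 𝟙 (intertwines? S T w)))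
  y S w = ∑ PP (λ T → 𝟙 (M.preservesRows? T) * 𝟙 (intertwines? S T w))
  regroup : ∀ a b d → a * (b * d) ≡ b * (a * d)
  regroup = solve 3 (λ a b d → a :* (b :* d) := b :* (a :* d)) refl
  inner : ∀ S₁ S₂ → ∑ Ps (λ ρ → p (loops S₁ S₂) ρ * (M.zonal ρ * jackWeight ρ)) ≡
                    ∑ ws (λ w → x S₁ w * y S₂ w * 𝟙 (injective? w))
  inner S₁ S₂ = begin
    ∑ Ps (λ ρ → p (loops S₁ S₂) ρ * (M.zonal ρ * jackWeight ρ))
      ≡⟨ ∑-cong Ps (λ ρ → regroup (p (loops S₁ S₂) ρ) (M.zonal ρ) (jackWeight ρ)) ⟩
    ∑ Ps (λ ρ → M.zonal ρ * (p (loops S₁ S₂) ρ * jackWeight ρ))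
      ≡⟨ M.∑-zonal (λ ρ → p (loops S₁ S₂) ρ * jackWeight ρ) ⟩
    ∑ PP (λ T₁ → ∑ PP (λ T₂ → 𝟙 (M.preservesColumns? T₁) * 𝟙 (M.preservesRows? T₂) *
      (M.ε T₁ * ∑ Ps (λ ρ → p (loops T₁ T₂) ρ * (p (loops S₁ S₂) ρ * jackWeight ρ)))))
      ≡⟨ ∑-cong PP (λ T₁ → ∑-cong PP (λ T₂ →
           cong (λ z → 𝟙 (M.preservesColumns? T₁) * 𝟙 (M.preservesRows? T₂) * (M.ε T₁ * z)) (count T₁ T₂))) ⟩
    ∑ PP (λ T₁ → ∑ PP (λ T₂ → 𝟙 (M.preservesColumns? T₁) * 𝟙 (M.preservesRows? T₂) *
      (M.ε T₁ * ∑ ws (λ w → 𝟙 (intertwines? S₁ T₁ w) * 𝟙 (intertwines? S₂ T₂ w) * 𝟙 (injective? w)))))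
      ≡⟨ ∑-factor PP PP ws (λ T → 𝟙 (M.preservesColumns? T)) M.ε (λ T → 𝟙 (M.preservesRows? T))
           (λ T w → 𝟙 (intertwines? S₁ T w)) (λ T w → 𝟙 (intertwines? S₂ T w)) (λ w → 𝟙 (injective? w)) ⟩
    ∑ ws (λ w → 𝟙 (injective? w) * (x S₁ w * y S₂ w))
      ≡⟨ ∑-cong ws (λ w → *-comm (𝟙 (injective? w)) (x S₁ w * y S₂ w)) ⟩
    ∑ ws (λ w → x S₁ w * y S₂ w * 𝟙 (injective? w)) ∎
    where
    count : ∀ T₁ T₂ → ∑ Ps (λ ρ → p (loops T₁ T₂) ρ * (p (loops S₁ S₂) ρ * jackWeight ρ)) ≡
                      ∑ ws (λ w → 𝟙 (intertwines? S₁ T₁ w) * 𝟙 (intertwines? S₂ T₂ w) * 𝟙 (injective? w))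
    count T₁ T₂ = begin
      ∑ Ps (λ ρ → p (loops T₁ T₂) ρ * (p (loops S₁ S₂) ρ * jackWeight ρ))
        ≡⟨ ∑-cong Ps (λ ρ → swap-assoc (p (loops T₁ T₂) ρ) (p (loops S₁ S₂) ρ) (jackWeight ρ)) ⟩
      ∑ Ps (λ ρ → p (loops S₁ S₂) ρ * p (loops T₁ T₂) ρ * jackWeight ρ)
        ≡⟨ sym (⟨⟩≡ (p {n} (loops S₁ S₂)) (p (loops T₁ T₂))) ⟩
      ⟨ p {n} (loops S₁ S₂) , p (loops T₁ T₂) ⟩
        ≡⟨ ⟨loops,loops⟩ S₁ S₂ T₁ T₂ ⟩
      ∑ ws (λ w → 𝟙 (intertwines? S₁ T₁ w ×-dec intertwines? S₂ T₂ w) * 𝟙 (injective? w))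
        ≡⟨ ∑-cong ws (λ w → cong (_* 𝟙 (injective? w)) (𝟙-× (intertwines? S₁ T₁ w) (intertwines? S₂ T₂ w))) ⟩
      ∑ ws (λ w → 𝟙 (intertwines? S₁ T₁ w) * 𝟙 (intertwines? S₂ T₂ w) * 𝟙 (injective? w)) ∎
      where
      swap-assoc : ∀ a b d → a * (b * d) ≡ b * a * d
      swap-assoc = solve 3 (λ a b d → a :* (b :* d) := b :* a :* d) refl

module Orthogonality {n : ℕ} (la μ : Partition n) (μ⋬la : ¬ (μ ⊴ la)) where

  private
    m = n ℕ.* 2
    PP = pairPartitions n
    module L = Admissibility la
    module M = Admissibility μ

  rowWord : Vec (Fin m) m → Vec ℕ m
  rowWord w = tabulate (λ i → row μ (lookup w i))

  lookup-rowWord : ∀ w i → lookup (rowWord w) i ≡ row μ (lookup w i)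
  lookup-rowWord w = Vecₚ.lookup∘tabulate _

  precompose : Fin m → Fin m → Vec (Fin m) m → Vec (Fin m) m
  precompose a b w = tabulate (lookup w ∘ transpose a b)

  lookup-precompose : ∀ a b w i → lookup (precompose a b w) i ≡ lookup w (transpose a b i)
  lookup-precompose a b w = Vecₚ.lookup∘tabulate _

  precompose-involutive : ∀ a b w → precompose a b (precompose a b w) ≡ w
  precompose-involutive a b w = trans
    (Vecₚ.tabulate-cong (λ i → trans (lookup-precompose a b w _) (cong (lookup w) (transpose-involutive a b i))))
    (Vecₚ.tabulate∘lookup w)

  collisionIn? : ∀ v → Dec (L.Collision (lookup v))
  collisionIn? v = L.collision? ℕ._≟_ (lookup v)

  -- w is composed with the transposition of its first collision; as this
  -- does not change rowWord w, the same collision is found again.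
  flipBy : ∀ (v : Vec ℕ m) → Dec (L.Collision (lookup v)) → Vec (Fin m) m → Vec (Fin m) m
  flipBy v (yes (a , b , _)) w = precompose a b w
  flipBy v (no _)            w = w

  flip : Vec (Fin m) m → Vec (Fin m) m
  flip w = flipBy (rowWord w) (collisionIn? (rowWord w)) w

  rowWord-precompose : ∀ {a b} w → lookup (rowWord w) a ≡ lookup (rowWord w) b →
                       rowWord (precompose a b w) ≡ rowWord w
  rowWord-precompose {a} {b} w eq = Vecₚ.tabulate-cong (λ i → trans (cong (row μ) (lookup-precompose a b w i))
    (transpose-invariant a b (row μ ∘ lookup w)
      (trans (sym (lookup-rowWord w a)) (trans eq (lookup-rowWord w b))) i))

  rowWord-flipBy : ∀ v (d : Dec (L.Collision (lookup v))) w → v ≡ rowWord w → rowWord (flipBy v d w) ≡ rowWord w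
  rowWord-flipBy v (yes (a , b , _ , eq , _)) w refl = rowWord-precompose w eq
  rowWord-flipBy v (no _)                     w _    = refl

  flipBy-involutive : ∀ v (d : Dec (L.Collision (lookup v))) w → flipBy v d (flipBy v d w) ≡ w
  flipBy-involutive v (yes (a , b , _)) w = precompose-involutive a b w
  flipBy-involutive v (no _)            w = refl

  flip-involutive : ∀ w → flip (flip w) ≡ w
  flip-involutive w = trans
    (cong (λ v → flipBy v (collisionIn? v) (flip w)) (rowWord-flipBy (rowWord w) (collisionIn? (rowWord w)) w refl))
    (flipBy-involutive (rowWord w) (collisionIn? (rowWord w)) w)

  columnPart rowPart : Vec (Fin m) m → ℚ
  columnPart w = ∑ PP (λ S → 𝟙 (L.preservesColumns? S) * (L.ε S *
    ∑ PP (λ T → 𝟙 (M.preservesColumns? T) * (M.ε T * 𝟙 (intertwines? S T w)))))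
  rowPart w = ∑ PP (λ S → 𝟙 (L.preservesRows? S) *
    ∑ PP (λ T → 𝟙 (M.preservesRows? T) * 𝟙 (intertwines? S T w)))

  module _ (a b : Fin m) (w : Vec (Fin m) m) where

    private
      t = transpose a b
      w′ = precompose a b w

    columnPart-flip : a ≢ b → column la a ≡ column la b → columnPart w′ ≡ - columnPart w
    columnPart-flip a≢b col≡ = L.columnSum-conjugate a≢b col≡ _ _ (λ S → ∑-cong PP (λ T →
      cong (λ x → 𝟙 (M.preservesColumns? T) * (M.ε T * x)) (𝟙-cong
        (intertwines? (conjugate a b S) T w′) (intertwines? S T w) (from S T) (to S T))))
      where
      open ≡-Reasoning
      left : ∀ S i → lookup w′ (⟦ conjugate a b S ⟧ i) ≡ lookup w (⟦ S ⟧ (t i))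
      left S i = begin
        lookup w′ (⟦ conjugate a b S ⟧ i)     ≡⟨ lookup-precompose a b w _ ⟩
        lookup w (t (⟦ conjugate a b S ⟧ i))  ≡⟨ cong (lookup w ∘ t) (⟦conjugate⟧ a b S i) ⟩
        lookup w (t (t (⟦ S ⟧ (t i))))        ≡⟨ cong (lookup w) (transpose-involutive a b _) ⟩
        lookup w (⟦ S ⟧ (t i))                ∎
      to : ∀ S T → (∀ i → lookup w (⟦ S ⟧ i) ≡ ⟦ T ⟧ (lookup w i)) →
           ∀ i → lookup w′ (⟦ conjugate a b S ⟧ i) ≡ ⟦ T ⟧ (lookup w′ i)
      to S T eqv i = trans (left S i) (trans (eqv (t i)) (cong ⟦ T ⟧ (sym (lookup-precompose a b w i))))
      from : ∀ S T → (∀ i → lookup w′ (⟦ conjugate a b S ⟧ i) ≡ ⟦ T ⟧ (lookup w′ i)) →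
             ∀ i → lookup w (⟦ S ⟧ i) ≡ ⟦ T ⟧ (lookup w i)
      from S T eqv i = begin
        lookup w (⟦ S ⟧ i)                       ≡⟨ cong (lookup w ∘ ⟦ S ⟧) (sym (transpose-involutive a b i)) ⟩
        lookup w (⟦ S ⟧ (t (t i)))               ≡⟨ sym (left S (t i)) ⟩
        lookup w′ (⟦ conjugate a b S ⟧ (t i))    ≡⟨ eqv (t i) ⟩
        ⟦ T ⟧ (lookup w′ (t i))                  ≡⟨ cong ⟦ T ⟧ (lookup-precompose a b w (t i)) ⟩
        ⟦ T ⟧ (lookup w (t (t i)))               ≡⟨ cong (⟦ T ⟧ ∘ lookup w) (transpose-involutive a b i) ⟩
        ⟦ T ⟧ (lookup w i)                       ∎

    rowPart-flip : Injective w →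
                   row μ (lookup w a) ≡ row μ (lookup w b) → rowPart w′ ≡ rowPart w
    rowPart-flip w-inj row≡ = ∑-cong PP (λ S → cong (𝟙 (L.preservesRows? S) *_) (trans
      (∑-involution (pairPartitionsE n) (conjugate a′ b′) (conjugate-involutive a′ b′) _)
      (∑-cong PP (λ T → cong₂ _*_ (M.conjugate-rows row≡ T)
        (𝟙-cong (intertwines? S (conjugate a′ b′ T) w′) (intertwines? S T w) (from S T) (to S T))))))
      where
      open ≡-Reasoning
      a′ = lookup w a
      b′ = lookup w b
      t′ = transpose a′ b′
      transported : ∀ x → t′ (lookup w x) ≡ lookup w (t x)
      transported x = case x Fin.≟ a of λ
        { (yes refl) → trans (transpose-a a′ b′) (cong (lookup w) (sym (transpose-a a b)))
        ; (no x≢a)   → case x Fin.≟ b of λ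
            { (yes refl) → trans (transpose-b a′ b′) (cong (lookup w) (sym (transpose-b a b)))
            ; (no x≢b)   → trans (transpose-≢ a′ b′ (x≢a ∘ w-inj x a) (x≢b ∘ w-inj x b))
                                 (cong (lookup w) (sym (transpose-≢ a b x≢a x≢b))) } }
      left : ∀ S i → lookup w′ (⟦ S ⟧ i) ≡ t′ (lookup w (⟦ S ⟧ i))
      left S i = trans (lookup-precompose a b w _) (sym (transported _))
      right : ∀ T i → ⟦ conjugate a′ b′ T ⟧ (lookup w′ i) ≡ t′ (⟦ T ⟧ (lookup w i))
      right T i = trans (⟦conjugate⟧ a′ b′ T _) (cong (t′ ∘ ⟦ T ⟧) (begin
        t′ (lookup w′ i)     ≡⟨ cong t′ (lookup-precompose a b w i) ⟩
        t′ (lookup w (t i))  ≡⟨ transported (t i) ⟩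
        lookup w (t (t i))   ≡⟨ cong (lookup w) (transpose-involutive a b i) ⟩
        lookup w i           ∎))
      to : ∀ S T → (∀ i → lookup w (⟦ S ⟧ i) ≡ ⟦ T ⟧ (lookup w i)) →
           ∀ i → lookup w′ (⟦ S ⟧ i) ≡ ⟦ conjugate a′ b′ T ⟧ (lookup w′ i)
      to S T eqv i = trans (left S i) (trans (cong t′ (eqv i)) (sym (right T i)))
      from : ∀ S T → (∀ i → lookup w′ (⟦ S ⟧ i) ≡ ⟦ conjugate a′ b′ T ⟧ (lookup w′ i)) →
             ∀ i → lookup w (⟦ S ⟧ i) ≡ ⟦ T ⟧ (lookup w i)
      from S T eqv i = begin
        lookup w (⟦ S ⟧ i)           ≡⟨ sym (transpose-involutive a′ b′ _) ⟩
        t′ (t′ (lookup w (⟦ S ⟧ i))) ≡⟨ cong t′ (trans (sym (left S i)) (trans (eqv i) (right T i))) ⟩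
        t′ (t′ (⟦ T ⟧ (lookup w i))) ≡⟨ transpose-involutive a′ b′ _ ⟩
        ⟦ T ⟧ (lookup w i)           ∎

    precompose-injective : Injective w → Injective w′
    precompose-injective w-inj i j eq = trans (sym (transpose-involutive a b i)) (trans
      (cong t (w-inj (t i) (t j) (trans (sym (lookup-precompose a b w i)) (trans eq (lookup-precompose a b w j)))))
      (transpose-involutive a b j))

  summand : Vec (Fin m) m → ℚ
  summand w = 𝟙 (injective? w) * (columnPart w * rowPart w)

  summand-flip : ∀ w → summand (flip w) ≡ - summand w
  summand-flip w = by (collisionIn? (rowWord w))
    where
    open ≡-Reasoning
    neg-out : ∀ a b d → a * ((- b) * d) ≡ - (a * (b * d))
    neg-out = solve 3 (λ a b d → a :* ((:- b) :* d) := :- (a :* (b :* d))) refl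
    by : ∀ (d : Dec (L.Collision (lookup (rowWord w)))) → summand (flipBy (rowWord w) d w) ≡ - summand w
    by (no none) = trans zero′ (trans (-≡ 0ℚ) (cong -_ (sym zero′)))
      where
      not-injective : ¬ Injective w
      not-injective w-inj = μ⋬la (L.column-injective⇒⊴ μ (row μ ∘ lookup w)
        (λ i j col≡ row≡ → L.¬collision⇒injective none i j col≡
          (trans (lookup-rowWord w i) (trans row≡ (sym (lookup-rowWord w j)))))
        (λ l → trans (∑-permute (lookup w) w-inj (λ y → 𝟙 (row μ y ℕ.<? l))) (M.∑-rows-below l)))
      zero′ : summand w ≡ 0ℚ
      zero′ = 𝟙-*-no (injective? w) _ not-injective
    by (yes (a , b , col≡ , eq , a≢b)) = begin
      𝟙 (injective? w′) * (columnPart w′ * rowPart w′)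
        ≡⟨ cong (_* (columnPart w′ * rowPart w′)) (𝟙-cong (injective? w′) (injective? w)
             (λ inj → subst Injective (precompose-involutive a b w)
               (precompose-injective a b w′ inj))
             (precompose-injective a b w)) ⟩
      𝟙 (injective? w) * (columnPart w′ * rowPart w′)
        ≡⟨ 𝟙-guard (injective? w) (λ inj → cong₂ _*_ (columnPart-flip a b w a≢b col≡)
             (rowPart-flip a b w inj (trans (sym (lookup-rowWord w a)) (trans eq (lookup-rowWord w b))))) ⟩
      𝟙 (injective? w) * ((- columnPart w) * rowPart w)
        ≡⟨ neg-out (𝟙 (injective? w)) (columnPart w) (rowPart w) ⟩
      - summand w ∎
      where w′ = precompose a b w

  zonal-orthogonal : ⟨ L.zonal , M.zonal ⟩ ≡ 0ℚ
  zonal-orthogonal = trans (⟨zonal,zonal⟩ la μ)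
    (sign-reversing (tuplesE (finE m) m) flip flip-involutive summand summand-flip)

-- Normalisation

module _ {n : ℕ} (la : Partition n) where

  open Admissibility la

  private
    ones-squarefree : ∀ k → Squarefree (replicate k 1)
    ones-squarefree zero    = []
    ones-squarefree (suc k) = s≤s z≤n ∷ ones-squarefree k

    sum-ones : ∀ k → sum (replicate k 1) ≡ k
    sum-ones zero    = refl
    sum-ones (suc k) = cong suc (sum-ones k)

    unit-loops : ∀ (S₁ S₂ : PairPartition n) → All (_≡ 1) (loops S₁ S₂) → ∀ i → ⟦ S₁ ⟧ i ≡ ⟦ S₂ ⟧ i
    unit-loops S₁ S₂ ones i = trans (sym (⟦⟧-involutive S₂ _)) (cong ⟦ S₂ ⟧
      (subst (G.Closes i) period-1 (G.period-closes i)))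
      where
      module G = Graph S₁ S₂
      period-1 : G.period i ≡ 1
      period-1 = trans (G.period-resp-~ (G.~-rep i))
        (All.lookup (Allₚ.map⁻ {f = G.period} (subst (All (_≡ 1)) G.loops≡ ones)) (G.∈-reps (G.rep-isRep i)))

    standard-loops : ∀ (S : PairPartition n) → All (_≡ 1) (loops S S)
    standard-loops S = subst (All (_≡ 1)) (sym G.loops≡) (Allₚ.map⁺ (All.universal period-1 G.reps))
      where
      module G = Graph S S
      period-1 : ∀ i → G.period i ≡ 1
      period-1 i = ℕₚ.≤-antisym
        (ℕₚ.≮⇒≥ (λ 1<P → G.period-minimal i 1 (s≤s z≤n) 1<P (⟦⟧-involutive S i))) (s≤s z≤n)

    length-ones : ∀ {ks} → All (_≡ 1) ks → length ks ≡ sum ks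
    length-ones []            = refl
    length-ones (refl ∷ ones) = cong suc (length-ones ones)

    ones-coeff : ℕ → List ℕ → ℕ
    ones-coeff n ks = powerSumCoeff ks (replicate n 1)

    std = standard n

    term : PairPartition n → PairPartition n → ℚ
    term S₁ S₂ = 𝟙 (preservesColumns? S₁) * 𝟙 (preservesRows? S₂) * (ε S₁ * fromℕ (ones-coeff n (loops S₁ S₂)))

    only-standard : ∀ S₁ S₂ → PreservesColumns S₁ → PreservesRows S₂ → ones-coeff n (loops S₁ S₂) ≢ 0 →
                    S₁ ≡ std × S₂ ≡ std
    only-standard S₁ S₂ columns rows ≢0 = ⟦⟧-injective S₁≡ , ⟦⟧-injective (λ i → trans (sym (equal i)) (S₁≡ i))
      where
      equal : ∀ i → ⟦ S₁ ⟧ i ≡ ⟦ S₂ ⟧ i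
      equal = unit-loops S₁ S₂ (powerSumCoeff-squarefree≢0 (loops S₁ S₂) (Graph.loops-positive S₁ S₂)
        (replicate n 1) (ones-squarefree n) ≢0)
      fixed : ∀ i → ⟦ std ⟧ (⟦ S₁ ⟧ i) ≡ i
      fixed i = box-injective (trans (row-standard (⟦ S₁ ⟧ i)) (trans (cong (row la) (equal i)) (rows i))) (columns i)
      S₁≡ : ∀ i → ⟦ S₁ ⟧ i ≡ ⟦ std ⟧ i
      S₁≡ i = trans (sym (⟦⟧-involutive std _)) (cong ⟦ std ⟧ (fixed i))

    term-vanishes : ∀ S₁ S₂ → ¬ (S₁ ≡ std × S₂ ≡ std) → term S₁ S₂ ≡ 0ℚ
    term-vanishes S₁ S₂ ≢std = trans (cong (_* rest) (sym (𝟙-× (preservesColumns? S₁) (preservesRows? S₂))))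
      (trans (𝟙-guard (preservesColumns? S₁ ×-dec preservesRows? S₂) {y = 0ℚ} (λ (columns , rows) →
        case ones-coeff n (loops S₁ S₂) ℕ.≟ 0 of λ
          { (yes eq) → trans (cong (λ k → ε S₁ * fromℕ k) eq) (trans (cong (ε S₁ *_) fromℕ-0) (zeroʳ (ε S₁)))
          ; (no neq) → contradiction (only-standard S₁ S₂ columns rows neq) ≢std })) (zeroʳ _))
      where rest = ε S₁ * fromℕ (ones-coeff n (loops S₁ S₂))

    term-standard : term std std ≡ fromℕ (n !)
    term-standard = begin
      term std std
        ≡⟨ cong (_* (ε std * fromℕ (ones-coeff n (loops std std)))) (cong₂ _*_
             (𝟙-yes (preservesColumns? std) (λ i → trans (column-standard (⟦ std ⟧ i))
               (trans (cong swapℕ (column-standard i)) (swapℕ-involutive (column la i)))))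
             (𝟙-yes (preservesRows? std) row-standard)) ⟩
      1ℚ * 1ℚ * (ε std * fromℕ (ones-coeff n (loops std std)))
        ≡⟨ cong₂ (λ a b → 1ℚ * 1ℚ * (a * b))
             (cong -1^_ (trans (cong (n ∸_) length≡n) (ℕₚ.n∸n≡0 n)))
             (cong fromℕ (powerSumCoeff-ones n (loops std std) ones length≡n (replicate n 1) (ones-squarefree n) (sum-ones n))) ⟩
      1ℚ * 1ℚ * (1ℚ * fromℕ (n !))
        ≡⟨ trans (cong (_* (1ℚ * fromℕ (n !))) (*-identityˡ 1ℚ)) (trans (*-identityˡ _) (*-identityˡ _)) ⟩
      fromℕ (n !) ∎
      where
      open ≡-Reasoning
      ones = standard-loops std
      length≡n : length (loops std std) ≡ n
      length≡n = trans (length-ones ones) (Graph.sum-loops std std)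

  zonal-normalised : coeff (replicate n 1) zonal ≡ fromℕ (n !)
  zonal-normalised = begin
    coeff (replicate n 1) zonal
      ≡⟨ coeff-zonal (replicate n 1) ⟩
    ∑ (pairPartitions n) (λ S₁ → ∑ (pairPartitions n) (term S₁))
      ≡⟨ ∑-single (pairPartitionsE n) std _ (λ S₁ S₁≢ → ∑-zero (pairPartitions n) (λ S₂ →
           term-vanishes S₁ S₂ (S₁≢ ∘ proj₁))) ⟩
    ∑ (pairPartitions n) (term std)
      ≡⟨ ∑-single (pairPartitionsE n) std _ (λ S₂ S₂≢ → term-vanishes std S₂ (S₂≢ ∘ proj₂)) ⟩
    term std std
      ≡⟨ term-standard ⟩
    fromℕ (n !) ∎
    where open ≡-Reasoning

-- Uniqueness

zero-product : ∀ a b → a * b ≡ 0ℚ → (a ≡ 0ℚ) ⊎ (b ≡ 0ℚ)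
zero-product a b ab≡0 with ℚₚ.<-cmp b 0ℚ
... | tri≈ _ b≡0 _ = inj₂ b≡0
... | tri> _ _ 0<b = inj₁ (pos-cancel a 0<b ab≡0)
... | tri< b<0 _ _ = inj₁ (pos-cancel a (neg⇒pos b<0)
        (trans (neg-*ʳ a b) (trans (cong -_ ab≡0) (sym (-≡ 0ℚ)))))
  where
  neg-*ʳ : ∀ a b → a * (- b) ≡ - (a * b)
  neg-*ʳ = solve 2 (λ a b → a :* (:- b) := :- (a :* b)) refl

square-nonneg : ∀ a → 0ℚ ℚ.≤ a * a
square-nonneg a with ℚₚ.<-cmp a 0ℚ
... | tri≈ _ refl _ = ℚₚ.≤-reflexive (sym (zeroˡ 0ℚ))
... | tri> _ _ 0<a  = ℚₚ.<⇒≤ (*-pos 0<a 0<a)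
... | tri< a<0 _ _  = subst (0ℚ ℚ.≤_) (neg*neg a a) (ℚₚ.<⇒≤ (*-pos (neg⇒pos a<0) (neg⇒pos a<0)))
  where
  neg*neg : ∀ a b → (- a) * (- b) ≡ a * b
  neg*neg = solve 2 (λ a b → (:- a) :* (:- b) := a :* b) refl

∑-nonneg≡0 : ∀ {A : Set} (xs : List A) {f : A → ℚ} → (∀ x → 0ℚ ℚ.≤ f x) → ∑ xs f ≡ 0ℚ →
             ∀ {x} → x ∈ xs → f x ≡ 0ℚ
∑-nonneg≡0 (y ∷ xs) {f} f≥0 ∑≡0 = λ { (here refl) → fy≡0 ; (there x∈) → ∑-nonneg≡0 xs f≥0 rest≡0 x∈ }
  where
  fy≡0 : f y ≡ 0ℚ
  fy≡0 with ℚₚ.<-cmp 0ℚ (f y)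
  ... | tri≈ _ eq _   = sym eq
  ... | tri> _ _ fy<0 = contradiction (ℚₚ.<-≤-trans fy<0 (f≥0 y)) (ℚₚ.<-irrefl refl)
  ... | tri< 0<fy _ _ = contradiction (sym ∑≡0) (ℚₚ.<⇒≢ (subst (ℚ._< f y + ∑ xs f) (+-identityˡ 0ℚ)
          (+-mono-<-≤ 0<fy (∑-nonneg xs f≥0))))
  rest≡0 : ∑ xs f ≡ 0ℚ
  rest≡0 = trans (sym (zero-+ (∑ xs f) fy≡0)) ∑≡0

automorphisms-positive : ∀ {ks} → Positive ks → 0 < automorphisms ks
automorphisms-positive []                       = s≤s z≤n
automorphisms-positive {suc k ∷ ks} (_ ∷ ks>0) =
  ℕₚ.*-mono-< (ℕₚ.*-mono-< {0} {suc k ℕ.* 2} {0} (s≤s z≤n) (subst (0 <_) (sym (multiplicity-≡ (suc k) ks)) (s≤s z≤n)))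
              (automorphisms-positive ks>0)

fromℕ-positive : ∀ {k} → 0 < k → 0ℚ ℚ.< fromℕ k
fromℕ-positive {suc k} _ = fromℕ-pos k

jackWeight-positive : ∀ {n} (ρ : Partition n) → 0ℚ ℚ.< jackWeight ρ
jackWeight-positive {n} ρ = fromℕ-positive (subst (0 <_) (sym (automorphisms≡ n (parts ρ)
  (subst (λ n → All (λ k → 0 < k × k ≤ n) (parts ρ)) (sum-parts ρ) (parts-bounded (parts-positive ρ)))))
  (automorphisms-positive (parts-positive ρ)))

module _ {n : ℕ} where

  combination : ℚ → SymFun n → ℚ → SymFun n → SymFun n
  combination a F b G ρ = a * F ρ + - (b * G ρ)

  ∑-combination : ∀ a F b G (w : Partition n → ℚ) →
    ∑ (partitions n) (λ ρ → combination a F b G ρ * w ρ) ≡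
    a * ∑ (partitions n) (λ ρ → F ρ * w ρ) + - (b * ∑ (partitions n) (λ ρ → G ρ * w ρ))
  ∑-combination a F b G w = begin
    ∑ Ps (λ ρ → combination a F b G ρ * w ρ)
      ≡⟨ ∑-cong Ps (λ ρ → distribute a (F ρ) b (G ρ) (w ρ)) ⟩
    ∑ Ps (λ ρ → a * (F ρ * w ρ) + - (b * (G ρ * w ρ)))
      ≡⟨ ∑-+ Ps _ _ ⟩
    ∑ Ps (λ ρ → a * (F ρ * w ρ)) + ∑ Ps (λ ρ → - (b * (G ρ * w ρ)))
      ≡⟨ cong₂ _+_ (sym (∑-*ˡ a Ps _)) (trans (∑-neg Ps _) (cong -_ (sym (∑-*ˡ b Ps _)))) ⟩
    a * ∑ Ps (λ ρ → F ρ * w ρ) + - (b * ∑ Ps (λ ρ → G ρ * w ρ)) ∎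
    where
    open ≡-Reasoning
    Ps = partitions n
    distribute : ∀ a f b g w → (a * f + - (b * g)) * w ≡ a * (f * w) + - (b * (g * w))
    distribute = solve 5 (λ a f b g w → (a :* f :+ :- (b :* g)) :* w := a :* (f :* w) :+ :- (b :* (g :* w))) refl

  coeff-combination : ∀ a F b G e → coeff e (combination a F b G) ≡ a * coeff e F + - (b * coeff e G)
  coeff-combination a F b G e = trans (coeff≡ e (combination a F b G)) (trans (∑-combination a F b G _)
    (sym (cong₂ (λ x y → a * x + - (b * y)) (coeff≡ e F) (coeff≡ e G))))

  ⟨⟩-assoc : ∀ (F G : SymFun n) → ⟨ F , G ⟩ ≡ ∑ (partitions n) (λ ρ → F ρ * (G ρ * jackWeight ρ))
  ⟨⟩-assoc F G = trans (⟨⟩≡ F G) (∑-cong (partitions n) (λ ρ → *-assoc (F ρ) (G ρ) (jackWeight ρ)))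

  ⟨⟩-combination : ∀ a F b G H → ⟨ combination a F b G , H ⟩ ≡ a * ⟨ F , H ⟩ + - (b * ⟨ G , H ⟩)
  ⟨⟩-combination a F b G H = trans (⟨⟩-assoc (combination a F b G) H) (trans (∑-combination a F b G _)
    (sym (cong₂ (λ x y → a * x + - (b * y)) (⟨⟩-assoc F H) (⟨⟩-assoc G H))))

  ⟨⟩-sym : ∀ (F G : SymFun n) → ⟨ F , G ⟩ ≡ ⟨ G , F ⟩
  ⟨⟩-sym F G = trans (⟨⟩≡ F G) (trans
    (∑-cong (partitions n) (λ ρ → cong (_* jackWeight ρ) (*-comm (F ρ) (G ρ)))) (sym (⟨⟩≡ G F)))

  ⟨⟩-cong : ∀ {F F′ G G′ : SymFun n} → F ≈ F′ → G ≈ G′ → ⟨ F , G ⟩ ≡ ⟨ F′ , G′ ⟩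
  ⟨⟩-cong {F} {F′} {G} {G′} F≈ G≈ = trans (⟨⟩≡ F G) (trans
    (∑-cong (partitions n) (λ ρ → cong₂ (λ x y → x * y * jackWeight ρ) (F≈ ρ) (G≈ ρ))) (sym (⟨⟩≡ F′ G′)))

  coeff-zero : ∀ {F : SymFun n} → F ≈ (λ _ → 0ℚ) → ∀ e → coeff e F ≡ 0ℚ
  coeff-zero {F} F≈0 e = trans (coeff≡ e F) (∑-zero (partitions n) (λ ρ →
    trans (cong (_* fromℕ (powerSumCoeff (parts ρ) e)) (F≈0 ρ)) (zeroˡ _)))

  ⟨⟩-zeroˡ : ∀ {F : SymFun n} → F ≈ (λ _ → 0ℚ) → ∀ G → ⟨ F , G ⟩ ≡ 0ℚ
  ⟨⟩-zeroˡ {F} F≈0 G = trans (⟨⟩-assoc F G) (∑-zero (partitions n) (λ ρ →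
    trans (cong (_* (G ρ * jackWeight ρ)) (F≈0 ρ)) (zeroˡ _)))

  ⟨⟩-definite : ∀ (F : SymFun n) → ⟨ F , F ⟩ ≡ 0ℚ → F ≈ (λ _ → 0ℚ)
  ⟨⟩-definite F eq ρ = [ id , id ]′ (zero-product (F ρ) (F ρ) (pos-cancel (F ρ * F ρ) (jackWeight-positive ρ)
    (∑-nonneg≡0 (partitions n) terms≥0 (trans (sym (⟨⟩≡ F F)) eq) (∈-elements (partitionsE n) ρ))))
    where
    terms≥0 : ∀ σ → 0ℚ ℚ.≤ F σ * F σ * jackWeight σ
    terms≥0 σ with ℚₚ.<-cmp 0ℚ (F σ * F σ)
    ... | tri< 0<F² _ _ = ℚₚ.<⇒≤ (*-pos 0<F² (jackWeight-positive σ))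
    ... | tri≈ _ 0≡F² _ = ℚₚ.≤-reflexive (sym (trans (cong (_* jackWeight σ) (sym 0≡F²)) (zeroˡ (jackWeight σ))))
    ... | tri> _ _ F²<0 = contradiction (ℚₚ.<-≤-trans F²<0 (square-nonneg (F σ))) (ℚₚ.<-irrefl refl)

  -- A linear extension of the dominance order.
  rank : Partition n → ℕ
  rank μ = sum (map (λ k → sum (take k (parts μ))) (upTo (suc n)))

  ⊴-rank : ∀ {μ ν : Partition n} → μ ⊴ ν → rank ν ≤ rank μ → μ ≡ ν
  ⊴-rank {μ} {ν} μ⊴ν rank≤ = ⊴-antisym μ⊴ν ν⊴μ
    where
    sum-map-mono : ∀ {f g : ℕ → ℕ} → (∀ k → f k ≤ g k) → ∀ ks → sum (map f ks) ≤ sum (map g ks)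
    sum-map-mono f≤g []       = z≤n
    sum-map-mono f≤g (k ∷ ks) = ℕₚ.+-mono-≤ (f≤g k) (sum-map-mono f≤g ks)
    termwise : ∀ {f g : ℕ → ℕ} → (∀ k → f k ≤ g k) → ∀ ks → sum (map g ks) ≤ sum (map f ks) →
               ∀ {k} → k ∈ ks → g k ≤ f k
    termwise {f} {g} f≤g (k ∷ ks) g≤f (here refl) = ℕₚ.+-cancelʳ-≤ (sum (map g ks)) (g k) (f k)
      (ℕₚ.≤-trans g≤f (ℕₚ.+-monoʳ-≤ (f k) (sum-map-mono f≤g ks)))
    termwise {f} {g} f≤g (k ∷ ks) g≤f (there k∈) = termwise f≤g ks
      (ℕₚ.+-cancelˡ-≤ (g k) _ _ (ℕₚ.≤-trans g≤f (ℕₚ.+-monoˡ-≤ (sum (map f ks)) (f≤g k)))) k∈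
    total′ : ∀ (κ : Partition n) {k} → n ≤ k → sum (take k (parts κ)) ≡ n
    total′ κ {k} n≤k = trans (cong sum (Listₚ.take-all k (parts κ) (ℕₚ.≤-trans
      (subst (length (parts κ) ≤_) (sum-parts κ) (length≤sum (parts-positive κ))) n≤k))) (sum-parts κ)
    ν⊴μ : ν ⊴ μ
    ν⊴μ k = case k ℕ.<? suc n of λ
      { (yes k≤n) → termwise μ⊴ν (upTo (suc n)) rank≤ (Memₚ.∈-upTo⁺ k≤n)
      ; (no k≰n)  → let n≤k = ℕₚ.<⇒≤ (ℕₚ.≮⇒≥ k≰n) in
                    ℕₚ.≤-reflexive (trans (total′ ν n≤k) (sym (total′ μ n≤k))) }

  record ZonalFamily (Z : Partition n → SymFun n) : Set where
    field
      triangular : ∀ la μ → ¬ (μ ⊴ la) → coeff (parts μ) (Z la) ≡ 0ℚ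
      orthogonal : ∀ la μ → la ≢ μ → ⟨ Z la , Z μ ⟩ ≡ 0ℚ
      normalised : ∀ la → coeff (replicate n 1) (Z la) ≡ fromℕ (n !)

    nonzero : ∀ la → ¬ (Z la ≈ (λ _ → 0ℚ))
    nonzero la Z≈0 = ℚₚ.<⇒≢ (fromℕ-positive (ℕₚ.1≤n! n))
      (trans (sym (coeff-zero Z≈0 (replicate n 1))) (normalised la))

  module Uniqueness {Y Z : Partition n → SymFun n} (YF : ZonalFamily Y) (ZF : ZonalFamily Z) where

    private
      module Y = ZonalFamily YF
      module Z = ZonalFamily ZF

    SupportedOn : List (Partition n) → SymFun n → Set
    SupportedOn κs F = ∀ κ → κ ∉ κs → coeff (parts κ) F ≡ 0ℚ

    DownClosed : List (Partition n) → Set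
    DownClosed κs = ∀ {κ ν} → ν ∈ κs → κ ⊴ ν → κ ∈ κs

    Spans : List (Partition n) → Set
    Spans κs = ∀ F → SupportedOn κs F → (∀ κ → κ ∈ κs → ⟨ F , Z κ ⟩ ≡ 0ℚ) → F ≈ (λ _ → 0ℚ)

    private
      cancel : ∀ a b → a * b + - (b * a) ≡ 0ℚ
      cancel a b = trans (cong (λ x → a * b + - x) (*-comm b a)) (-‿inverseʳ (a * b))

      both-zero : ∀ a b {x y} → x ≡ 0ℚ → y ≡ 0ℚ → a * x + - (b * y) ≡ 0ℚ
      both-zero a b refl refl = trans (cong₂ (λ u v → u + - v) (zeroʳ a) (zeroʳ b)) (trans (+-identityˡ _) (sym (-≡ 0ℚ)))

      _∈?_ : ∀ (κ : Partition n) κs → Dec (κ ∈ κs)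
      κ ∈? κs = Any.any? (κ ≟ᵖ_) κs

    module Step (la : Partition n) (κs : List (Partition n)) (la∉ : la ∉ κs) (closed : DownClosed (la ∷ κs)) (spans : Spans κs) where

      κ≢la : ∀ {κ} → κ ∈ κs → la ≢ κ
      κ≢la κ∈ refl = la∉ κ∈

      drop-leading : ∀ F G → SupportedOn (la ∷ κs) F → SupportedOn (la ∷ κs) G →
                     SupportedOn κs (combination (coeff (parts la) F) G (coeff (parts la) G) F)
      drop-leading F G suppF suppG κ κ∉ = trans (coeff-combination _ G _ F (parts κ)) (case κ ≟ᵖ la of λ
        { (yes refl) → cancel (coeff (parts la) F) (coeff (parts la) G)
        ; (no κ≢)    → let κ∉′ = λ { (here eq) → κ≢ eq ; (there κ∈) → κ∉ κ∈ } in
                       both-zero (coeff (parts la) F) (coeff (parts la) G) (suppG κ κ∉′) (suppF κ κ∉′) })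

      triangular⇒supported : ∀ {X : Partition n → SymFun n} → ZonalFamily X → SupportedOn (la ∷ κs) (X la)
      triangular⇒supported XF κ κ∉ = ZonalFamily.triangular XF la κ (λ κ⊴la → κ∉ (closed (here refl) κ⊴la))

      supported-drop : ∀ F → coeff (parts la) F ≡ 0ℚ → SupportedOn (la ∷ κs) F → SupportedOn κs F
      supported-drop F lead≡0 supp κ κ∉ = case κ ≟ᵖ la of λ
        { (yes refl) → lead≡0
        ; (no κ≢)    → supp κ (λ { (here eq) → κ≢ eq ; (there κ∈) → κ∉ κ∈ }) }

      leading≢0 : coeff (parts la) (Z la) ≢ 0ℚ
      leading≢0 lead≡0 = Z.nonzero la (spans (Z la) (supported-drop (Z la) lead≡0 (triangular⇒supported ZF))
        (λ κ κ∈ → Z.orthogonal la κ (κ≢la κ∈)))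

      spans-∷ : Spans (la ∷ κs)
      spans-∷ F supp orth = spans F (supported-drop F f≡0 supp) (λ κ κ∈ → orth κ (there κ∈))
        where
        c = coeff (parts la) (Z la)
        f = coeff (parts la) F
        G = combination c F f (Z la)
        G≈0 : G ≈ (λ _ → 0ℚ)
        G≈0 = spans G (drop-leading (Z la) F (triangular⇒supported ZF) supp)
          (λ κ κ∈ → trans (⟨⟩-combination c F f (Z la) (Z κ))
            (both-zero c f (orth κ (there κ∈)) (Z.orthogonal la κ (κ≢la κ∈))))
        f*norm : f * ⟨ Z la , Z la ⟩ ≡ 0ℚ
        f*norm = begin
          f * N                          ≡⟨ isolate c f ⟨ F , Z la ⟩ N ⟩
          c * ⟨ F , Z la ⟩ + - (c * ⟨ F , Z la ⟩ + - (f * N))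
            ≡⟨ both-zero′ (trans (cong (c *_) (orth la (here refl))) (zeroʳ c))
                 (trans (sym (⟨⟩-combination c F f (Z la) (Z la))) (⟨⟩-zeroˡ G≈0 (Z la))) ⟩
          0ℚ ∎
          where
          open ≡-Reasoning
          N = ⟨ Z la , Z la ⟩
          isolate : ∀ c f x N → f * N ≡ c * x + - (c * x + - (f * N))
          isolate = solve 4 (λ c f x N → f :* N := c :* x :+ :- (c :* x :+ :- (f :* N))) refl
          both-zero′ : ∀ {x y} → x ≡ 0ℚ → y ≡ 0ℚ → x + - y ≡ 0ℚ
          both-zero′ refl refl = trans (+-identityˡ _) (sym (-≡ 0ℚ))
        f≡0 : f ≡ 0ℚ
        f≡0 = [ id , (λ N≡0 → contradiction (⟨⟩-definite (Z la) N≡0) (Z.nonzero la)) ]′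
              (zero-product f ⟨ Z la , Z la ⟩ f*norm)

      agree : (∀ κ → κ ∈ κs → Y κ ≈ Z κ) → Y la ≈ Z la
      agree agreeκ ρ = difference (Y la ρ) (Z la ρ) ([ (λ c≡0 → contradiction c≡0 leading≢0) , id ]′
        (zero-product c (Y la ρ + - Z la ρ) (trans (factor c (Y la ρ) (Z la ρ))
          (trans (cong (λ d → c * Y la ρ + - (d * Z la ρ)) c≡d) (G≈0 ρ)))))
        where
        c = coeff (parts la) (Z la)
        d = coeff (parts la) (Y la)
        G = combination c (Y la) d (Z la)
        factor : ∀ c x y → c * (x + - y) ≡ c * x + - (c * y)
        factor = solve 3 (λ c x y → c :* (x :+ :- y) := c :* x :+ :- (c :* y)) refl
        difference : ∀ x y → x + - y ≡ 0ℚ → x ≡ y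
        difference x y eq = trans (split x y) (zero-+ y eq)
          where
          split : ∀ x y → x ≡ (x + - y) + y
          split = solve 2 (λ x y → x := (x :+ :- y) :+ y) refl
        G≈0 : G ≈ (λ _ → 0ℚ)
        G≈0 = spans G (drop-leading (Z la) (Y la) (triangular⇒supported ZF) (triangular⇒supported YF))
          (λ κ κ∈ → trans (⟨⟩-combination c (Y la) d (Z la) (Z κ)) (both-zero c d
            (trans (⟨⟩-cong {F = Y la} (λ _ → refl) (λ σ → sym (agreeκ κ κ∈ σ))) (Y.orthogonal la κ (κ≢la κ∈)))
            (Z.orthogonal la κ (κ≢la κ∈))))
        c≡d : c ≡ d
        c≡d = difference c d (pos-cancel (c + - d) (fromℕ-positive (ℕₚ.1≤n! n)) (begin
          (c + - d) * fromℕ (n !)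
            ≡⟨ expand c d (fromℕ (n !)) ⟩
          c * fromℕ (n !) + - (d * fromℕ (n !))
            ≡⟨ sym (cong₂ (λ x y → c * x + - (d * y)) (Y.normalised la) (Z.normalised la)) ⟩
          c * coeff (replicate n 1) (Y la) + - (d * coeff (replicate n 1) (Z la))
            ≡⟨ sym (coeff-combination c (Y la) d (Z la) (replicate n 1)) ⟩
          coeff (replicate n 1) G
            ≡⟨ coeff-zero G≈0 (replicate n 1) ⟩
          0ℚ ∎))
          where
          open ≡-Reasoning
          expand : ∀ c d x → (c + - d) * x ≡ c * x + - (d * x)
          expand = solve 3 (λ c d x → (c :+ :- d) :* x := c :* x :+ :- (d :* x)) refl

    tail-closed : ∀ {la κs} → All (λ κ → rank κ ≤ rank la) κs → DownClosed (la ∷ κs) → DownClosed κs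
    tail-closed {κs = κs} below closed {κ} {ν} ν∈ κ⊴ν with closed {κ} {ν} (there ν∈) κ⊴ν
    ... | there κ∈  = κ∈
    ... | here refl = subst (_∈ κs) (sym (⊴-rank κ⊴ν (All.lookup below ν∈))) ν∈

    Agree : List (Partition n) → Set
    Agree κs = ∀ κ → κ ∈ κs → Y κ ≈ Z κ

    spans-repeated : ∀ {la κs} → la ∈ κs → Spans κs → Spans (la ∷ κs)
    spans-repeated {la} {κs} la∈ spans F supp orth = spans F (λ κ κ∉ → supp κ (κ∉′ κ κ∉)) (λ κ κ∈ → orth κ (there κ∈))
      where
      κ∉′ : ∀ κ → κ ∉ κs → κ ∉ la ∷ κs
      κ∉′ κ κ∉ (here refl) = κ∉ la∈
      κ∉′ κ κ∉ (there κ∈)  = κ∉ κ∈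

    agree-∷ : ∀ {la κs} → Y la ≈ Z la → Agree κs → Agree (la ∷ κs)
    agree-∷ head tail κ (here refl) = head
    agree-∷ head tail κ (there κ∈)  = tail κ κ∈

    extend : ∀ la κs → Dec (la ∈ κs) → DownClosed (la ∷ κs) → Spans κs → Agree κs → Spans (la ∷ κs) × Agree (la ∷ κs)
    extend la κs (yes la∈) closed spans agree = spans-repeated la∈ spans , agree-∷ (agree la la∈) agree
    extend la κs (no la∉)  closed spans agree =
      Step.spans-∷ la κs la∉ closed spans , agree-∷ (Step.agree la κs la∉ closed spans agree) agree

    uniqueness : ∀ κs → AllPairs (λ κ ν → rank ν ≤ rank κ) κs → DownClosed κs → Spans κs × Agree κs
    uniqueness []        _               _      = (λ F supp _ → coeff-injective F (λ μ → supp μ λ ())) , λ _ ()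
    uniqueness (la ∷ κs) (below ∷ pairs) closed = extend la κs (la ∈? κs) closed (proj₁ ih) (proj₂ ih)
      where
      ih : Spans κs × Agree κs
      ih = uniqueness κs pairs (tail-closed below closed)

  private
    rankOrder = Relation.Binary.Construct.On.decTotalOrder
      (Relation.Binary.Construct.Flip.EqAndOrd.decTotalOrder ℕₚ.≤-decTotalOrder) rank

    byRank : List (Partition n)
    byRank = sort rankOrder (partitions n)

    byRank-↭ : byRank ↭ partitions n
    byRank-↭ = InsertionSortₚ.sort-↭ rankOrder (partitions n)

    ∈-byRank : ∀ κ → κ ∈ byRank
    ∈-byRank κ = Permₚ.∈-resp-↭ (↭-sym byRank-↭) (∈-elements (partitionsE n) κ)

  zonalFamily-unique : ∀ {Y Z} → ZonalFamily Y → ZonalFamily Z → ∀ la → Y la ≈ Z la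
  zonalFamily-unique YF ZF la = proj₂ (Uniqueness.uniqueness YF ZF byRank
    (Linkedₚ.Linked⇒AllPairs (λ i≥j j≥k → ℕₚ.≤-trans j≥k i≥j) (InsertionSortₚ.sort-↗ rankOrder (partitions n)))
    (λ {κ} _ _ → ∈-byRank κ)) la (∈-byRank la)

  zonal-family : ZonalFamily Admissibility.zonal
  zonal-family = record
    { triangular = Admissibility.zonal-triangular
    ; orthogonal = orthogonal
    ; normalised = zonal-normalised
    }
    where
    orthogonal : ∀ la μ → la ≢ μ → ⟨ Admissibility.zonal la , Admissibility.zonal μ ⟩ ≡ 0ℚ
    orthogonal la μ la≢μ = case ⟨ Admissibility.zonal la , Admissibility.zonal μ ⟩ ℚ.≟ 0ℚ of λ
      { (yes eq) → eq
      ; (no neq) → contradiction (Orthogonality.zonal-orthogonal la μ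
          (λ μ⊴la → neq (trans (⟨⟩-sym (Admissibility.zonal la) (Admissibility.zonal μ))
            (Orthogonality.zonal-orthogonal μ la (λ la⊴μ → la≢μ (⊴-antisym la⊴μ μ⊴la)))))) neq }

theorem1p2 : (Z : ∀ {n} → Partition n → SymFun n) → IsZonal Z →
    ∀ {n : ℕ} (la : Partition n) →
    Z la ≈ Sum (admissibleCouples la) (λ (S₁ , S₂) → sign (standard n) S₁ • p (loops S₁ S₂))
theorem1p2 Z Z-zonal {n} la = zonalFamily-unique Z-family zonal-family la
  where
  open IsZonal Z-zonal
  Z-family : ZonalFamily (Z {n})
  Z-family = record
    { triangular = triangular
    ; orthogonal = orthogonal
    ; normalised = λ μ → trans (normalised μ) (fromℕ≡ (n !))
    }
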